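{- Suppose that $n=2^a b$ where $a\ge 1$ is an integer and $b>1$ is odd. Then there is a transitive avoidance game on $n$ points which is a Player I win.
   Context: An avoidance game consists of a finite set $X$ (the board) and a family $\mathcal{L}$ of subsets of $X$ (the lines). Two players, Player I and Player II, alternately claim previously unclaimed points of $X$, Player I moving first. The first player to have claimed all points of some line loses; if all points have been claimed and neither player has completed a line, the game is a draw. The game is transitive if its automorphism group (the group of permutations of $X$ mapping $\mathcal{L}$ onto $\mathcal{L}$) acts transitively on $X$. The game is a Player I win if Player I has a strategy guaranteeing that Player II loses. -}

module Defs where

open import Data.Nat using (ℕ)
open import Data.Fin using (Fin)
open import Data.Fin.Subset using (Subset; _⊆_; ⁅_⁆; _∪_; ⊥)
open import Data.Fin.Permutation using (Permutation′; _⟨$⟩ʳ_; _⟨$⟩ˡ_)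
open import Data.Vec using (tabulate; lookup)
open import Data.List using (List; []; _∷_; _++_; [_]; foldr)
open import Data.List.Membership.Propositional using (_∈_; _∉_)
open import Data.Product using (Σ; ∃; _×_)
open import Data.Sum using (_⊎_)
open import Relation.Nullary using (¬_)
open import Relation.Binary.PropositionalEquality using (_≡_)

-- An avoidance game on the board X = Fin n: a (finite) family of lines,
-- each line a subset of the board.
AvoidanceGame : ℕ → Set
AvoidanceGame n = List (Subset n)

image : ∀ {n} → Permutation′ n → Subset n → Subset n
image π ℓ = tabulate (λ i → lookup ℓ (π ⟨$⟩ˡ i))

IsAutomorphism : ∀ {n} → AvoidanceGame n → Permutation′ n → Set
IsAutomorphism L π =
  (∀ ℓ → ℓ ∈ L → image π ℓ ∈ L) ×
  (∀ ℓ′ → ℓ′ ∈ L → Σ (Subset _) λ ℓ → ℓ ∈ L × image π ℓ ≡ ℓ′)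

IsTransitive : ∀ {n} → AvoidanceGame n → Set
IsTransitive {n} L =
  ∀ (x y : Fin n) → Σ (Permutation′ n) λ π → IsAutomorphism L π × π ⟨$⟩ʳ x ≡ y

-- Histories: lists of claimed points in chronological order.
-- Player I claims the points at even positions (0,2,4,…), Player II the others.
evens odds : ∀ {A : Set} → List A → List A
evens []       = []
evens (x ∷ xs) = x ∷ odds xs
odds []        = []
odds (x ∷ xs)  = evens xs

toSubset : ∀ {n} → List (Fin n) → Subset n
toSubset = foldr (λ x s → ⁅ x ⁆ ∪ s) ⊥

Completes : ∀ {n} → AvoidanceGame n → Subset n → Set
Completes L S = ∃ λ ℓ → ℓ ∈ L × ℓ ⊆ S

-- Winning strategies for Player I, as strategy trees (the game is finite).
-- IWinsAtI L h : at history h (game not yet over), Player I is to move and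
--   has a strategy from here guaranteeing that Player II loses.
-- IWinsAtII L h : at history h (game not yet over), Player II is to move and
--   whatever Player II does, Player II loses.
data IWinsAtI {n} (L : AvoidanceGame n) (h : List (Fin n)) : Set
data IWinsAtII {n} (L : AvoidanceGame n) (h : List (Fin n)) : Set

data IWinsAtI {n} L h where
  move : (x : Fin n) → x ∉ h →
         ¬ Completes L (toSubset (evens (h ++ [ x ]))) →
         IWinsAtII L (h ++ [ x ]) →
         IWinsAtI L h

data IWinsAtII {n} L h where
  respond : (∃ λ (y : Fin n) → y ∉ h) →   -- board not full (otherwise draw)
            (∀ (y : Fin n) → y ∉ h →
               Completes L (toSubset (odds (h ++ [ y ])))
               ⊎ (¬ Completes L (toSubset (odds (h ++ [ y ]))) × IWinsAtI L (h ++ [ y ]))) →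
            IWinsAtII L h

IsPlayerIWin : ∀ {n} → AvoidanceGame n → Set
IsPlayerIWin L = IWinsAtI L []

{-# OPTIONS --safe #-}
module Submission where

-- The board is a cycle of b = 2h + 1 blocks, each block being the set of roots of unity ± t^j,
-- j < k = 2^m, t^k = −1; the two points ± t^j form a pair. The lines are the complements of the
-- "good" sets, where good is invariant under rotating the blocks and under multiplying one block
-- by t and another one by t⁻¹, and a set and its complement are never both good. Good are
--   * the sets with one excess point in a block i and one missing in a block j dominated by i
--     in the cyclic tournament arc;
--   * the sets splitting all pairs except in one block i, for which a weighted count is positive:
--     the weight of the pair ± t^j is |C t^j|, where C ∈ ℤ[t] is the product over the other blocks
--     of the sums of their points (up to sign) and ℤ[t] carries its lexicographic order;
--   * the sets splitting every pair for which the product over all blocks is positive.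
-- Player II cannot afford a move in a block dominated by that of Player I's open pair: Player I
-- would complete the pair and then just split pairs, reaching a set of the first kind. Other moves
-- of Player II are answered in the same pair. So Player I can exhaust
-- the blocks dominating block 0 while block 0 is untouched, and then the blocks 0, …, h, which
-- are linearly ordered by domination, one after the other. In the last block in which he still
-- has two free pairs he takes the pairs by decreasing weight: now any deviation is answered by a
-- set of the second kind, and the choice of signs for two pairs suffices to make the final
-- product positive.

-- Every good set contains exactly half of the points, and so does every line. Hence Player II can
-- complete a line only with the very last move, and what Player I needs is to own a good set at the
-- end. Oddness of b enters twice: complementation negates each of the b factors of the product,
-- hence the product itself, and a rotation-invariant tournament on b blocks exists only for odd b.
-- That b > 1 provides the second block, which absorbs t⁻¹. The main obstacle is a move of Player II
-- in the very block of the open pair, where domination says nothing. The pairs of that block must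
-- be ranked, but the automorphisms permute them cyclically, so no fixed ranking is invariant.
-- Ranking by |C t^j| is: turning the block by t moves its pairs, turning another block by t⁻¹
-- changes C, and the two effects cancel. The price is that C must be under Player I's control
-- before the ranking is used. There are no ties because signed sums of all t^j are not zero
-- divisors: modulo 2 they are 1 + t + ⋯ + t^(k-1), a divisor of 2.

open import Defs
import Algebra.Properties.CommutativeMonoid.Sum as Sum
import Algebra.Properties.Ring as RingProperties
import Algebra.Solver.Ring.NaturalCoefficients.Default as SemiringSolver
open import Algebra.Bundles using (CommutativeRing)
open import Algebra.Structures using (IsCommutativeRing)
open import Data.Bool using (Bool; true; false; not; _xor_; _∧_; if_then_else_)
import Data.Bool.Properties as Bool
open import Data.Bool.Solver using (module xor-∧-Solver)
open import Data.Empty using (⊥; ⊥-elim)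
open import Data.Fin using (Fin; zero; suc; toℕ; fromℕ; inject₁)
open import Data.Fin.Induction using (<-weakInduction)
open import Data.Fin.Permutation
  using (Permutation′; permutation; flip; _⟨$⟩ʳ_; _⟨$⟩ˡ_; inverseʳ; inverseˡ)
import Data.Fin.Properties as Fin
open import Data.Fin.Relation.Unary.Top
  using (‵fromℕ; ‵inj₁; view-fromℕ; view-inject₁) renaming (view to topView)
import Data.Fin.Subset as Subset
open import Data.Fin.Subset using (Subset; ⁅_⁆)
import Data.Fin.Subset.Properties as Subset
open import Data.Integer as ℤ using (ℤ)
import Data.Integer.Properties as ℤ
open import Data.List using (List; []; _∷_; map; _++_; [_]; length; filter; cartesianProduct; allFin)
open import Data.List.Membership.Propositional using (_∈_; _∉_; find; lose)
open import Data.List.Membership.Propositional.Properties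
  using (∈-map⁺; ∈-++⁺ˡ; ∈-++⁺ʳ; ∈-++⁻; ∈-filter⁺; ∈-filter⁻; ∈-cartesianProduct⁺; ∈-allFin)
open import Data.List.Relation.Unary.Any using (here; there; any?)
import Data.Maybe as Maybe
open import Data.Maybe using (Maybe; just; nothing)
open import Data.Nat as ℕ using (ℕ; zero; suc; _<_; _≤_; s≤s; z≤n)
import Data.Nat.DivMod as ℕ
import Data.Nat.Properties as ℕ
open import Data.Product using (Σ; ∃; ∃₂; _×_; _,_; proj₁; proj₂; swap)
open import Data.Product.Function.NonDependent.Propositional using (_×-↔_)
open import Data.Product.Properties using (≡-dec)
open import Data.Sum using (_⊎_; inj₁; inj₂)
open import Data.Vec using (Vec; []; _∷_; lookup; replicate)
import Data.Vec.Properties as Vec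
open import Data.Vec.Properties
  using (∷-injectiveʳ; []=⇒lookup; lookup⇒[]=; lookup∘tabulate; tabulate∘lookup; tabulate-cong)
open import Function using (_∘_; id; _↔_; mk↔ₛ′; Inverse)
open import Function.Construct.Composition using (_↔-∘_)
open import Function.Construct.Identity using (↔-id)
open import Level using (0ℓ)
open import Relation.Binary.Definitions using (DecidableEquality)
open import Relation.Binary.PropositionalEquality hiding (J; [_])
open import Relation.Binary.Structures using (IsEquivalence)
open import Relation.Nullary using (¬_; Dec; yes; no; does)
open import Relation.Nullary.Decidable
  using (_×-dec_; _⊎-dec_; _→-dec_; ¬?; dec-true; dec-false; map′)

-- The ordered rings ℤ[t]/(t^k + 1)

record NegacyclicRing (A : Set) : Set₁ where
  infixl 6 _+_
  infixl 7 _*_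
  infix 8 -_
  field
    _+_ _*_ : A → A → A
    -_ : A → A
    0# 1# : A
    isCommutativeRing : IsCommutativeRing _≡_ _+_ _*_ -_ 0# 1#
    -- `ones` stands for 1 + t + ⋯ + t^(k-1); as t^k = -1, the geometric sum gives (1 - t) · ones =
    -- 2.
    t ones : A
    ones-eq : (1# + - t) * ones ≡ 1# + 1#
    -- The homomorphism to the field of two elements with t ↦ 1. It serves as a source of elements
    -- that are not zero divisors.
    par : A → Bool
    par-+ : ∀ x y → par (x + y) ≡ par x xor par y
    par-* : ∀ x y → par (x * y) ≡ par x ∧ par y
    par-neg : ∀ x → par (- x) ≡ par x
    par-1 : par 1# ≡ true
    par-t : par t ≡ true
    -- Only addition respects this order: for k > 1 the element -1 = t^k is a square, so no order is
    -- compatible with multiplication.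
    Pos : A → Set
    pos? : ∀ x → Dec (Pos x)
    pos-+ : ∀ {x y} → Pos x → Pos y → Pos (x + y)
    pos-0 : ¬ Pos 0#
    tri : ∀ x → Pos x ⊎ x ≡ 0# ⊎ Pos (- x)
    odd-regular : ∀ x → par x ≡ true → ∀ y → x * y ≡ 0# → y ≡ 0#

  commutativeRing : CommutativeRing 0ℓ 0ℓ
  commutativeRing = record { isCommutativeRing = isCommutativeRing }
  open CommutativeRing commutativeRing public
    using (+-assoc; +-comm; +-identityˡ; +-identityʳ; -‿inverseˡ; -‿inverseʳ;
           *-assoc; *-comm; *-identityˡ; *-identityʳ; distribˡ; distribʳ; zeroˡ; zeroʳ;
           commutativeSemiring; *-commutativeMonoid)
  open RingProperties (CommutativeRing.ring commutativeRing) public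
    using (-‿distribˡ-*; -‿distribʳ-*; -0#≈0#; -‿+-comm; -‿involutive; +-cancelʳ; +-cancelˡ)

module _ {A : Set} (L : NegacyclicRing A) where
  open NegacyclicRing L
  private
    module S = SemiringSolver commutativeSemiring
    module X = xor-∧-Solver
    -- A pair (a , b) stands for a + b s with s² = `t`: doubling adjoins a square root of `t`, which
    -- becomes the new `t`.
    B = A × A
    _+₂_ _*₂_ : B → B → B
    (a , b) +₂ (c , d) = a + c , b + d
    (a , b) *₂ (c , d) = a * c + t * (b * d) , a * d + b * c
    neg₂ : B → B
    neg₂ (a , b) = - a , - b
    open S

    assoc₂ : ∀ x y z → (x *₂ y) *₂ z ≡ x *₂ (y *₂ z)
    assoc₂ (a , b) (c , d) (e , f) = cong₂ _,_
      (solve 7 (λ a b c d e f t → (a :* c :+ t :* (b :* d)) :* e :+ t :* ((a :* d :+ b :* c) :* f)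
        := a :* (c :* e :+ t :* (d :* f)) :+ t :* (b :* (c :* f :+ d :* e))) refl a b c d e f t)
      (solve 7 (λ a b c d e f t → (a :* c :+ t :* (b :* d)) :* f :+ (a :* d :+ b :* c) :* e
        := a :* (c :* f :+ d :* e) :+ b :* (c :* e :+ t :* (d :* f))) refl a b c d e f t)

    comm₂ : ∀ x y → x *₂ y ≡ y *₂ x
    comm₂ (a , b) (c , d) = cong₂ _,_
      (solve 5 (λ a b c d t → a :* c :+ t :* (b :* d) := c :* a :+ t :* (d :* b)) refl a b c d t)
      (solve 4 (λ a b c d → a :* d :+ b :* c := c :* b :+ d :* a) refl a b c d)

    identityˡ₂ : ∀ x → (1# , 0#) *₂ x ≡ x
    identityˡ₂ (a , b) = cong₂ _,_
      (solve 3 (λ a b t → con 1 :* a :+ t :* (con 0 :* b) := a) refl a b t)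
      (solve 2 (λ a b → con 1 :* b :+ con 0 :* a := b) refl a b)

    distribˡ₂ : ∀ x y z → x *₂ (y +₂ z) ≡ (x *₂ y) +₂ (x *₂ z)
    distribˡ₂ (a , b) (c , d) (e , f) = cong₂ _,_
      (solve 7 (λ a b c d e f t → a :* (c :+ e) :+ t :* (b :* (d :+ f))
         := (a :* c :+ t :* (b :* d)) :+ (a :* e :+ t :* (b :* f))) refl a b c d e f t)
      (solve 6 (λ a b c d e f → a :* (d :+ f) :+ b :* (c :+ e)
         := (a :* d :+ b :* c) :+ (a :* f :+ b :* e)) refl a b c d e f)

    isCommutativeRing₂ : IsCommutativeRing _≡_ _+₂_ _*₂_ neg₂ (0# , 0#) (1# , 0#)
    isCommutativeRing₂ = record
      { isRing = record
        { +-isAbelianGroup = record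
          { isGroup = record
            { isMonoid = record
              { isSemigroup = record
                { isMagma = record { isEquivalence = isEquivalence ; ∙-cong = cong₂ _+₂_ }
                ; assoc = λ (a , b) (c , d) (e , f) → cong₂ _,_ (+-assoc a c e) (+-assoc b d f) }
              ; identity = (λ (a , b) → cong₂ _,_ (+-identityˡ a) (+-identityˡ b))
                         , (λ (a , b) → cong₂ _,_ (+-identityʳ a) (+-identityʳ b)) }
            ; inverse = (λ (a , b) → cong₂ _,_ (-‿inverseˡ a) (-‿inverseˡ b))
                      , (λ (a , b) → cong₂ _,_ (-‿inverseʳ a) (-‿inverseʳ b))
            ; ⁻¹-cong = cong neg₂ }
          ; comm = λ (a , b) (c , d) → cong₂ _,_ (+-comm a c) (+-comm b d) }
        ; *-cong = cong₂ _*₂_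
        ; *-assoc = assoc₂
        ; *-identity = identityˡ₂ , λ x → trans (comm₂ x _) (identityˡ₂ x)
        ; distrib = distribˡ₂ , λ x y z → trans (comm₂ (y +₂ z) x)
            (trans (distribˡ₂ x y z) (cong₂ _+₂_ (comm₂ x y) (comm₂ x z)))
        }
      ; *-comm = comm₂ }

    par₂ : B → Bool
    par₂ (a , b) = par a xor par b

    xor-interchange : ∀ a b c d → (a xor b) xor (c xor d) ≡ (a xor c) xor (b xor d)
    xor-interchange = X.solve 4 (λ a b c d → (a X.:+ b) X.:+ (c X.:+ d) X.:=
        (a X.:+ c) X.:+ (b X.:+ d)) refl

    xor-∧ : ∀ a b c d → ((a ∧ c) xor (b ∧ d)) xor ((a ∧ d) xor (b ∧ c)) ≡ (a xor b) ∧ (c xor d)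
    xor-∧ = X.solve 4 (λ a b c d → ((a X.:* c) X.:+ (b X.:* d)) X.:+ ((a X.:* d) X.:+ (b X.:* c))
      X.:= (a X.:+ b) X.:* (c X.:+ d)) refl

    par-0 : par 0# ≡ false
    par-0 = trans (cong par (sym (-‿inverseʳ 1#))) (trans (par-+ 1# (- 1#))
      (trans (cong (par 1# xor_) (par-neg 1#)) (Bool.xor-same (par 1#))))

    par-t* : ∀ x → par (t * x) ≡ par x
    par-t* x = trans (par-* t x) (cong (_∧ par x) par-t)

    Pos₂ : B → Set
    Pos₂ (a , b) = Pos a ⊎ (a ≡ 0# × Pos b)

    pos₂? : ∀ x → Dec (Pos₂ x)
    pos₂? (a , b) with tri a
    ... | inj₁ p = yes (inj₁ p)
    ... | inj₂ (inj₂ q) = no λ where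
      (inj₁ p) → pos-0 (subst Pos (-‿inverseʳ a) (pos-+ p q))
      (inj₂ (z , _)) → pos-0 (subst Pos (trans (cong -_ z) -0#≈0#) q)
    ... | inj₂ (inj₁ z) with pos? b
    ...   | yes p = yes (inj₂ (z , p))
    ...   | no ¬p = no λ where
      (inj₁ p) → pos-0 (subst Pos z p)
      (inj₂ (_ , p)) → ¬p p

    tri₂ : ∀ x → Pos₂ x ⊎ x ≡ (0# , 0#) ⊎ Pos₂ (neg₂ x)
    tri₂ (a , b) with tri a | tri b
    ... | inj₁ p | _ = inj₁ (inj₁ p)
    ... | inj₂ (inj₂ q) | _ = inj₂ (inj₂ (inj₁ q))
    ... | inj₂ (inj₁ z) | inj₁ p = inj₁ (inj₂ (z , p))
    ... | inj₂ (inj₁ z) | inj₂ (inj₁ w) = inj₂ (inj₁ (cong₂ _,_ z w))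
    ... | inj₂ (inj₁ z) | inj₂ (inj₂ q) = inj₂ (inj₂ (inj₂ (trans (cong -_ z) -0#≈0# , q)))

    pos-+₂ : ∀ {x y} → Pos₂ x → Pos₂ y → Pos₂ (x +₂ y)
    pos-+₂ (inj₁ p) (inj₁ q) = inj₁ (pos-+ p q)
    pos-+₂ {a , _} (inj₁ p) (inj₂ (z , q)) =
      inj₁ (subst Pos (sym (trans (cong (a +_) z) (+-identityʳ a))) p)
    pos-+₂ {_} {c , _} (inj₂ (z , p)) (inj₁ q) =
      inj₁ (subst Pos (sym (trans (cong (_+ c) z) (+-identityˡ c))) q)
    pos-+₂ (inj₂ (z , p)) (inj₂ (w , q)) =
      inj₂ (trans (cong₂ _+_ z w) (+-identityˡ 0#) , pos-+ p q)

    -- For w = (e, o) the norm e² − t o² annihilates whatever w annihilates, and it is odd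
    -- when w is.
    odd-regular₂ : ∀ w → par₂ w ≡ true → ∀ y → w *₂ y ≡ (0# , 0#) → y ≡ (0# , 0#)
    odd-regular₂ (e , o) odd (p , q) eq =
      cong₂ _,_ (odd-regular N oddN p (N*≡0 p eep)) (odd-regular N oddN q (N*≡0 q eeq))
      where
      eq₁ = cong proj₁ eq
      eq₂ = cong proj₂ eq
      N = e * e + - (t * (o * o))
      oddN : par N ≡ true
      oddN = begin
        par N                              ≡⟨ par-+ (e * e) _ ⟩
        par (e * e) xor par (- (t * (o * o))) ≡⟨ cong₂ _xor_ (par-* e e)
            (trans (par-neg _) (trans (par-t* _) (par-* o o))) ⟩
        (par e ∧ par e) xor (par o ∧ par o) ≡⟨ cong₂ _xor_ (Bool.∧-idem (par e)) (Bool.∧-idem (par o)) ⟩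
        par e xor par o                    ≡⟨ odd ⟩
        true                               ∎
        where open ≡-Reasoning
      N*≡0 : ∀ x → e * e * x ≡ t * (o * o) * x → N * x ≡ 0#
      N*≡0 x h = begin
        N * x ≡⟨ distribʳ x (e * e) _ ⟩
        e * e * x + - (t * (o * o)) * x ≡⟨ cong₂ _+_ h (sym (-‿distribˡ-* _ x)) ⟩
        t * (o * o) * x + - (t * (o * o) * x) ≡⟨ -‿inverseʳ _ ⟩
        0# ∎
        where open ≡-Reasoning
      eep : e * e * p ≡ t * (o * o) * p
      eep = +-cancelʳ (t * (e * (o * q))) _ _ (begin
        e * e * p + t * (e * (o * q))   ≡⟨ solve 5 (λ e o p q t → e :* e :* p :+ t :* (e :* (o :* q))
                                             := e :* (e :* p :+ t :* (o :* q))) refl e o p q t ⟩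
        e * (e * p + t * (o * q))       ≡⟨ trans (cong (e *_) eq₁) (zeroʳ e) ⟩
        0#                              ≡⟨ sym (trans (cong (t * o *_) eq₂) (zeroʳ (t * o))) ⟩
        t * o * (e * q + o * p)         ≡⟨ solve 5 (λ e o p q t → t :* o :* (e :* q :+ o :* p)
                                             := t :* (o :* o) :* p :+ t :* (e :* (o :* q))) refl e o p q t ⟩
        t * (o * o) * p + t * (e * (o * q)) ∎)
        where open ≡-Reasoning
      eeq : e * e * q ≡ t * (o * o) * q
      eeq = +-cancelʳ (e * (o * p)) _ _ (begin
        e * e * q + e * (o * p)         ≡⟨ solve 4 (λ e o p q → e :* e :* q :+ e :* (o :* p)
                                             := e :* (e :* q :+ o :* p)) refl e o p q ⟩
        e * (e * q + o * p)             ≡⟨ trans (cong (e *_) eq₂) (zeroʳ e) ⟩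
        0#                              ≡⟨ sym (trans (cong (o *_) eq₁) (zeroʳ o)) ⟩
        o * (e * p + t * (o * q))       ≡⟨ solve 5 (λ e o p q t → o :* (e :* p :+ t :* (o :* q))
                                             := t :* (o :* o) :* q :+ e :* (o :* p)) refl e o p q t ⟩
        t * (o * o) * q + e * (o * p)   ∎)
        where open ≡-Reasoning

  doubled : NegacyclicRing B
  doubled = record
    { _+_ = _+₂_ ; _*_ = _*₂_ ; -_ = neg₂ ; 0# = 0# , 0# ; 1# = 1# , 0#
    ; isCommutativeRing = isCommutativeRing₂
    ; t = 0# , 1# ; ones = ones , ones
    ; ones-eq = cong₂ _,_
        (trans (cong (λ z → (1# + z) * ones + t * ((0# + - 1#) * ones)) -0#≈0#)
          (trans (cong₂ _+_ (trans (cong (_* ones) (+-identityʳ 1#)) (*-identityˡ ones))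
                            (trans (cong (λ z → t * (z * ones)) (+-identityˡ (- 1#)))
                              (trans (cong (t *_) (trans (sym (-‿distribˡ-* 1# ones))
                                  (cong -_ (*-identityˡ ones))))
                                (trans (sym (-‿distribʳ-* t ones)) (-‿distribˡ-* t ones)))))
            (trans (cong (_+ - t * ones) (sym (*-identityˡ ones)))
              (trans (sym (distribʳ ones 1# (- t))) ones-eq))))
        (trans (cong₂ (λ y z → (1# + y) * ones + z * ones) -0#≈0# (+-identityˡ (- 1#)))
          (trans (cong (λ y → y * ones + - 1# * ones) (+-identityʳ 1#))
            (trans (sym (distribʳ ones 1# (- 1#)))
              (trans (cong (_* ones) (-‿inverseʳ 1#)) (trans (zeroˡ ones) (sym (+-identityˡ 0#)))))))
    ; par = par₂
    ; par-+ = λ (a , b) (c , d) → trans (cong₂ _xor_ (par-+ a c) (par-+ b d))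
        (xor-interchange (par a) (par c) (par b) (par d))
    ; par-* = λ (a , b) (c , d) → trans (cong₂ _xor_
          (trans (par-+ (a * c) _) (cong₂ _xor_ (par-* a c) (trans (par-t* _) (par-* b d))))
          (trans (par-+ (a * d) _) (cong₂ _xor_ (par-* a d) (par-* b c))))
        (xor-∧ (par a) (par b) (par c) (par d))
    ; par-neg = λ (a , b) → cong₂ _xor_ (par-neg a) (par-neg b)
    ; par-1 = cong₂ _xor_ par-1 par-0
    ; par-t = cong₂ _xor_ par-0 par-1
    ; Pos = Pos₂ ; pos? = pos₂? ; pos-+ = pos-+₂
    ; pos-0 = λ where
        (inj₁ p) → pos-0 p
        (inj₂ (_ , p)) → pos-0 p
    ; tri = tri₂
    ; odd-regular = odd-regular₂
    }

-- The base ring ℤ and the tower above it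

odd : ℕ → Bool
odd zero = false
odd (suc n) = not (odd n)

odd-+ : ∀ m n → odd (m ℕ.+ n) ≡ odd m xor odd n
odd-+ zero n = refl
odd-+ (suc m) n = trans (cong not (odd-+ m n)) (Bool.not-distribˡ-xor (odd m) (odd n))

odd-* : ∀ m n → odd (m ℕ.* n) ≡ odd m ∧ odd n
odd-* zero n = refl
odd-* (suc m) n = trans (odd-+ n (m ℕ.* n)) (trans (cong (odd n xor_) (odd-* m n)) (lemma (odd m) (odd n)))
  where
  lemma : ∀ a b → b xor (a ∧ b) ≡ not a ∧ b
  lemma true true = refl
  lemma true false = refl
  lemma false true = refl
  lemma false false = refl

odd-⊖ : ∀ m n → odd ℤ.∣ m ℤ.⊖ n ∣ ≡ odd m xor odd n
odd-⊖ zero zero = refl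
odd-⊖ zero (suc n) = refl
odd-⊖ (suc m) zero = sym (Bool.xor-identityʳ (not (odd m)))
odd-⊖ (suc m) (suc n) = trans (cong (λ i → odd ℤ.∣ i ∣) (ℤ.[1+m]⊖[1+n]≡m⊖n m n))
  (trans (odd-⊖ m n) (lemma (odd m) (odd n)))
  where
  lemma : ∀ a b → a xor b ≡ not a xor not b
  lemma true true = refl
  lemma true false = refl
  lemma false true = refl
  lemma false false = refl

odd-∣+∣ : ∀ x y → odd ℤ.∣ x ℤ.+ y ∣ ≡ odd ℤ.∣ x ∣ xor odd ℤ.∣ y ∣
odd-∣+∣ (ℤ.+ m) (ℤ.+ n) = odd-+ m n
odd-∣+∣ (ℤ.+ m) ℤ.-[1+ n ] = odd-⊖ m (suc n)
odd-∣+∣ ℤ.-[1+ m ] (ℤ.+ n) = trans (odd-⊖ n (suc m)) (Bool.xor-comm (odd n) _)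
odd-∣+∣ ℤ.-[1+ m ] ℤ.-[1+ n ] = trans (cong (λ k → not (odd k)) (sym (ℕ.+-suc m n))) (odd-+ (suc m) (suc n))

integers : NegacyclicRing ℤ
integers = record
  { isCommutativeRing = ℤ.+-*-isCommutativeRing
  -- The case k = 1: t^1 = -1, and the sum of the powers of t has a single term.
  ; t = ℤ.-1ℤ ; ones = ℤ.1ℤ ; ones-eq = refl
  ; par = λ x → odd ℤ.∣ x ∣
  ; par-+ = odd-∣+∣
  ; par-* = λ x y → trans (cong odd (ℤ.abs-* x y)) (odd-* ℤ.∣ x ∣ ℤ.∣ y ∣)
  ; par-neg = λ x → cong odd (ℤ.∣-i∣≡∣i∣ x)
  ; par-1 = refl ; par-t = refl
  ; Pos = ℤ.0ℤ ℤ.<_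
  ; pos? = ℤ.0ℤ ℤ.<?_
  ; pos-+ = ℤ.+-mono-<
  ; pos-0 = ℤ.<-irrefl refl
  ; tri = λ where
      (ℤ.+ zero) → inj₂ (inj₁ refl)
      (ℤ.+ suc n) → inj₁ (ℤ.+<+ (ℕ.s≤s ℕ.z≤n))
      ℤ.-[1+ n ] → inj₂ (inj₂ (ℤ.+<+ (ℕ.s≤s ℕ.z≤n)))
  ; odd-regular = regular
  }
  where
  regular : ∀ x → odd ℤ.∣ x ∣ ≡ true → ∀ y → x ℤ.* y ≡ ℤ.0ℤ → y ≡ ℤ.0ℤ
  regular x o y eq with ℤ.i*j≡0⇒i≡0∨j≡0 x eq
  ... | inj₂ z = z
  ... | inj₁ refl with () ← o

R : ℕ → Set
R zero = ℤ
R (suc m) = R m × R m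

ringR : ∀ m → NegacyclicRing (R m)
ringR zero = integers
ringR (suc m) = doubled (ringR m)

-- Non-zero-divisors and absolute values

module Derived {A : Set} (L : NegacyclicRing A) where
  open NegacyclicRing L public
  open SemiringSolver commutativeSemiring

  Regular : A → Set
  Regular x = ∀ y → x * y ≡ 0# → y ≡ 0#

  regular-1 : Regular 1#
  regular-1 y eq = trans (sym (*-identityˡ y)) eq

  regular-* : ∀ {x y} → Regular x → Regular y → Regular (x * y)
  regular-* {x} {y} rx ry w eq = ry w (rx _ (trans (sym (*-assoc x y w)) eq))

  regular-neg : ∀ {x} → Regular x → Regular (- x)
  regular-neg {x} rx y eq = rx y (trans (sym (-‿involutive _))
      (trans (cong -_ (trans (-‿distribˡ-* x y) eq)) -0#≈0#))

  regular-cancel : ∀ {x y z} → Regular x → x * y ≡ x * z → y ≡ z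
  regular-cancel {x} {y} {z} rx eq = trans (sym (+-identityʳ y)) (trans (cong (y +_) (sym (-‿inverseˡ z)))
    (trans (sym (+-assoc y (- z) z)) (trans (cong (_+ z) (rx (y + - z) (begin
      x * (y + - z) ≡⟨ distribˡ x y (- z) ⟩
      x * y + x * - z ≡⟨ cong₂ _+_ eq (sym (-‿distribʳ-* x z)) ⟩
      x * z + - (x * z) ≡⟨ -‿inverseʳ _ ⟩
      0# ∎))) (+-identityˡ z))))
    where open ≡-Reasoning

  pos-irrefl : ∀ {x} → Pos x → Pos (- x) → ⊥
  pos-irrefl {x} p q = pos-0 (subst Pos (-‿inverseʳ x) (pos-+ p q))

  -- A group ordered additively has no torsion.
  double-regular : ∀ x → x + x ≡ 0# → x ≡ 0#
  double-regular x eq with tri x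
  ... | inj₁ p = ⊥-elim (pos-0 (subst Pos eq (pos-+ p p)))
  ... | inj₂ (inj₁ z) = z
  ... | inj₂ (inj₂ p) = ⊥-elim (pos-0 (subst Pos (trans (-‿+-comm x x) (trans (cong -_ eq) -0#≈0#))
      (pos-+ p p)))

  abs : A → A
  abs x with pos? (- x)
  ... | yes _ = - x
  ... | no _ = x

  abs-neg : ∀ x → abs (- x) ≡ abs x
  abs-neg x with pos? (- x) | pos? (- - x)
  ... | yes p | yes q = ⊥-elim (pos-irrefl p q)
  ... | yes p | no _ = refl
  ... | no _ | yes q = -‿involutive x
  ... | no p | no q with tri x
  ...   | inj₁ r = ⊥-elim (q (subst Pos (sym (-‿involutive x)) r))
  ...   | inj₂ (inj₁ refl) = -0#≈0#
  ...   | inj₂ (inj₂ r) = ⊥-elim (p r)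

  abs-± : ∀ x → abs x ≡ x ⊎ abs x ≡ - x
  abs-± x with pos? (- x)
  ... | yes _ = inj₂ refl
  ... | no _ = inj₁ refl

  abs-≡ : ∀ x y → abs x ≡ abs y → x ≡ y ⊎ x ≡ - y
  abs-≡ x y eq with abs-± x | abs-± y
  ... | inj₁ p | inj₁ q = inj₁ (trans (sym p) (trans eq q))
  ... | inj₁ p | inj₂ q = inj₂ (trans (sym p) (trans eq q))
  ... | inj₂ p | inj₁ q = inj₂ (trans (sym (-‿involutive x)) (cong -_ (trans (sym p) (trans eq q))))
  ... | inj₂ p | inj₂ q = inj₁ (trans (sym (-‿involutive x))
      (trans (cong -_ (trans (sym p) (trans eq q))) (-‿involutive y)))

  regular-t : Regular t
  regular-t = odd-regular t par-t

  -- As (1 − t) · ones = 2, multiplying by 1 − t turns such an element into 2 (1 + (1 − t) u),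
  -- twice an odd one.
  ones-regular : ∀ u → Regular (ones + (u + u))
  ones-regular u y eq = odd-regular w odd-w y (double-regular (w * y) (begin
      w * y + w * y ≡⟨ solve 4 (λ a o u y → (con 1 :+ a :* u) :* y :+ (con 1 :+ a :* u) :* y
                          := (con 1 :+ con 1) :* y :+ a :* ((u :+ u) :* y)) refl a ones u y ⟩
      (1# + 1#) * y + a * ((u + u) * y) ≡⟨ cong (λ z → z * y + a * ((u + u) * y)) (sym ones-eq) ⟩
      a * ones * y + a * ((u + u) * y) ≡⟨ solve 4 (λ a o u y → a :* o :* y :+ a :* ((u :+ u) :* y)
                          := a :* ((o :+ (u :+ u)) :* y)) refl a ones u y ⟩
      a * ((ones + (u + u)) * y) ≡⟨ trans (cong (a *_) eq) (zeroʳ a) ⟩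
      0# ∎))
    where
    open ≡-Reasoning
    a = 1# + - t
    w = 1# + a * u
    odd-w : par w ≡ true
    odd-w = trans (par-+ 1# (a * u)) (cong₂ _xor_ par-1 (trans (par-* a u)
      (cong (_∧ par u) (trans (par-+ 1# (- t)) (cong₂ _xor_ par-1 (trans (par-neg t) par-t))))))

-- Elements attached to a block

J : ℕ → Set
J = Vec Bool

infix 4 _≟J_
_≟J_ : ∀ {m} → DecidableEquality (J m)
_≟J_ = Vec.≡-dec Bool._≟_

-- The exponents j < 2^m are written in binary, least significant bit first; t · t^j is t^(τ j),
-- with a minus sign when the odometer wraps around.
τ τ⁻¹ : ∀ {m} → J m → J m
τ [] = []
τ (false ∷ j) = true ∷ j
τ (true ∷ j) = false ∷ τ j
τ⁻¹ [] = []
τ⁻¹ (true ∷ j) = false ∷ j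
τ⁻¹ (false ∷ j) = true ∷ τ⁻¹ j

wraps : ∀ {m} → J m → Bool
wraps [] = true
wraps (false ∷ j) = false
wraps (true ∷ j) = wraps j

τ-τ⁻¹ : ∀ {m} (j : J m) → τ (τ⁻¹ j) ≡ j
τ-τ⁻¹ [] = refl
τ-τ⁻¹ (true ∷ j) = refl
τ-τ⁻¹ (false ∷ j) = cong (false ∷_) (τ-τ⁻¹ j)

τ⁻¹-τ : ∀ {m} (j : J m) → τ⁻¹ (τ j) ≡ j
τ⁻¹-τ [] = refl
τ⁻¹-τ (false ∷ j) = refl
τ⁻¹-τ (true ∷ j) = cong (true ∷_) (τ⁻¹-τ j)

module _ {A : Set} (L : NegacyclicRing A) where
  open Derived L
  open SemiringSolver commutativeSemiring

  sumJ : ∀ {m} → (J m → A) → A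
  sumJ {zero} f = f []
  sumJ {suc m} f = sumJ (f ∘ (false ∷_)) + sumJ (f ∘ (true ∷_))

  sumJ-cong : ∀ {m} {f g : J m → A} → (∀ j → f j ≡ g j) → sumJ f ≡ sumJ g
  sumJ-cong {zero} h = h []
  sumJ-cong {suc m} h = cong₂ _+_ (sumJ-cong (h ∘ (false ∷_))) (sumJ-cong (h ∘ (true ∷_)))

  sumJ-zero : ∀ {m} {f : J m → A} → (∀ j → f j ≡ 0#) → sumJ f ≡ 0#
  sumJ-zero {zero} h = h []
  sumJ-zero {suc m} h = trans (cong₂ _+_ (sumJ-zero (h ∘ (false ∷_))) (sumJ-zero (h ∘ (true ∷_))))
      (+-identityˡ 0#)

  sumJ-neg : ∀ {m} {f g : J m → A} → (∀ j → g j ≡ - f j) → sumJ g ≡ - sumJ f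
  sumJ-neg {zero} h = h []
  sumJ-neg {suc m} h = trans (cong₂ _+_ (sumJ-neg (h ∘ (false ∷_))) (sumJ-neg (h ∘ (true ∷_))))
      (-‿+-comm _ _)

  sumJ-τ : ∀ {m} (f : J m → A) → sumJ (f ∘ τ) ≡ sumJ f
  sumJ-τ {zero} f = refl
  sumJ-τ {suc m} f = trans (cong (sumJ (f ∘ (true ∷_)) +_) (sumJ-τ (f ∘ (false ∷_)))) (+-comm _ _)

  sumJ-update : ∀ {m} {f g : J m → A} (p : J m) {c} → g p ≡ f p + c → (∀ j → j ≢ p → g j ≡ f j) →
                sumJ g ≡ sumJ f + c
  sumJ-update {zero} [] gp _ = gp
  sumJ-update {suc m} {f} {g} (false ∷ p) {c} gp h =
    trans (cong₂ _+_ (sumJ-update {m} {f ∘ (false ∷_)} p gp λ j j≢p → h (false ∷ j) (j≢p ∘ ∷-injectiveʳ))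
                     (sumJ-cong {m} λ j → h (true ∷ j) λ ()))
      (solve 3 (λ a b c → (a :+ c) :+ b := (a :+ b) :+ c) refl (sumJ (f ∘ (false ∷_)))
          (sumJ (f ∘ (true ∷_))) c)
  sumJ-update {suc m} {f} {g} (true ∷ p) {c} gp h =
    trans (cong₂ _+_ (sumJ-cong {m} λ j → h (false ∷ j) λ ())
                     (sumJ-update {m} {f ∘ (true ∷_)} p gp λ j j≢p → h (true ∷ j) (j≢p ∘ ∷-injectiveʳ)))
      (sym (+-assoc _ _ c))

  signed : Bool → A → A
  signed true x = x
  signed false x = - x

  signed-*ʳ : ∀ s x y → x * signed s y ≡ signed s (x * y)
  signed-*ʳ true x y = refl
  signed-*ʳ false x y = sym (-‿distribʳ-* x y)

  signed-not : ∀ s x → signed (not s) x ≡ - signed s x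
  signed-not true x = refl
  signed-not false x = sym (-‿involutive x)

  signed-neg : ∀ s x → signed s (- x) ≡ - signed s x
  signed-neg true x = refl
  signed-neg false x = refl

  abs-signed : ∀ s x → abs (signed s x) ≡ abs x
  abs-signed true x = refl
  abs-signed false x = abs-neg x

  regular-signed : ∀ s {x} → Regular x → Regular (signed s x)
  regular-signed true r = r
  regular-signed false r = regular-neg r

  signed-zero : ∀ s {x} → signed s x ≡ 0# → x ≡ 0#
  signed-zero true eq = eq
  signed-zero false eq = trans (sym (-‿involutive _)) (trans (cong -_ eq) -0#≈0#)

module RM (m : ℕ) = Derived (ringR m)

xorJ : ∀ {m} → (J m → Bool) → Bool
xorJ {zero} u = u []
xorJ {suc m} u = xorJ (u ∘ (false ∷_)) xor xorJ (u ∘ (true ∷_))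

xorJ-cong : ∀ {m} {u v : J m → Bool} → (∀ j → u j ≡ v j) → xorJ u ≡ xorJ v
xorJ-cong {zero} h = h []
xorJ-cong {suc m} h = cong₂ _xor_ (xorJ-cong (h ∘ (false ∷_))) (xorJ-cong (h ∘ (true ∷_)))

element : ∀ {m} → (J m → Bool) → R m
element {zero} u = signed integers (u []) ℤ.1ℤ
element {suc m} u = element (u ∘ (false ∷_)) , element (u ∘ (true ∷_))

element-cong : ∀ {m} {u v : J m → Bool} → (∀ j → u j ≡ v j) → element u ≡ element v
element-cong {zero} h = cong (λ s → signed integers s ℤ.1ℤ) (h [])
element-cong {suc m} h = cong₂ _,_ (element-cong (h ∘ (false ∷_))) (element-cong (h ∘ (true ∷_)))

element-not : ∀ {m} (u : J m → Bool) → element (not ∘ u) ≡ RM.-_ m (element u)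
element-not {zero} u = signed-not integers (u []) ℤ.1ℤ
element-not {suc m} u = cong₂ _,_ (element-not (u ∘ (false ∷_))) (element-not (u ∘ (true ∷_)))

-- All choices of signs agree modulo 2. For k > 1 the number of terms is even, so `odd-regular` does
-- not reach these elements; `ones-regular` does.
element-odd : ∀ {m} (u : J m → Bool) → let open RM m in ∃ λ w → element u ≡ ones + (w + w)
element-odd {zero} u with u []
... | true = ℤ.0ℤ , refl
... | false = ℤ.-1ℤ , refl
element-odd {suc m} u =
  let (w , p) = element-odd (u ∘ (false ∷_)) ; (w′ , p′) = element-odd (u ∘ (true ∷_))
  in (w , w′) , cong₂ _,_ p p′

element-regular : ∀ {m} (u : J m → Bool) → RM.Regular m (element u)
element-regular {m} u = let (w , eq) = element-odd u in subst (RM.Regular m) (sym eq) (RM.ones-regular m w)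

basis : ∀ {m} → J m → R m
basis [] = ℤ.1ℤ
basis {suc m} (false ∷ j) = basis j , RM.0# m
basis {suc m} (true ∷ j) = RM.0# m , basis j

basis≢0 : ∀ {m} (j : J m) → basis j ≢ RM.0# m
basis≢0 [] ()
basis≢0 (false ∷ j) eq = basis≢0 j (cong proj₁ eq)
basis≢0 (true ∷ j) eq = basis≢0 j (cong proj₂ eq)

-- Distinctness up to sign is what makes the absolute values |C t^j| pairwise different for regular
-- C.
basis-injective : ∀ {m} (j l : J m) → basis j ≡ basis l ⊎ basis j ≡ RM.-_ m (basis l) → j ≡ l
basis-injective [] [] _ = refl
basis-injective (false ∷ j) (false ∷ l) (inj₁ eq) =
    cong (false ∷_) (basis-injective j l (inj₁ (cong proj₁ eq)))
basis-injective (false ∷ j) (false ∷ l) (inj₂ eq) =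
    cong (false ∷_) (basis-injective j l (inj₂ (cong proj₁ eq)))
basis-injective (true ∷ j) (true ∷ l) (inj₁ eq) = cong (true ∷_)
    (basis-injective j l (inj₁ (cong proj₂ eq)))
basis-injective (true ∷ j) (true ∷ l) (inj₂ eq) = cong (true ∷_)
    (basis-injective j l (inj₂ (cong proj₂ eq)))
basis-injective (false ∷ j) (true ∷ l) (inj₁ eq) = ⊥-elim (basis≢0 j (cong proj₁ eq))
basis-injective {suc m} (false ∷ j) (true ∷ l) (inj₂ eq) =
    ⊥-elim (basis≢0 j (trans (cong proj₁ eq) (RM.-0#≈0# m)))
basis-injective (true ∷ j) (false ∷ l) (inj₁ eq) = ⊥-elim (basis≢0 j (cong proj₂ eq))
basis-injective {suc m} (true ∷ j) (false ∷ l) (inj₂ eq) =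
    ⊥-elim (basis≢0 j (trans (cong proj₂ eq) (RM.-0#≈0# m)))

t*-doubled : ∀ {m} (x y : R m) → RM._*_ (suc m) (RM.t (suc m)) (x , y) ≡ (RM._*_ m (RM.t m) y , x)
t*-doubled {m} x y = cong₂ _,_
  (solve 3 (λ t x y → con 0 :* x :+ t :* (con 1 :* y) := t :* y) refl t x y)
  (solve 2 (λ x y → con 0 :* y :+ con 1 :* x := x) refl x y)
  where
  open RM m
  open SemiringSolver commutativeSemiring

t*basis : ∀ {m} (j : J m) → RM._*_ m (RM.t m) (basis j) ≡ signed (ringR m) (not (wraps j)) (basis (τ j))
t*basis [] = refl
t*basis {suc m} (false ∷ j) = trans (t*-doubled (basis j) 0#) (cong (_, basis j) (zeroʳ t))
  where open RM m
t*basis {suc m} (true ∷ j) = trans (t*-doubled 0# (basis j))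
    (trans (cong (_, 0#) (t*basis j)) (lemma (not (wraps j))))
  where
  open RM m
  lemma : ∀ s → (signed (ringR m) s (basis (τ j)) , 0#) ≡ signed (ringR (suc m)) s (basis (false ∷ τ j))
  lemma true = refl
  lemma false = cong (- basis (τ j) ,_) (sym -0#≈0#)

-- Multiplying a + b s by s gives t b + a s: the halves change places, and the odd one picks up `t`
-- of the smaller ring, which is the carry of `τ`.
element-τ : ∀ {m} {u v : J m → Bool} → (∀ j → v (τ j) ≡ u j xor wraps j) →
            element v ≡ RM._*_ m (RM.t m) (element u)
element-τ {zero} {u} {v} h with u [] | v [] | h []
... | true | _ | refl = refl
... | false | _ | refl = refl
element-τ {suc m} {u} {v} h = trans
  (cong₂ _,_ (element-τ λ j → h (true ∷ j))
             (element-cong λ j → trans (h (false ∷ j)) (Bool.xor-identityʳ _)))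
  (sym (t*-doubled (element (u ∘ (false ∷_))) (element (u ∘ (true ∷_)))))

-- The odometer wraps at exactly one exponent, so exactly one sign is flipped.
xorJ-τ : ∀ {m} {u v : J m → Bool} → (∀ j → v (τ j) ≡ u j xor wraps j) → xorJ v ≡ not (xorJ u)
xorJ-τ {zero} {u} h = trans (h []) (Bool.xor-comm (u []) true)
xorJ-τ {suc m} {u} h = trans
  (cong₂ _xor_ (xorJ-τ λ j → h (true ∷ j)) (xorJ-cong λ j → trans (h (false ∷ j)) (Bool.xor-identityʳ _)))
  (trans (sym (Bool.not-distribˡ-xor (xorJ (u ∘ (true ∷_))) _))
      (cong not (Bool.xor-comm (xorJ (u ∘ (true ∷_))) _)))

-- The number of signs is even.
xorJ-not : ∀ {m} (u : J (suc m) → Bool) → xorJ (not ∘ u) ≡ xorJ u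
xorJ-not {zero} u with u (false ∷ []) | u (true ∷ [])
... | true | true = refl
... | true | false = refl
... | false | true = refl
... | false | false = refl
xorJ-not {suc m} u = cong₂ _xor_ (xorJ-not (u ∘ (false ∷_))) (xorJ-not (u ∘ (true ∷_)))

xorJ-update : ∀ {m} {u v : J m → Bool} (p : J m) → v p ≡ not (u p) → (∀ j → j ≢ p → v j ≡ u j) →
              xorJ v ≡ not (xorJ u)
xorJ-update {zero} [] h _ = h
xorJ-update {suc m} {u} (false ∷ p) h k = trans
  (cong₂ _xor_ (xorJ-update p h λ j j≢p → k (false ∷ j) (j≢p ∘ ∷-injectiveʳ))
      (xorJ-cong λ j → k (true ∷ j) λ ()))
  (sym (Bool.not-distribˡ-xor (xorJ (u ∘ (false ∷_))) _))
xorJ-update {suc m} {u} (true ∷ p) h k = trans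
  (cong₂ _xor_ (xorJ-cong λ j → k (false ∷ j) λ ())
      (xorJ-update p h λ j j≢p → k (true ∷ j) (j≢p ∘ ∷-injectiveʳ)))
  (sym (Bool.not-distribʳ-xor (xorJ (u ∘ (false ∷_))) _))

element-update : ∀ {m} {u v : J m → Bool} (p : J m) → u p ≡ true → v p ≡ false → (∀ j → j ≢ p → v j ≡ u j) →
                 let open RM m in element u ≡ element v + (basis p + basis p)
element-update {zero} [] h k _ rewrite h | k = refl
element-update {suc m} {u} (false ∷ p) h k l = cong₂ _,_
  (element-update p h k λ j j≢p → l (false ∷ j) (j≢p ∘ ∷-injectiveʳ))
  (trans (sym (+-identityʳ _)) (cong₂ _+_ (element-cong λ j → sym (l (true ∷ j) λ ()))
      (sym (+-identityˡ 0#))))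
  where open RM m
element-update {suc m} {u} (true ∷ p) h k l = cong₂ _,_
  (trans (sym (+-identityʳ _)) (cong₂ _+_ (element-cong λ j → sym (l (false ∷ j) λ ()))
      (sym (+-identityˡ 0#))))
  (element-update p h k λ j j≢p → l (true ∷ j) (j≢p ∘ ∷-injectiveʳ))
  where open RM m

-- Without the twist by xorJ the face lemma below would fail. For m = 0 the element is itself a
-- sign, which the twist would cancel.
ζ : ∀ {m} → (J m → Bool) → R m
ζ {zero} u = element u
ζ {suc m} u = signed (ringR (suc m)) (xorJ u) (element u)

ζ-cong : ∀ {m} {u v : J m → Bool} → (∀ j → u j ≡ v j) → ζ u ≡ ζ v
ζ-cong {zero} h = element-cong h
ζ-cong {suc m} h = cong₂ (signed (ringR (suc m))) (xorJ-cong h) (element-cong h)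

ζ-not : ∀ {m} (u : J m → Bool) → ζ (not ∘ u) ≡ RM.-_ m (ζ u)
ζ-not {zero} u = element-not u
ζ-not {suc m} u = trans (cong₂ (signed (ringR (suc m))) (xorJ-not u) (element-not u))
  (signed-neg (ringR (suc m)) (xorJ u) (element u))

ζ-regular : ∀ {m} (u : J m → Bool) → RM.Regular m (ζ u)
ζ-regular {zero} u = element-regular u
ζ-regular {suc m} u = regular-signed (ringR (suc m)) (xorJ u) (element-regular u)

-- The factor by which `ζ` changes when a block is multiplied by t. For k > 1 the one sign flipped
-- by the wrap reverses the twist, whence the minus.
shiftUnit : ∀ m → R m
shiftUnit zero = RM.t zero
shiftUnit (suc m) = RM.-_ (suc m) (RM.t (suc m))

shiftUnit-regular : ∀ m → RM.Regular m (shiftUnit m)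
shiftUnit-regular zero = RM.regular-t zero
shiftUnit-regular (suc m) = RM.regular-neg (suc m) (RM.regular-t (suc m))

ζ-τ : ∀ {m} {u v : J m → Bool} → (∀ j → v (τ j) ≡ u j xor wraps j) → ζ v ≡ RM._*_ m (shiftUnit m) (ζ u)
ζ-τ {zero} {u} {v} h = element-τ {u = u} {v} h
ζ-τ {suc m} {u} {v} h = begin
  sgn (xorJ v) (element v)             ≡⟨ cong₂ sgn (xorJ-τ {u = u} {v} h) (element-τ {u = u} {v} h) ⟩
  sgn (not (xorJ u)) (t * element u)   ≡⟨ signed-not (ringR (suc m)) (xorJ u) _ ⟩
  - sgn (xorJ u) (t * element u)       ≡⟨ cong -_ (sym (signed-*ʳ (ringR (suc m)) (xorJ u) t _)) ⟩
  - (t * sgn (xorJ u) (element u))     ≡⟨ -‿distribˡ-* t _ ⟩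
  - t * sgn (xorJ u) (element u)       ∎
  where
  open RM (suc m)
  open ≡-Reasoning
  sgn = signed (ringR (suc m))

shiftUnit*basis : ∀ {m} (j : J m) → ∃ λ s → RM._*_ m (shiftUnit m) (basis j) ≡ signed (ringR m) s
    (basis (τ j))
shiftUnit*basis {zero} j = not (wraps j) , t*basis j
shiftUnit*basis {suc m} j = wraps j , (begin
  - t * basis j   ≡⟨ sym (-‿distribˡ-* t _) ⟩
  - (t * basis j) ≡⟨ cong -_ (t*basis j) ⟩
  - signed (ringR (suc m)) (not (wraps j)) (basis (τ j)) ≡⟨ sym
      (signed-not (ringR (suc m)) (not (wraps j)) _) ⟩
  signed (ringR (suc m)) (not (not (wraps j))) (basis (τ j)) ≡⟨ cong
      (λ s → signed (ringR (suc m)) s (basis (τ j))) (Bool.not-involutive (wraps j)) ⟩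
  signed (ringR (suc m)) (wraps j) (basis (τ j)) ∎)
  where
  open RM (suc m)
  open ≡-Reasoning

-- Choosing signs that make the product positive

module _ {A : Set} (L : NegacyclicRing A) where
  open Derived L

  signed-*ˡ : ∀ s x y → signed L s x * y ≡ signed L s (x * y)
  signed-*ˡ true x y = refl
  signed-*ˡ false x y = sym (-‿distribˡ-* x y)

  NonPos : A → Set
  NonPos x = x ≡ 0# ⊎ Pos (- x)

  nonPos : ∀ {x} → ¬ Pos x → NonPos x
  nonPos {x} ¬p with tri x
  ... | inj₁ p = ⊥-elim (¬p p)
  ... | inj₂ q = q

  nonPos-+ : ∀ {x y} → NonPos x → NonPos y → NonPos (x + y)
  nonPos-+ {y = y} (inj₁ refl) q = subst NonPos (sym (+-identityˡ y)) q
  nonPos-+ {x} (inj₂ p) (inj₁ refl) = subst NonPos (sym (+-identityʳ x)) (inj₂ p)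
  nonPos-+ {x} {y} (inj₂ p) (inj₂ q) = inj₂ (subst Pos (-‿+-comm x y) (pos-+ p q))

  nonPos-zero : ∀ {x y} → NonPos x → NonPos y → x + y ≡ 0# → x ≡ 0#
  nonPos-zero (inj₁ z) _ _ = z
  nonPos-zero {x} (inj₂ p) (inj₁ refl) eq = trans (sym (+-identityʳ x)) eq
  nonPos-zero {x} {y} (inj₂ p) (inj₂ q) eq =
    ⊥-elim (pos-0 (subst Pos (trans (-‿+-comm x y) (trans (cong -_ eq) -0#≈0#)) (pos-+ p q)))

  private
    module Solver = SemiringSolver commutativeSemiring

  -- Two even corners and two negated odd corners add up to zero. If none is positive, all four
  -- vanish; as `D` is regular, `w + 2a` and `w + 2a + 2b` both vanish, so 2b = 0.
  corner-positive : ∀ {D w a b} → Regular D → b ≢ 0# →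
    ¬ Pos (D * (w + (a + a) + (b + b))) → ¬ Pos (D * w) →
    ¬ Pos (- (D * (w + (a + a)))) → ¬ Pos (- (D * (w + (b + b)))) → ⊥
  corner-positive {D} {w} {a} {b} regD b≢0 ¬p₁ ¬p₂ ¬p₃ ¬p₄ = b≢0 (double-regular b (begin
      b + b ≡⟨ sym (+-identityˡ _) ⟩
      0# + (b + b) ≡⟨ cong (_+ (b + b)) (sym w+2a≡0) ⟩
      w + (a + a) + (b + b) ≡⟨ w+2a+2b≡0 ⟩
      0# ∎))
    where
    open ≡-Reasoning
    E = D * (w + (a + a) + (b + b)) + D * w
    O = - (D * (w + (a + a))) + - (D * (w + (b + b)))
    sum≡0 : E + O ≡ 0#
    sum≡0 = begin
      E + O
        ≡⟨ cong₂ _+_ (Solver.solve 4 (λ D w a b → D :* (w :+ (a :+ a) :+ (b :+ b)) :+ D :* w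
             := D :* (w :+ (a :+ a)) :+ D :* (w :+ (b :+ b))) refl D w a b) (-‿+-comm _ _) ⟩
      D * (w + (a + a)) + D * (w + (b + b)) + - (D * (w + (a + a)) + D * (w + (b + b))) ≡⟨ -‿inverseʳ _ ⟩
      0# ∎
      where open Solver using (_:+_; _:*_; _:=_)
    E≡0 : E ≡ 0#
    E≡0 = nonPos-zero (nonPos-+ (nonPos ¬p₁) (nonPos ¬p₂)) (nonPos-+ (nonPos ¬p₃) (nonPos ¬p₄)) sum≡0
    O≡0 : O ≡ 0#
    O≡0 = trans (sym (+-identityˡ O)) (trans (cong (_+ O) (sym E≡0)) sum≡0)
    w+2a+2b≡0 : w + (a + a) + (b + b) ≡ 0#
    w+2a+2b≡0 = regD _ (nonPos-zero (nonPos ¬p₁) (nonPos ¬p₂) E≡0)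
    w+2a≡0 : w + (a + a) ≡ 0#
    w+2a≡0 = regD _ (signed-zero L false (nonPos-zero (nonPos ¬p₃) (nonPos ¬p₄) O≡0))

module _ {m : ℕ} where
  set : (J m → Bool) → J m → Bool → J m → Bool
  set u p s j with j ≟J p
  ... | yes _ = s
  ... | no _ = u j

  set-≡ : ∀ u p s → set u p s p ≡ s
  set-≡ u p s with p ≟J p
  ... | yes _ = refl
  ... | no p≢p = ⊥-elim (p≢p refl)

  set-≢ : ∀ u p s {j} → j ≢ p → set u p s j ≡ u j
  set-≢ u p s {j} j≢p with j ≟J p
  ... | yes j≡p = ⊥-elim (j≢p j≡p)
  ... | no _ = refl

-- For k = 1 the two signs of one pair already give opposite values. For k > 1 two pairs are
-- required, spanning a face with four corners.
Enough : ∀ m → (J m → Set) → Set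
Enough zero F = F []
Enough (suc m) F = ∃₂ λ j l → j ≢ l × F j × F l

-- The four values of C · ζ on a two-dimensional face add up to zero (the twist in ζ gives the
-- mixed corners the opposite sign), and they cannot all vanish.
face : ∀ m {C} → RM.Regular m C → (u : J m → Bool) (F : J m → Set) → Enough m F →
       ∃ λ v → (∀ j → ¬ F j → v j ≡ u j) × RM.Pos m (RM._*_ m C (ζ v))
face zero {C} reg u F F[] = result
  where
  open RM zero
  outside : ∀ s i → ¬ F i → set u [] s i ≡ u i
  outside s [] ¬F[] = ⊥-elim (¬F[] F[])
  result : ∃ λ v → (∀ j → ¬ F j → v j ≡ u j) × Pos (C * ζ v)
  result with tri (C * ℤ.1ℤ)
  ... | inj₁ p = set u [] true , outside true , p
  ... | inj₂ (inj₁ z) with () ← reg ℤ.1ℤ z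
  ... | inj₂ (inj₂ p) = set u [] false , outside false , subst Pos (-‿distribʳ-* C ℤ.1ℤ) p
face (suc m) {C} reg u F (j , l , j≢l , Fj , Fl) = result
  where
  open RM (suc m)
  open ≡-Reasoning
  sgn = signed (ringR (suc m))
  v : Bool → Bool → J (suc m) → Bool
  v s s′ = set (set u j s) l s′
  v-j : ∀ s s′ → v s s′ j ≡ s
  v-j s s′ = trans (set-≢ (set u j s) l s′ j≢l) (set-≡ u j s)
  v-l : ∀ s s′ → v s s′ l ≡ s′
  v-l s s′ = set-≡ (set u j s) l s′
  v-same-j : ∀ s₁ s₂ s′ i → i ≢ j → v s₁ s′ i ≡ v s₂ s′ i
  v-same-j s₁ s₂ s′ i i≢j with i ≟J l
  ... | yes _ = refl
  ... | no _ = trans (set-≢ u j s₁ i≢j) (sym (set-≢ u j s₂ i≢j))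
  v-same-l : ∀ s s₁ s₂ i → i ≢ l → v s s₁ i ≡ v s s₂ i
  v-same-l s s₁ s₂ i i≢l = trans (set-≢ (set u j s) l s₁ i≢l) (sym (set-≢ (set u j s) l s₂ i≢l))
  v-outside : ∀ s s′ i → ¬ F i → v s s′ i ≡ u i
  v-outside s s′ i ¬Fi = trans (set-≢ (set u j s) l s′ {i} λ { refl → ¬Fi Fl })
      (set-≢ u j s {i} λ { refl → ¬Fi Fj })
  w = element (v false false)
  a = basis j
  b = basis l
  s₀ = xorJ (v true true)
  -- Absorbing the twist of the corner `v true true` into the constant leaves the even corners
  -- untwisted and negates the odd ones.
  D = sgn s₀ C
  xor-tf : xorJ (v true false) ≡ not s₀
  xor-tf = xorJ-update l (trans (v-l true false) (cong not (sym (v-l true true))))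
      (v-same-l true false true)
  xor-ft : xorJ (v false true) ≡ not s₀
  xor-ft = xorJ-update j (trans (v-j false true) (cong not (sym (v-j true true))))
      (v-same-j false true true)
  xor-ff : xorJ (v false false) ≡ s₀
  xor-ff = trans (xorJ-update l (trans (v-l false false) (cong not (sym (v-l false true))))
      (v-same-l false false true))
    (trans (cong not xor-ft) (Bool.not-involutive s₀))
  el-tf : element (v true false) ≡ w + (a + a)
  el-tf = element-update j (v-j true false) (v-j false false) (v-same-j false true false)
  el-ft : element (v false true) ≡ w + (b + b)
  el-ft = element-update l (v-l false true) (v-l false false) (v-same-l false false true)
  el-tt : element (v true true) ≡ w + (a + a) + (b + b)
  el-tt = trans (element-update l (v-l true true) (v-l true false) (v-same-l true false true))
      (cong (_+ (b + b)) el-tf)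
  even-corner : ∀ s s′ {y} → xorJ (v s s′) ≡ s₀ → element (v s s′) ≡ y → C * ζ (v s s′) ≡ D * y
  even-corner s s′ {y} eq eq′ = begin
    C * ζ (v s s′) ≡⟨ cong (C *_) (cong₂ sgn eq eq′) ⟩
    C * sgn s₀ y   ≡⟨ signed-*ʳ (ringR (suc m)) s₀ C y ⟩
    sgn s₀ (C * y) ≡⟨ sym (signed-*ˡ (ringR (suc m)) s₀ C y) ⟩
    D * y ∎
  odd-corner : ∀ s s′ {y} → xorJ (v s s′) ≡ not s₀ → element (v s s′) ≡ y → C * ζ (v s s′) ≡ - (D * y)
  odd-corner s s′ {y} eq eq′ = begin
    C * ζ (v s s′)       ≡⟨ cong (C *_) (cong₂ sgn eq eq′) ⟩
    C * sgn (not s₀) y   ≡⟨ signed-*ʳ (ringR (suc m)) (not s₀) C y ⟩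
    sgn (not s₀) (C * y) ≡⟨ signed-not (ringR (suc m)) s₀ (C * y) ⟩
    - sgn s₀ (C * y)     ≡⟨ cong -_ (sym (signed-*ˡ (ringR (suc m)) s₀ C y)) ⟩
    - (D * y) ∎
  result : ∃ λ v → (∀ j → ¬ F j → v j ≡ u j) × Pos (C * ζ v)
  result with pos? (C * ζ (v true true)) | pos? (C * ζ (v false false))
            | pos? (C * ζ (v true false)) | pos? (C * ζ (v false true))
  ... | yes p | _ | _ | _ = v true true , v-outside true true , p
  ... | no _ | yes p | _ | _ = v false false , v-outside false false , p
  ... | no _ | no _ | yes p | _ = v true false , v-outside true false , p
  ... | no _ | no _ | no _ | yes p = v false true , v-outside false true , p
  ... | no ¬p₁ | no ¬p₂ | no ¬p₃ | no ¬p₄ = ⊥-elim (corner-positive (ringR (suc m)) {D} {w} {a} {b}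
    (regular-signed (ringR (suc m)) s₀ reg) (basis≢0 l)
    (¬p₁ ∘ subst Pos (sym (even-corner true true refl el-tt)))
    (¬p₂ ∘ subst Pos (sym (even-corner false false xor-ff refl)))
    (¬p₃ ∘ subst Pos (sym (odd-corner true false xor-tf el-tf)))
    (¬p₄ ∘ subst Pos (sym (odd-corner false true xor-ft el-ft))))

-- Good sets

-- The bits tell whether +t^j and -t^j, in this order, belong to the set.
Pair : Set
Pair = Bool × Bool

Split : Pair → Set
Split (u , v) = v ≡ not u

split : Bool → Pair
split s = s , not s

compl : Pair → Pair
compl (u , v) = not u , not v

swapIf : Bool → Pair → Pair
swapIf false x = x
swapIf true x = swap x

swapIf-involutive : ∀ w x → swapIf w (swapIf w x) ≡ x
swapIf-involutive false x = refl
swapIf-involutive true x = refl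

split-swapIf : ∀ w x → Split x → Split (swapIf w x)
split-swapIf false x h = h
split-swapIf true (u , v) h = trans (sym (Bool.not-involutive u)) (cong not (sym h))

sign-swapIf : ∀ w x → Split x → proj₁ (swapIf w x) ≡ proj₁ x xor w
sign-swapIf false (u , v) h = sym (Bool.xor-identityʳ u)
sign-swapIf true (u , v) h = trans h (Bool.xor-comm true u)

split-compl : ∀ {x} → Split (compl x) → Split x
split-compl h = Bool.not-injective h

_≤ᵇ_ : Bool → Bool → Set
u ≤ᵇ v = u ≡ true → v ≡ true

module _ {A : Set} (L : NegacyclicRing A) where
  open Derived L

  charge : A → Pair → A
  charge x (true  , true)  = x
  charge x (false , false) = - x
  charge x (true  , false) = 0#
  charge x (false , true)  = 0#

  charge-split : ∀ x {v} → Split v → charge x v ≡ 0#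
  charge-split x {true , .false} refl = refl
  charge-split x {false , .true} refl = refl

  charge-compl : ∀ x v → charge x (compl v) ≡ - charge x v
  charge-compl x (true , true) = refl
  charge-compl x (false , false) = sym (-‿involutive x)
  charge-compl x (true , false) = sym -0#≈0#
  charge-compl x (false , true) = sym -0#≈0#

  charge-swapIf : ∀ x w v → charge x (swapIf w v) ≡ charge x v
  charge-swapIf x false v = refl
  charge-swapIf x true (true , true) = refl
  charge-swapIf x true (false , false) = refl
  charge-swapIf x true (true , false) = refl
  charge-swapIf x true (false , true) = refl

  open Sum *-commutativeMonoid public renaming (sum to prod; sum-permute to prod-permute; sum-cong-≗
      to prod-cong)
    using ()

  -- Phrased without division so as to cover both uses: inserting the factor left out of a cofactor,
  -- and multiplying a single factor by `shiftUnit`.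
  prod-update : ∀ {n} {f g : Fin n → A} i c → c * g i ≡ f i → (∀ l → l ≢ i → g l ≡ f l) →
      c * prod g ≡ prod f
  prod-update {suc n} {f} {g} zero c gi h =
    trans (sym (*-assoc c _ _)) (cong₂ _*_ gi (prod-cong λ l → h (suc l) λ ()))
  prod-update {suc n} {f} {g} (suc i) c gi h = begin
    c * (g zero * prod (g ∘ suc)) ≡⟨ sym (*-assoc c _ _) ⟩
    c * g zero * prod (g ∘ suc)   ≡⟨ cong (_* prod (g ∘ suc)) (*-comm c _) ⟩
    g zero * c * prod (g ∘ suc)   ≡⟨ *-assoc _ c _ ⟩
    g zero * (c * prod (g ∘ suc)) ≡⟨ cong₂ _*_ (h zero λ ())
        (prod-update {n} {f ∘ suc} {g ∘ suc} i c gi λ l l≢i → h (suc l) (l≢i ∘ Fin.suc-injective)) ⟩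
    f zero * prod (f ∘ suc) ∎
    where open ≡-Reasoning

  prod-regular : ∀ {n} (f : Fin n → A) → (∀ i → Regular (f i)) → Regular (prod f)
  prod-regular {zero} f h = regular-1
  prod-regular {suc n} f h = regular-* (h zero) (prod-regular (f ∘ suc) (h ∘ suc))

  neg-*-neg : ∀ x y → - x * - y ≡ x * y
  neg-*-neg x y = trans (sym (-‿distribˡ-* x (- y)))
      (trans (cong -_ (sym (-‿distribʳ-* x y))) (-‿involutive _))

  prod-± : ∀ {n} (f g : Fin n → A) → (∀ i → g i ≡ f i ⊎ g i ≡ - f i) → prod g ≡ prod f ⊎ prod g ≡ - prod f
  prod-± {zero} f g h = inj₁ refl
  prod-± {suc n} f g h with h zero | prod-± (f ∘ suc) (g ∘ suc) (h ∘ suc)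
  ... | inj₁ p | inj₁ q = inj₁ (cong₂ _*_ p q)
  ... | inj₁ p | inj₂ q = inj₂ (trans (cong₂ _*_ p q) (sym (-‿distribʳ-* _ _)))
  ... | inj₂ p | inj₁ q = inj₂ (trans (cong₂ _*_ p q) (sym (-‿distribˡ-* _ _)))
  ... | inj₂ p | inj₂ q = inj₁ (trans (cong₂ _*_ p q) (neg-*-neg _ _))

  prod-neg : ∀ {n} (f g : Fin n → A) → (∀ i → g i ≡ - f i) → prod g ≡ signed L (not (odd n)) (prod f)
  prod-neg {zero} f g h = refl
  prod-neg {suc n} f g h = trans (cong₂ _*_ (h zero) (prod-neg (f ∘ suc) (g ∘ suc) (h ∘ suc)))
    (trans (sym (-‿distribˡ-* _ _)) (trans (cong -_ (signed-*ʳ L (not (odd n)) _ _))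
        (sym (signed-not L (not (odd n)) _))))

  weigh : ∀ {m} → (J m → A) → (J m → Pair) → A
  weigh x X = sumJ L λ j → charge (x j) (X j)

  weigh-cong : ∀ {m} {x y : J m → A} {X Y : J m → Pair} → (∀ j → x j ≡ y j) → (∀ j → X j ≡ Y j) →
               weigh x X ≡ weigh y Y
  weigh-cong h k = sumJ-cong L λ j → cong₂ charge (h j) (k j)

  weigh-split : ∀ {m} (x : J m → A) {X : J m → Pair} → (∀ j → Split (X j)) → weigh x X ≡ 0#
  weigh-split x h = sumJ-zero L λ j → charge-split (x j) (h j)

  weigh-compl : ∀ {m} (x : J m → A) (X : J m → Pair) → weigh x (compl ∘ X) ≡ - weigh x X
  weigh-compl x X = sumJ-neg L λ j → charge-compl (x j) (X j)

  weigh-τ : ∀ {m} {x y : J m → A} {X Y : J m → Pair} → (∀ j → y (τ j) ≡ x j) →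
            (∀ j → Y (τ j) ≡ swapIf (wraps j) (X j)) → weigh y Y ≡ weigh x X
  weigh-τ {x = x} {y} {X} {Y} h k = trans (sym (sumJ-τ L λ j → charge (y j) (Y j)))
    (sumJ-cong L λ j → trans (cong₂ charge (h j) (k j)) (charge-swapIf (x j) (wraps j) (X j)))

charge-mono : ∀ {u v u′ v′} → u ≤ᵇ u′ → v ≤ᵇ v′ → charge integers ℤ.1ℤ
    (u , v) ℤ.≤ charge integers ℤ.1ℤ (u′ , v′)
charge-mono {true} {true} {true} {true} p q = ℤ.≤-refl
charge-mono {true} {true} {u′} {false} p q with () ← q refl
charge-mono {true} {true} {false} {v′} p q with () ← p refl
charge-mono {true} {false} {true} {true} p q = ℤ.+≤+ ℕ.z≤n
charge-mono {true} {false} {true} {false} p q = ℤ.≤-refl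
charge-mono {true} {false} {false} {v′} p q with () ← p refl
charge-mono {false} {true} {true} {true} p q = ℤ.+≤+ ℕ.z≤n
charge-mono {false} {true} {false} {true} p q = ℤ.≤-refl
charge-mono {false} {true} {u′} {false} p q with () ← q refl
charge-mono {false} {false} {true} {true} p q = ℤ.-≤+
charge-mono {false} {false} {true} {false} p q = ℤ.-≤+
charge-mono {false} {false} {false} {true} p q = ℤ.-≤+
charge-mono {false} {false} {false} {false} p q = ℤ.≤-refl

charge-mono-≡ : ∀ {u v u′ v′} → u ≤ᵇ u′ → v ≤ᵇ v′ →
    charge integers ℤ.1ℤ (u , v) ≡ charge integers ℤ.1ℤ (u′ , v′) →
                (u , v) ≡ (u′ , v′)
charge-mono-≡ {false} {false} {true} {true} p q ()
charge-mono-≡ {false} {false} {false} {true} p q ()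
charge-mono-≡ {true} {true} {true} {true} p q eq = refl
charge-mono-≡ {true} {true} {u′} {false} p q eq with () ← q refl
charge-mono-≡ {true} {true} {false} {v′} p q eq with () ← p refl
charge-mono-≡ {true} {false} {true} {false} p q eq = refl
charge-mono-≡ {true} {false} {false} {v′} p q eq with () ← p refl
charge-mono-≡ {false} {true} {false} {true} p q eq = refl
charge-mono-≡ {false} {true} {u′} {false} p q eq with () ← q refl
charge-mono-≡ {false} {false} {false} {false} p q eq = refl

sum-mono : ∀ {m} {f g : J m → ℤ} → (∀ j → f j ℤ.≤ g j) → sumJ integers f ℤ.≤ sumJ integers g
sum-mono {zero} h = h []
sum-mono {suc m} h = ℤ.+-mono-≤ (sum-mono (h ∘ (false ∷_))) (sum-mono (h ∘ (true ∷_)))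

+-tight : ∀ {a b c d} → a ℤ.≤ c → b ℤ.≤ d → a ℤ.+ b ≡ c ℤ.+ d → a ≡ c × b ≡ d
+-tight {a} {b} {c} {d} p q eq with a ℤ.≟ c
... | no a≢c = ⊥-elim (ℤ.<-irrefl eq (ℤ.+-mono-<-≤ (ℤ.≤∧≢⇒< p a≢c) q))
... | yes refl = refl , Derived.+-cancelˡ integers a b d eq

sum-tight : ∀ {m} {f g : J m → ℤ} → (∀ j → f j ℤ.≤ g j) → sumJ integers f ≡ sumJ integers g → ∀ j →
    f j ≡ g j
sum-tight {zero} h eq [] = eq
sum-tight {suc m} h eq j with +-tight (sum-mono (h ∘ (false ∷_))) (sum-mono (h ∘ (true ∷_))) eq
sum-tight {suc m} h eq (false ∷ j) | p , q = sum-tight (h ∘ (false ∷_)) p j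
sum-tight {suc m} h eq (true ∷ j) | p , q = sum-tight (h ∘ (true ∷_)) q j

allJ? : ∀ {m} {P : J m → Set} → (∀ j → Dec (P j)) → Dec (∀ j → P j)
allJ? {zero} P? with P? []
... | yes p = yes λ { [] → p }
... | no ¬p = no λ h → ¬p (h [])
allJ? {suc m} P? with allJ? (P? ∘ (false ∷_)) | allJ? (P? ∘ (true ∷_))
... | no ¬p | _ = no λ h → ¬p (h ∘ (false ∷_))
... | yes _ | no ¬q = no λ h → ¬q (h ∘ (true ∷_))
... | yes p | yes q = yes λ { (false ∷ j) → p j ; (true ∷ j) → q j }

split? : ∀ x → Dec (Split x)
split? (u , v) = v Bool.≟ not u

indicator : ∀ {b} → Fin b → Fin b → ℤ
indicator i l = if does (l Fin.≟ i) then ℤ.1ℤ else ℤ.0ℤ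

indicator-≡ : ∀ {b} (i : Fin b) → indicator i i ≡ ℤ.1ℤ
indicator-≡ i rewrite dec-true (i Fin.≟ i) refl = refl

indicator-≢ : ∀ {b} {i l : Fin b} → l ≢ i → indicator i l ≡ ℤ.0ℤ
indicator-≢ {i = i} {l} l≢i rewrite dec-false (l Fin.≟ i) l≢i = refl

dipole : ∀ {b} → Fin b → Fin b → Fin b → ℤ
dipole i j l = indicator i l ℤ.- indicator j l

dipole-head : ∀ {b} {i j : Fin b} → i ≢ j → dipole i j i ≡ ℤ.1ℤ
dipole-head {i = i} i≢j = cong₂ ℤ._-_ (indicator-≡ i) (indicator-≢ i≢j)

dipole-tail : ∀ {b} {i j : Fin b} → i ≢ j → dipole i j j ≡ ℤ.-1ℤ
dipole-tail {i = i} {j} i≢j = cong₂ ℤ._-_ (indicator-≢ (i≢j ∘ sym)) (indicator-≡ j)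

dipole-anti : ∀ {b} (i j l : Fin b) → ℤ.- dipole i j l ≡ dipole j i l
dipole-anti i j l = trans (ℤ.neg-distrib-+ (indicator i l) (ℤ.- indicator j l))
  (trans (cong (λ x → ℤ.- indicator i l ℤ.+ x) (ℤ.neg-involutive (indicator j l)))
      (ℤ.+-comm (ℤ.- indicator i l) _))

dipole-≥1 : ∀ {b} (i j l : Fin b) → ℤ.1ℤ ℤ.≤ dipole i j l → l ≡ i
dipole-≥1 i j l h with l Fin.≟ i | l Fin.≟ j
... | yes p | _ = p
... | no _ | yes _ with () ← h
... | no _ | no _ with ℤ.+≤+ () ← h

-- Good sets, their complements and their subsets

module Outcome (m b : ℕ) (arc : Fin b → Fin b → Set) (arc-irrefl : ∀ {i j} → arc i j → i ≢ j)
               (arc-asym : ∀ {i j} → arc i j → ¬ arc j i) where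
  open RM m

  Config : Set
  Config = Fin b → J m → Pair

  signs : (J m → Pair) → J m → Bool
  signs X j = proj₁ (X j)

  balance : (J m → Pair) → ℤ
  balance = weigh integers λ _ → ℤ.1ℤ

  -- Block `i` contributes 1 instead of being skipped, so that every product runs over all blocks.
  factor : Fin b → Config → Fin b → R m
  factor i A l = if does (l Fin.≟ i) then 1# else ζ (signs (A l))

  cofactor : Fin b → Config → R m
  cofactor i A = prod (ringR m) (factor i A)

  -- The absolute value removes the dependence on the sign of `C`, which may change under
  -- complementation, and on the exchange of the two points of a pair at a wrap.
  magnitude : R m → J m → R m
  magnitude C j = abs (C * basis j)

  weight : Config → Fin b → R m
  weight A i = weigh (ringR m) (magnitude (cofactor i A)) (A i)

  total : Config → R m
  total A = prod (ringR m) λ l → ζ (signs (A l))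

  Dipolar Unipolar Neutral Good : Config → Set
  Dipolar A = ∃₂ λ i j → arc i j × ∀ l → balance (A l) ≡ dipole i j l
  Unipolar A = ∃ λ i → (∀ l → l ≢ i → ∀ p → Split (A l p)) × balance (A i) ≡ ℤ.0ℤ × Pos (weight A i)
  Neutral A = (∀ l p → Split (A l p)) × Pos (total A)
  Good A = Dipolar A ⊎ Unipolar A ⊎ Neutral A

  factor-≡ : ∀ i A → factor i A i ≡ 1#
  factor-≡ i A rewrite dec-true (i Fin.≟ i) refl = refl

  factor-≢ : ∀ {i l} A → l ≢ i → factor i A l ≡ ζ (signs (A l))
  factor-≢ {i} {l} A l≢i rewrite dec-false (l Fin.≟ i) l≢i = refl

  factor-cong : ∀ {A A′ : Config} i → (∀ l → l ≢ i → ∀ p → signs (A l) p ≡ signs (A′ l) p) → ∀ l →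
      factor i A l ≡ factor i A′ l
  factor-cong {A} {A′} i h l with l Fin.≟ i
  ... | yes _ = refl
  ... | no l≢i = ζ-cong {u = signs (A l)} {signs (A′ l)} (h l l≢i)

  cofactor-cong : ∀ {A A′ : Config} i → (∀ l → l ≢ i → ∀ p → signs (A l) p ≡ signs (A′ l) p) →
      cofactor i A ≡ cofactor i A′
  cofactor-cong {A} {A′} i h = prod-cong (ringR m) (factor-cong {A} {A′} i h)

  cofactor-regular : ∀ i A → Regular (cofactor i A)
  cofactor-regular i A = prod-regular (ringR m) (factor i A) λ l → lemma l
    where
    lemma : ∀ l → Regular (factor i A l)
    lemma l with l Fin.≟ i
    ... | yes _ = regular-1
    ... | no _ = ζ-regular (signs (A l))

  total-factor : ∀ i A → total A ≡ cofactor i A * ζ (signs (A i))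
  total-factor i A = trans (sym (prod-update (ringR m) {f = λ l → ζ (signs (A l))} {factor i A} i
      (ζ (signs (A i)))
    (trans (cong (ζ (signs (A i)) *_) (factor-≡ i A)) (trans (*-comm _ 1#) (*-identityˡ _)))
    (λ l l≢i → factor-≢ A l≢i))) (*-comm _ _)

  balance-cong : ∀ (X Y : J m → Pair) → (∀ p → X p ≡ Y p) → balance X ≡ balance Y
  balance-cong X Y = weigh-cong integers {X = X} {Y} λ _ → refl

  good-cong : ∀ {A A′ : Config} → (∀ l p → A l p ≡ A′ l p) → Good A → Good A′
  good-cong {A} {A′} h (inj₁ (i , j , a , d)) =
    inj₁ (i , j , a , λ l → trans (sym (balance-cong (A l) (A′ l) (h l))) (d l))
  good-cong {A} {A′} h (inj₂ (inj₁ (i , s , d , w))) =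
    inj₂ (inj₁ (i , (λ l l≢i p → subst Split (h l p) (s l l≢i p)) ,
      trans (sym (balance-cong (A i) (A′ i) (h i))) d ,
      subst Pos (weigh-cong (ringR m) {X = A i} {A′ i}
        (λ j → cong (λ C → magnitude C j) (cofactor-cong {A} {A′} i λ l _ p → cong proj₁ (h l p)))
            (h i)) w))
  good-cong {A} {A′} h (inj₂ (inj₂ (s , w))) = inj₂ (inj₂ ((λ l p → subst Split (h l p) (s l p)) ,
    subst Pos (prod-cong (ringR m) λ l → ζ-cong {u = signs (A l)} {signs (A′ l)} λ p →
        cong proj₁ (h l p)) w))

  good? : (∀ i j → Dec (arc i j)) → ∀ A → Dec (Good A)
  good? arc? A =
    Fin.any? (λ i → Fin.any? λ j → arc? i j ×-dec Fin.all? λ l → balance (A l) ℤ.≟ dipole i j l)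
    ⊎-dec (Fin.any? (λ i → Fin.all? (λ l → ¬? (l Fin.≟ i) →-dec allJ? λ p → split? (A l p))
                           ×-dec (balance (A i) ℤ.≟ ℤ.0ℤ ×-dec pos? (weight A i)))
    ⊎-dec (Fin.all? (λ l → allJ? λ p → split? (A l p)) ×-dec pos? (total A)))

  complement : Config → Config
  complement A l p = compl (A l p)

  balance-compl : ∀ A l → balance (complement A l) ≡ ℤ.- balance (A l)
  balance-compl A l = weigh-compl integers (λ _ → ℤ.1ℤ) (A l)

  cofactor-compl : ∀ i A → cofactor i (complement A) ≡ cofactor i A ⊎ cofactor i
      (complement A) ≡ - cofactor i A
  cofactor-compl i A = prod-± (ringR m) (factor i A) (factor i (complement A)) lemma
    where
    lemma : ∀ l → factor i (complement A) l ≡ factor i A l ⊎ factor i (complement A) l ≡ - factor i A l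
    lemma l with l Fin.≟ i
    ... | yes _ = inj₁ refl
    ... | no _ = inj₂ (ζ-not (signs (A l)))

  magnitude-neg : ∀ {C C′} → C′ ≡ C ⊎ C′ ≡ - C → ∀ j → magnitude C′ j ≡ magnitude C j
  magnitude-neg (inj₁ refl) j = refl
  magnitude-neg {C} (inj₂ refl) j = trans (cong abs (sym (-‿distribˡ-* C _))) (abs-neg _)

  weight-compl : ∀ A i → weight (complement A) i ≡ - weight A i
  weight-compl A i = trans (weigh-cong (ringR m) {X = complement A i}
      (magnitude-neg (cofactor-compl i A)) (λ _ → refl))
    (weigh-compl (ringR m) (magnitude (cofactor i A)) (A i))

  balance-split : ∀ (X : J m → Pair) → (∀ p → Split (X p)) → balance X ≡ ℤ.0ℤ
  balance-split X = weigh-split integers (λ _ → ℤ.1ℤ) {X}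

  weight-split : ∀ A i → (∀ p → Split (A i p)) → weight A i ≡ 0#
  weight-split A i = weigh-split (ringR m) (magnitude (cofactor i A)) {A i}

  Balanced : Config → Set
  Balanced A = (∃₂ λ i j → arc i j × ∀ l → balance (A l) ≡ dipole i j l) ⊎ (∀ l → balance (A l) ≡ ℤ.0ℤ)

  good-balance : ∀ A → Good A → Balanced A
  good-balance A (inj₁ g) = inj₁ g
  good-balance A (inj₂ (inj₁ (i , s , d , _))) = inj₂ lemma
    where
    lemma : ∀ l → balance (A l) ≡ ℤ.0ℤ
    lemma l with l Fin.≟ i
    ... | yes refl = d
    ... | no l≢i = balance-split (A l) (s l l≢i)
  good-balance A (inj₂ (inj₂ (s , _))) = inj₂ λ l → balance-split (A l) (s l)

  dipole≢0 : ∀ {i j} {A : Config} → arc i j → (∀ l → balance (A l) ≡ dipole i j l) →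
      (∀ l → balance (A l) ≡ ℤ.0ℤ) → ⊥
  dipole≢0 {i} {j} a d z with () ← trans (sym (dipole-head {i = i} {j} (arc-irrefl a)))
      (trans (sym (d i)) (z i))

  module _ (odd-b : odd b ≡ true) where
    -- Each of the `b` factors changes sign, and `b` is odd.
    total-compl : ∀ A → total (complement A) ≡ - total A
    total-compl A = trans (prod-neg (ringR m) _ _ λ l → ζ-not (signs (A l)))
      (cong (λ s → signed (ringR m) (not s) (total A)) odd-b)

    -- Balances tell dipolar sets from the others. For two unipolar sets with different exceptional
    -- blocks, or a unipolar and a neutral one, one of the two sets splits the exceptional block of
    -- the other, which makes a weight vanish. In the remaining cases complementation reverses the
    -- arc or negates the weight or the total.
    good-asym : ∀ A → Good A → ¬ Good (complement A)
    good-asym A (inj₁ (i , j , a , d)) (inj₁ (i′ , j′ , a′ , d′)) = arc-asym a (subst₂ arc j≡ i≡ a′)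
      where
      eq : ∀ l → dipole i j l ≡ dipole j′ i′ l
      eq l = trans (sym (d l)) (trans (sym (ℤ.neg-involutive (balance (A l))))
          (trans (cong ℤ.-_ (trans (sym (balance-compl A l)) (d′ l))) (dipole-anti i′ j′ l)))
      i≡ : j′ ≡ i
      i≡ = sym (dipole-≥1 j′ i′ i (ℤ.≤-reflexive (trans (sym (dipole-head {j = j} (arc-irrefl a))) (eq i))))
      j≡ : i′ ≡ j
      j≡ = sym (dipole-≥1 i′ j′ j (ℤ.≤-reflexive (trans
          (cong ℤ.-_ (sym (dipole-tail {i = i} (arc-irrefl a))))
        (trans (cong ℤ.-_ (eq j)) (dipole-anti j′ i′ j)))))
    good-asym A (inj₁ (i , j , a , d)) (inj₂ g) with good-balance (complement A) (inj₂ g)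
    ... | inj₂ z = dipole≢0 {i} {j} {A} a d λ l → trans (sym (ℤ.neg-involutive (balance (A l))))
        (cong ℤ.-_ (trans (sym (balance-compl A l)) (z l)))
    -- This alternative never arises for a set that is not dipolar, but the type of `good-balance`
    -- allows it; the dipolar case disposes of it.
    ... | inj₁ (i′ , j′ , a′ , d′) = good-asym A (inj₁ (i , j , a , d)) (inj₁ (i′ , j′ , a′ , d′))
    good-asym A (inj₂ g) (inj₁ (i′ , j′ , a′ , d′)) with good-balance A (inj₂ g)
    ... | inj₂ z = dipole≢0 {i′} {j′} {complement A} a′ d′ λ l → trans (balance-compl A l) (cong ℤ.-_ (z l))
    ... | inj₁ (i , j , a , d) = good-asym A (inj₁ (i , j , a , d)) (inj₁ (i′ , j′ , a′ , d′))
    good-asym A (inj₂ (inj₁ (i , s , _ , w))) (inj₂ (inj₁ (i′ , s′ , _ , w′))) with i′ Fin.≟ i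
    ... | yes refl = pos-irrefl w (subst Pos (weight-compl A i) w′)
    ... | no i′≢i = pos-0 (subst Pos (weight-split A i λ p → split-compl (s′ i (i′≢i ∘ sym) p)) w)
    good-asym A (inj₂ (inj₁ (i , s , _ , w))) (inj₂ (inj₂ (s′ , _))) =
      pos-0 (subst Pos (weight-split A i λ p → split-compl (s′ i p)) w)
    good-asym A (inj₂ (inj₂ (s , _))) (inj₂ (inj₁ (i′ , _ , _ , w′))) =
      pos-0 (subst Pos (trans (weight-compl A i′) (trans (cong -_ (weight-split A i′ (s i′))) -0#≈0#)) w′)
    good-asym A (inj₂ (inj₂ (_ , w))) (inj₂ (inj₂ (_ , w′))) = pos-irrefl w (subst Pos (total-compl A) w′)

    _≼_ : Config → Config → Set
    B ≼ A = ∀ l p → proj₁ (B l p) ≤ᵇ proj₁ (A l p) × proj₂ (B l p) ≤ᵇ proj₂ (A l p)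

    ≼-balance : ∀ {A B} → B ≼ A → ∀ l → balance (B l) ℤ.≤ balance (A l)
    ≼-balance h l = sum-mono λ p → charge-mono (proj₁ (h l p)) (proj₂ (h l p))

    ≼-tight : ∀ {A B} → B ≼ A → (∀ l → balance (B l) ≡ balance (A l)) → ∀ l p → B l p ≡ A l p
    ≼-tight h eq l p = charge-mono-≡ (proj₁ (h l p)) (proj₂ (h l p))
      (sum-tight (λ p → charge-mono (proj₁ (h l p)) (proj₂ (h l p))) (eq l) p)

    -- A dipole takes both values 1 and -1, so it is comparable neither with the zero profile nor
    -- with a different dipole.
    balance-below : ∀ {A B} → B ≼ A → Balanced A → Balanced (complement B) → ∀ l →
        balance (B l) ≡ balance (A l)
    balance-below {A} {B} h bA bB with bA | bB
    ... | inj₂ z | inj₂ z′ = λ l → trans (neg-balance l (z′ l)) (sym (z l))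
      where
      neg-balance : ∀ l {x} → balance (complement B l) ≡ x → balance (B l) ≡ ℤ.- x
      neg-balance l eq = trans (sym (ℤ.neg-involutive (balance (B l))))
          (cong ℤ.-_ (trans (sym (balance-compl B l)) eq))
    ... | inj₁ (i , j , a , d) | inj₂ z′ = ⊥-elim (lemma (subst₂ ℤ._≤_
            (trans (sym (ℤ.neg-involutive (balance (B j))))
                (cong ℤ.-_ (trans (sym (balance-compl B j)) (z′ j))))
            (trans (d j) (dipole-tail {i = i} (arc-irrefl a))) (≼-balance h j)))
      where
      lemma : ¬ (ℤ.0ℤ ℤ.≤ ℤ.-1ℤ)
      lemma ()
    ... | inj₂ z | inj₁ (i′ , j′ , a′ , d′) = ⊥-elim (lemma (subst₂ ℤ._≤_
            (trans (sym (ℤ.neg-involutive (balance (B j′))))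
                (cong ℤ.-_ (trans (sym (balance-compl B j′))
                (trans (d′ j′) (dipole-tail {i = i′} (arc-irrefl a′))))))
            (z j′) (≼-balance h j′)))
      where
      lemma : ¬ (ℤ.1ℤ ℤ.≤ ℤ.0ℤ)
      lemma (ℤ.+≤+ ())
    ... | inj₁ (i , j , a , d) | inj₁ (i′ , j′ , a′ , d′) = λ l →
        trans (B-dipole l) (trans (cong₂ (λ x y → dipole x y l) j′≡i i′≡j) (sym (d l)))
      where
      B-dipole : ∀ l → balance (B l) ≡ dipole j′ i′ l
      B-dipole l = trans (sym (ℤ.neg-involutive (balance (B l))))
          (trans (cong ℤ.-_ (trans (sym (balance-compl B l)) (d′ l))) (dipole-anti i′ j′ l))
      below : ∀ l → dipole j′ i′ l ℤ.≤ dipole i j l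
      below l = subst₂ ℤ._≤_ (B-dipole l) (d l) (≼-balance h l)
      j′≡i : j′ ≡ i
      j′≡i = dipole-≥1 i j j′ (subst (ℤ._≤ dipole i j j′)
          (dipole-head {i = j′} {i′} (arc-irrefl a′ ∘ sym)) (below j′))
      i′≡j : i′ ≡ j
      i′≡j = sym (dipole-≥1 i′ j′ j (subst₂ ℤ._≤_ (trans
          (cong ℤ.-_ (dipole-tail {i = i} (arc-irrefl a))) refl)
        (dipole-anti j′ i′ j) (ℤ.neg-mono-≤ (below j))))

    -- Equal balances in all blocks leave no room for a proper inclusion, and equality contradicts
    -- `good-asym`. This is why Player I, holding part of a good set, has completed no line.
    good-antichain : ∀ {A B} → B ≼ A → Good A → ¬ Good (complement B)
    good-antichain {A} {B} h gA gB = good-asym A gA (good-cong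
      (λ l p → cong compl (≼-tight h (balance-below h (good-balance A gA)
          (good-balance (complement B) gB)) l p)) gB)

-- Invariance of the good sets

indicator-injective : ∀ {b c} (f : Fin b → Fin c) → (∀ {i l} → f i ≡ f l → i ≡ l) → ∀ i l →
                      indicator (f i) (f l) ≡ indicator i l
indicator-injective f inj i l with l Fin.≟ i
... | yes refl = indicator-≡ (f i)
... | no l≢i = indicator-≢ (l≢i ∘ inj)

module Symmetry (m b : ℕ) (arc : Fin b → Fin b → Set) (arc-irrefl : ∀ {i j} → arc i j → i ≢ j)
                (arc-asym : ∀ {i j} → arc i j → ¬ arc j i) where
  open RM m
  open Outcome m b arc arc-irrefl arc-asym

  module _ (π : Permutation′ b) (π-arc : ∀ {i j} → arc i j → arc (π ⟨$⟩ʳ i) (π ⟨$⟩ʳ j))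
           {A A′ : Config} (moved : ∀ l p → A′ (π ⟨$⟩ʳ l) p ≡ A l p) where
    private
      f : Fin b → Fin b
      f = π ⟨$⟩ʳ_

      f-injective : ∀ {i l} → f i ≡ f l → i ≡ l
      f-injective {i} {l} eq = trans (sym (inverseˡ π)) (trans (cong (π ⟨$⟩ˡ_) eq) (inverseˡ π))

      preimage : ∀ {P : Fin b → Set} → (∀ l → P (f l)) → ∀ l → P l
      preimage {P} h l = subst P (inverseʳ π) (h (π ⟨$⟩ˡ l))

      balance-moved : ∀ l → balance (A′ (f l)) ≡ balance (A l)
      balance-moved l = balance-cong (A′ (f l)) (A l) (moved l)

      ζ-moved : ∀ l → ζ (signs (A′ (f l))) ≡ ζ (signs (A l))
      ζ-moved l = ζ-cong {u = signs (A′ (f l))} {signs (A l)} λ p → cong proj₁ (moved l p)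

      factor-moved : ∀ i l → factor (f i) A′ (f l) ≡ factor i A l
      factor-moved i l with l Fin.≟ i
      ... | yes refl = factor-≡ (f i) A′
      ... | no l≢i = trans (factor-≢ A′ (l≢i ∘ f-injective)) (ζ-moved l)

      cofactor-moved : ∀ i → cofactor (f i) A′ ≡ cofactor i A
      cofactor-moved i = trans (prod-permute (ringR m) (factor (f i) A′) π)
          (prod-cong (ringR m) (factor-moved i))

      total-moved : total A′ ≡ total A
      total-moved = trans (prod-permute (ringR m) (λ l → ζ (signs (A′ l))) π) (prod-cong (ringR m) ζ-moved)

    good-permute : Good A → Good A′
    good-permute (inj₁ (i , j , a , d)) = inj₁ (f i , f j , π-arc a , preimage λ l →
      trans (balance-moved l) (trans (d l)
        (sym (cong₂ ℤ._-_ (indicator-injective f f-injective i l)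
            (indicator-injective f f-injective j l)))))
    good-permute (inj₂ (inj₁ (i , s , d , w))) = inj₂ (inj₁ (f i ,
      preimage (λ l fl≢fi p → subst Split (sym (moved l p)) (s l (fl≢fi ∘ cong f) p)) ,
      trans (balance-moved i) d ,
      subst Pos (sym (weigh-cong (ringR m) {X = A′ (f i)} {A i}
          (λ j → cong (λ C → magnitude C j) (cofactor-moved i)) (moved i))) w))
    good-permute (inj₂ (inj₂ (s , w))) = inj₂ (inj₂ (
      preimage (λ l p → subst Split (sym (moved l p)) (s l p)) , subst Pos (sym total-moved) w))

  -- Block `i` is multiplied by t; where the exponent wraps, t^k = -1 exchanges the two points of
  -- the pair.
  Shift : Fin b → Config → Config → Set
  Shift i A M = (∀ p → M i (τ p) ≡ swapIf (wraps p) (A i p)) × (∀ l → l ≢ i → ∀ p → M l p ≡ A l p)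

  private
    c : R m
    c = shiftUnit m

    balance-shift : ∀ {i A M} → Shift i A M → ∀ l → balance (M l) ≡ balance (A l)
    balance-shift {i} {A} {M} (h , k) l with l Fin.≟ i
    ... | yes refl = weigh-τ integers {X = A i} {M i} (λ _ → refl) h
    ... | no l≢i = balance-cong (M l) (A l) (k l l≢i)

    split-shift : ∀ {i A M} → Shift i A M → ∀ l → (∀ p → Split (A l p)) → ∀ p → Split (M l p)
    split-shift {i} {A} {M} (h , k) l s p with l Fin.≟ i
    ... | yes refl = subst (Split ∘ M i) (τ-τ⁻¹ p)
        (subst Split (sym (h (τ⁻¹ p))) (split-swapIf (wraps (τ⁻¹ p)) (A i (τ⁻¹ p)) (s (τ⁻¹ p))))
    ... | no l≢i = subst Split (sym (k l l≢i p)) (s p)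

    split-unshift : ∀ {i A M} → Shift i A M → ∀ l → (∀ p → Split (M l p)) → ∀ p → Split (A l p)
    split-unshift {i} {A} {M} (h , k) l s p with l Fin.≟ i
    ... | yes refl = subst Split (trans (cong (swapIf (wraps p)) (h p))
        (swapIf-involutive (wraps p) (A i p)))
                       (split-swapIf (wraps p) (M i (τ p)) (s (τ p)))
    ... | no l≢i = subst Split (k l l≢i p) (s p)

    ζ-shift : ∀ {i A M} → Shift i A M → (∀ p → Split (A i p)) → c * ζ (signs (A i)) ≡ ζ (signs (M i))
    ζ-shift {i} {A} {M} (h , _) s = sym (ζ-τ {u = signs (A i)} {signs (M i)} λ p →
        trans (cong proj₁ (h p)) (sign-swapIf (wraps p) (A i p) (s p)))

    cofactor-shift : ∀ {i A M} → Shift i A M → ∀ l → l ≢ i → (∀ p → Split (A i p)) →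
        c * cofactor l A ≡ cofactor l M
    cofactor-shift {i} {A} {M} sh l l≢i s = prod-update (ringR m) {f = factor l M} {factor l A} i c
      (trans (cong (c *_) (factor-≢ A (l≢i ∘ sym)))
          (trans (ζ-shift {i} {A} {M} sh s) (sym (factor-≢ M (l≢i ∘ sym))))) other
      where
      other : ∀ x → x ≢ i → factor l A x ≡ factor l M x
      other x x≢i with x Fin.≟ l
      ... | yes _ = refl
      ... | no _ = ζ-cong {u = signs (A x)} {signs (M x)} λ p → cong proj₁ (sym (proj₂ sh x x≢i p))

    cofactor-shift-self : ∀ {i A M} → Shift i A M → cofactor i A ≡ cofactor i M
    cofactor-shift-self {i} {A} {M} (_ , k) = cofactor-cong {A} {M} i λ l l≢i p →
        cong proj₁ (sym (k l l≢i p))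

    total-shift : ∀ {i A M} → Shift i A M → (∀ p → Split (A i p)) → c * total A ≡ total M
    total-shift {i} {A} {M} sh s = prod-update (ringR m) {f = λ l → ζ (signs (M l))}
        {λ l → ζ (signs (A l))} i c
      (ζ-shift {i} {A} {M} sh s) λ x x≢i → ζ-cong {u = signs (A x)} {signs (M x)} λ p →
          cong proj₁ (sym (proj₂ sh x x≢i p))

    magnitude-shift : ∀ C p → magnitude C (τ p) ≡ magnitude (c * C) p
    magnitude-shift C p = let (s , eq) = shiftUnit*basis p in begin
      abs (C * basis (τ p))                      ≡⟨ sym (abs-signed (ringR m) s _) ⟩
      abs (signed (ringR m) s (C * basis (τ p))) ≡⟨ cong abs (sym (signed-*ʳ (ringR m) s C _)) ⟩
      abs (C * signed (ringR m) s (basis (τ p))) ≡⟨ cong (λ x → abs (C * x)) (sym eq) ⟩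
      abs (C * (c * basis p))                    ≡⟨ cong abs
          (trans (sym (*-assoc C c _)) (cong (_* basis p) (*-comm C c))) ⟩
      abs (c * C * basis p) ∎
      where open ≡-Reasoning

    weigh-shift : ∀ {C C′} {X Y : J m → Pair} → c * C′ ≡ C → (∀ p → Y (τ p) ≡ swapIf (wraps p) (X p)) →
                  weigh (ringR m) (magnitude C′) Y ≡ weigh (ringR m) (magnitude C) X
    weigh-shift {C} {C′} {X} {Y} eq h = weigh-τ (ringR m) {X = X} {Y}
      (λ p → trans (magnitude-shift C′ p) (cong (λ C → magnitude C p) eq)) h

    -- If the exceptional block is itself turned, its cofactor changes by the inverse factor through
    -- the other turned block, and the two effects cancel in the magnitudes. If it is a third block,
    -- its cofactor gains and loses the same factor. `ζ` turns by a unit only in a split block,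
    -- hence the hypothesis on the other blocks.
    weight-shift : ∀ {i j A A′ M} → i ≢ j → Shift i A M → Shift j A′ M → ∀ l →
                   (∀ x → x ≢ l → ∀ p → Split (A x p)) → weight A′ l ≡ weight A l
    weight-shift {i} {j} {A} {A′} {M} i≢j sh sh′ l s with l Fin.≟ i | l Fin.≟ j
    ... | yes refl | yes refl = ⊥-elim (i≢j refl)
    ... | yes refl | no l≢j = weigh-shift {X = A i} {A′ i}
          (trans (cofactor-shift {j} {A′} {M} sh′ i l≢j
              (split-unshift {j} {A′} {M} sh′ j (split-shift {i} {A} {M} sh j (s j (l≢j ∘ sym)))))
                 (sym (cofactor-shift-self {i} {A} {M} sh)))
          (λ p → trans (sym (proj₂ sh′ i l≢j (τ p))) (proj₁ sh p))
    ... | no l≢i | yes refl = sym (weigh-shift {X = A′ j} {A j}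
          (trans (cofactor-shift {i} {A} {M} sh j l≢i (s i (l≢i ∘ sym)))
              (sym (cofactor-shift-self {j} {A′} {M} sh′)))
          (λ p → trans (sym (proj₂ sh j l≢i (τ p))) (proj₁ sh′ p)))
    ... | no l≢i | no l≢j = weigh-cong (ringR m) {X = A′ l} {A l}
          (λ p → cong (λ C → magnitude C p) (regular-cancel (shiftUnit-regular m)
            (trans (cofactor-shift {j} {A′} {M} sh′ l l≢j
                (split-unshift {j} {A′} {M} sh′ j (split-shift {i} {A} {M} sh j (s j (l≢j ∘ sym)))))
                   (sym (cofactor-shift {i} {A} {M} sh l l≢i (s i (l≢i ∘ sym)))))))
          (λ p → trans (sym (proj₂ sh′ l l≢j p)) (proj₂ sh l l≢i p))

  -- M is halfway between A and A′: block i has been multiplied by t, block j not yet by t⁻¹.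
  good-shift : ∀ {i j A A′ M} → i ≢ j → Shift i A M → Shift j A′ M → Good A → Good A′
  good-shift {i} {j} {A} {A′} {M} i≢j sh sh′ good = lemma good
    where
    balance-≡ : ∀ l → balance (A′ l) ≡ balance (A l)
    balance-≡ l = trans (sym (balance-shift {j} {A′} {M} sh′ l)) (balance-shift {i} {A} {M} sh l)
    split-≡ : ∀ l → (∀ p → Split (A l p)) → ∀ p → Split (A′ l p)
    split-≡ l = split-unshift {j} {A′} {M} sh′ l ∘ split-shift {i} {A} {M} sh l
    lemma : Good A → Good A′
    lemma (inj₁ (x , y , a , d)) = inj₁ (x , y , a , λ l → trans (balance-≡ l) (d l))
    lemma (inj₂ (inj₁ (x , s , d , w))) = inj₂ (inj₁
        (x , (λ l l≢x → split-≡ l (s l l≢x)) , trans (balance-≡ x) d ,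
      subst Pos (sym (weight-shift {i} {j} {A} {A′} {M} i≢j sh sh′ x s)) w))
    lemma (inj₂ (inj₂ (s , w))) = inj₂ (inj₂ ((λ l → split-≡ l (s l)) ,
      subst Pos (sym (regular-cancel (shiftUnit-regular m)
        (trans (total-shift {j} {A′} {M} sh′ (split-≡ j (s j)))
            (sym (total-shift {i} {A} {M} sh (s i)))))) w))

-- Player I's strategy, pair by pair

anyJ? : ∀ {m} {P : J m → Set} → (∀ j → Dec (P j)) → Dec (∃ P)
anyJ? {zero} P? with P? []
... | yes p = yes ([] , p)
... | no ¬p = no λ { ([] , p) → ¬p p }
anyJ? {suc m} P? with anyJ? (P? ∘ (false ∷_)) | anyJ? (P? ∘ (true ∷_))
... | yes (j , p) | _ = yes (false ∷ j , p)
... | no _ | yes (j , p) = yes (true ∷ j , p)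
... | no ¬p | no ¬q = no λ where
  (false ∷ j , p) → ¬p (j , p)
  (true ∷ j , p) → ¬q (j , p)

allJ : ∀ m → List (J m)
allJ zero = [] ∷ []
allJ (suc m) = map (false ∷_) (allJ m) ++ map (true ∷_) (allJ m)

∈-allJ : ∀ {m} (j : J m) → j ∈ allJ m
∈-allJ [] = here refl
∈-allJ (false ∷ j) = ∈-++⁺ˡ (∈-map⁺ (false ∷_) (∈-allJ j))
∈-allJ {suc m} (true ∷ j) = ∈-++⁺ʳ (map (false ∷_) (allJ m)) (∈-map⁺ (true ∷_) (∈-allJ j))

enough? : ∀ {m} {F : J m → Set} → (∀ j → Dec (F j)) → Dec (Enough m F)
enough? {zero} F? = F? []
enough? {suc m} F? = anyJ? λ j → anyJ? λ l → ¬? (j ≟J l) ×-dec F? j ×-dec F? l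

enough-map : ∀ {m} {F G : J m → Set} → (∀ j → F j → G j) → Enough m F → Enough m G
enough-map {zero} h e = h [] e
enough-map {suc m} h (j , l , j≢l , Fj , Fl) = j , l , j≢l , h j Fj , h l Fl

enough-∃ : ∀ {m} {F : J m → Set} → Enough m F → ∃ F
enough-∃ {zero} e = [] , e
enough-∃ {suc m} (j , _ , _ , Fj , _) = j , Fj

not-enough : ∀ {m} {F : J m → Set} → ¬ Enough m F → ∀ {j l} → F j → F l → j ≡ l
not-enough {zero} _ {[]} {[]} _ _ = refl
not-enough {suc m} ¬e {j} {l} Fj Fl with j ≟J l
... | yes j≡l = j≡l
... | no j≢l = ⊥-elim (¬e (j , l , j≢l , Fj , Fl))

enough-all : ∀ {m} {F : J m → Set} → (∀ j → F j) → Enough m F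
enough-all {zero} h = h []
enough-all {suc m} h = false ∷ replicate m false , true ∷ replicate m false , (λ ()) , h _ , h _

module _ {A : Set} (L : NegacyclicRing A) where
  open Derived L

  nonPos-trans : ∀ {x y z} → NonPos L (x + - y) → NonPos L (y + - z) → NonPos L (x + - z)
  nonPos-trans {x} {y} {z} p q = subst (NonPos L) (begin
    (x + - y) + (y + - z) ≡⟨ +-assoc x (- y) _ ⟩
    x + (- y + (y + - z)) ≡⟨ cong (x +_) (sym (+-assoc (- y) y (- z))) ⟩
    x + (- y + y + - z)   ≡⟨ cong (λ w → x + (w + - z)) (-‿inverseˡ y) ⟩
    x + (0# + - z)        ≡⟨ cong (x +_) (+-identityˡ (- z)) ⟩
    x + - z ∎) (nonPos-+ L p q)
    where open ≡-Reasoning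

  nonPos-total : ∀ x y → NonPos L (x + - y) ⊎ NonPos L (y + - x)
  nonPos-total x y with tri (x + - y)
  ... | inj₁ p = inj₂ (inj₂ (subst Pos (sym (begin
      - (y + - x)     ≡⟨ sym (-‿+-comm y (- x)) ⟩
      - y + - - x     ≡⟨ cong (- y +_) (-‿involutive x) ⟩
      - y + x         ≡⟨ +-comm (- y) x ⟩
      x + - y ∎)) p))
    where open ≡-Reasoning
  ... | inj₂ q = inj₁ q

  maximum : ∀ {m} {F : J m → Set} → (∀ j → Dec (F j)) → (key : J m → A) → ∃ F →
            ∃ λ p → F p × ∀ q → F q → NonPos L (key q + - key p)
  maximum {zero} F? key ([] , F[]) = [] , F[] , λ { [] _ → inj₁ (-‿inverseʳ _) }
  maximum {suc m} {F} F? key ∃F with anyJ? (F? ∘ (false ∷_)) | anyJ? (F? ∘ (true ∷_))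
  ... | no ¬f | no ¬t = ⊥-elim (neither ∃F)
    where
    neither : ¬ ∃ F
    neither (false ∷ j , p) = ¬f (j , p)
    neither (true ∷ j , p) = ¬t (j , p)
  ... | yes f | no ¬t = let (p , Fp , h) = maximum (F? ∘ (false ∷_)) (key ∘ (false ∷_)) f in
    false ∷ p , Fp , λ { (false ∷ q) → h q ; (true ∷ q) Fq → ⊥-elim (¬t (q , Fq)) }
  ... | no ¬f | yes t = let (p , Fp , h) = maximum (F? ∘ (true ∷_)) (key ∘ (true ∷_)) t in
    true ∷ p , Fp , λ { (true ∷ q) → h q ; (false ∷ q) Fq → ⊥-elim (¬f (q , Fq)) }
  ... | yes f | yes t with maximum (F? ∘ (false ∷_)) (key ∘ (false ∷_)) f | maximum (F? ∘ (true ∷_))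
      (key ∘ (true ∷_)) t
  ...   | p , Fp , h | p′ , Fp′ , h′ with nonPos-total (key (false ∷ p)) (key (true ∷ p′))
  ...     | inj₁ le = true ∷ p′ , Fp′ , λ { (false ∷ q) Fq → nonPos-trans (h q Fq) le ; (true ∷ q) → h′ q }
  ...     | inj₂ le = false ∷ p , Fp , λ { (true ∷ q) Fq → nonPos-trans (h′ q Fq) le ; (false ∷ q) → h q }

least : ∀ {n} {P : Fin n → Set} → (∀ i → Dec (P i)) → ∃ P → ∃ λ i → P i × ∀ j → P j → toℕ i ≤ toℕ j
least {suc n} P? (i , Pi) with P? zero
... | yes P0 = zero , P0 , λ _ _ → z≤n
least {suc n} P? (zero , P0) | no ¬P0 = ⊥-elim (¬P0 P0)
least {suc n} {P} P? (suc i , Pi) | no ¬P0 = let (j , Pj , min) = least (P? ∘ suc) (i , Pi) in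
  suc j , Pj , λ where
    zero P0 → ⊥-elim (¬P0 P0)
    (suc k) Pk → s≤s (min k Pk)

-- The cyclic tournament

module Arcs (h : ℕ) where
  -- The difference y - x is one of 1, ..., h modulo 2h + 1; the second alternative is the case in
  -- which the step wraps around.
  arc : Fin (suc (h ℕ.* 2)) → Fin (suc (h ℕ.* 2)) → Set
  arc x y = (toℕ x < toℕ y × toℕ y ≤ toℕ x ℕ.+ h) ⊎ toℕ y ℕ.+ h < toℕ x

  arc? : ∀ x y → Dec (arc x y)
  arc? x y = (toℕ x ℕ.<? toℕ y ×-dec toℕ y ℕ.≤? toℕ x ℕ.+ h) ⊎-dec toℕ y ℕ.+ h ℕ.<? toℕ x

  arc-asym : ∀ {x y} → arc x y → ¬ arc y x
  arc-asym (inj₁ (x<y , _)) (inj₁ (y<x , _)) = ℕ.<-asym x<y y<x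
  arc-asym (inj₁ (_ , y≤x+h)) (inj₂ x+h<y) = ℕ.<⇒≱ x+h<y y≤x+h
  arc-asym (inj₂ y+h<x) (inj₁ (_ , x≤y+h)) = ℕ.<⇒≱ y+h<x x≤y+h
  arc-asym {x} {y} (inj₂ y+h<x) (inj₂ x+h<y) =
    ℕ.<-asym (ℕ.≤-<-trans (ℕ.m≤m+n (toℕ y) h) y+h<x) (ℕ.≤-<-trans (ℕ.m≤m+n (toℕ x) h) x+h<y)

  arc-irrefl : ∀ {x y} → arc x y → x ≢ y
  arc-irrefl a refl = arc-asym a a

  arc-high : ∀ {x} → h < toℕ x → arc x zero
  arc-high = inj₂

  arc-low : ∀ {x y} → toℕ x < toℕ y → toℕ y ≤ h → arc x y
  arc-low {x} x<y y≤h = inj₁ (x<y , ℕ.≤-trans y≤h (ℕ.m≤n+m h (toℕ x)))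

-- The game played on pairs

module PairGame (m h : ℕ) where
  open RM m
  open Arcs h
  open Outcome m (suc (h ℕ.* 2)) arc arc-irrefl arc-asym

  Block : Set
  Block = Fin (suc (h ℕ.* 2))

  Place : Set
  Place = Block × J m

  infix 4 _≟P_
  _≟P_ : DecidableEquality Place
  _≟P_ = ≡-dec Fin._≟_ _≟J_

  -- The points of a pair go to the players one by one, but a winning strategy never leaves more
  -- than one pair half taken; a state records the pairs that have been fully taken.
  State : Set
  State = Place → Maybe Pair

  Free : State → Place → Set
  Free St q = St q ≡ nothing

  free? : ∀ St q → Dec (Free St q)
  free? St q with St q
  ... | nothing = yes refl
  ... | just _ = no λ ()

  infixl 7 _[_≔_]
  _[_≔_] : State → Place → Pair → State
  (St [ p ≔ v ]) q with q ≟P p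
  ... | yes _ = just v
  ... | no _ = St q

  ≔-same : ∀ St p v → (St [ p ≔ v ]) p ≡ just v
  ≔-same St p v with p ≟P p
  ... | yes _ = refl
  ... | no p≢p = ⊥-elim (p≢p refl)

  ≔-other : ∀ St {p} v {q} → q ≢ p → (St [ p ≔ v ]) q ≡ St q
  ≔-other St {p} v {q} q≢p with q ≟P p
  ... | yes q≡p = ⊥-elim (q≢p q≡p)
  ... | no _ = refl

  ≔-free : ∀ St p v q → Free (St [ p ≔ v ]) q → Free St q × q ≢ p
  ≔-free St p v q eq with q ≟P p
  ... | yes _ with () ← eq
  ... | no q≢p = eq , q≢p

  ≔-just : ∀ St p v q {w} → (St [ p ≔ v ]) q ≡ just w → (q ≡ p × w ≡ v) ⊎ (q ≢ p × St q ≡ just w)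
  ≔-just St p v q eq with q ≟P p | eq
  ... | yes q≡p | refl = inj₁ (q≡p , refl)
  ... | no q≢p | eq′ = inj₂ (q≢p , eq′)

  -- A free pair counts as split, so it contributes nothing to balances and weights. The default
  -- sign is also the one that `critical-wins` will prescribe for the free pairs outside its block.
  settled : Maybe Pair → Pair
  settled nothing = split true
  settled (just v) = v

  config : State → Config
  config St l p = settled (St (l , p))

  -- In WinP Player I holds the point s of the pair p, in WinM Player II holds the point s of the
  -- pair q; in both cases Player II is to move.
  data WinI (St : State) : Set
  data WinP (St : State) (p : Place) (s : Bool) : Set
  data WinM (St : State) (q : Place) (s : Bool) : Set

  data WinI St where
    done : (∀ q → ¬ Free St q) → Good (config St) → WinI St
    play : ∀ p s → Free St p → WinP St p s → WinI St

  data WinP St p s where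
    respond : WinI (St [ p ≔ split s ]) →
              -- When Player II opens another pair `q`, Player I either closes `q` or takes both
              -- points of `p`, leaving `q` half taken.
              (∀ q s′ → q ≢ p → Free St q →
                 WinP (St [ q ≔ split (not s′) ]) p s ⊎ WinM (St [ p ≔ (true , true) ]) q s′) →
              WinP St p s

  data WinM St q s where
    respond : WinI (St [ q ≔ (false , false) ]) →
              -- Player I either closes `r` or takes the mate in `q`, so that now `r` is the pair
              -- half taken by Player II.
              (∀ r s′ → r ≢ q → Free St r →
                 WinM (St [ r ≔ split (not s′) ]) q s ⊎ WinM (St [ q ≔ split (not s) ]) r s′) →
              WinM St q s

  countIn : State → List Place → ℕ
  countIn St [] = zero
  countIn St (q ∷ qs) = if does (free? St q) then suc (countIn St qs) else countIn St qs

  places : List Place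
  places = cartesianProduct (allFin _) (allJ m)

  -- Closing a pair lowers it; the strategies recurse on an upper bound of it.
  count : State → ℕ
  count St = countIn St places

  countIn-≤ : ∀ St p v qs → countIn (St [ p ≔ v ]) qs ≤ countIn St qs
  countIn-≤ St p v [] = z≤n
  countIn-≤ St p v (q ∷ qs) with free? (St [ p ≔ v ]) q | free? St q
  ... | yes _ | yes _ = s≤s (countIn-≤ St p v qs)
  ... | yes f | no ¬f = ⊥-elim (¬f (proj₁ (≔-free St p v q f)))
  ... | no _ | yes _ = ℕ.m≤n⇒m≤1+n (countIn-≤ St p v qs)
  ... | no _ | no _ = countIn-≤ St p v qs

  countIn-< : ∀ St {p} v → Free St p → ∀ {qs} → p ∈ qs → countIn (St [ p ≔ v ]) qs < countIn St qs
  countIn-< St {p} v f {q ∷ qs} (here refl) with free? (St [ p ≔ v ]) p | free? St p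
  ... | yes f′ | _ = ⊥-elim (proj₂ (≔-free St p v p f′) refl)
  ... | no _ | yes _ = s≤s (countIn-≤ St p v qs)
  ... | no _ | no ¬f = ⊥-elim (¬f f)
  countIn-< St {p} v f {q ∷ qs} (there p∈qs) with free? (St [ p ≔ v ]) q | free? St q
  ... | yes _ | yes _ = s≤s (countIn-< St v f p∈qs)
  ... | yes f′ | no ¬f = ⊥-elim (¬f (proj₁ (≔-free St p v q f′)))
  ... | no _ | yes _ = ℕ.m≤n⇒m≤1+n (countIn-< St v f p∈qs)
  ... | no _ | no _ = countIn-< St v f p∈qs

  count-< : ∀ {St p v n} → Free St p → count St < suc n → count (St [ p ≔ v ]) < n
  count-< {St} {p} {v} f (s≤s c) =
    ℕ.<-≤-trans (countIn-< St v f (∈-cartesianProduct⁺ (∈-allFin (proj₁ p)) (∈-allJ (proj₂ p)))) c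

  weigh-≔ : ∀ {A} (L : NegacyclicRing A) (x : J m → A) {St} l {p v} → Free St (l , p) →
            weigh L x (config (St [ (l , p) ≔ v ]) l) ≡
            NegacyclicRing._+_ L (weigh L x (config St l)) (charge L (x p) v)
  weigh-≔ L x {St} l {p} {v} f = sumJ-update L p
    (trans (cong (charge L (x p) ∘ settled) (≔-same St (l , p) v))
      (sym (trans (cong (λ w → charge L (x p) (settled w) ⊞ charge L (x p) v) f) (+-identityˡ′ _))))
    (λ j j≢p → cong (charge L (x j) ∘ settled) (≔-other St v (j≢p ∘ cong proj₂)))
    where
    open NegacyclicRing L using () renaming (_+_ to _⊞_; +-identityˡ to +-identityˡ′)

  config-≔-other : ∀ {St} {q v l} → l ≢ proj₁ q → ∀ p → config (St [ q ≔ v ]) l p ≡ config St l p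
  config-≔-other {St} {q} {v} l≢ p = cong settled (≔-other St v (l≢ ∘ cong proj₁))

  balance-≔ : ∀ {St q v} → Free St q → ∀ l →
              balance (config (St [ q ≔ v ]) l) ≡ balance (config St l) ℤ.+ charge integers
                  (indicator (proj₁ q) l) v
  balance-≔ {St} {i , p} {v} f l = lemma (l Fin.≟ i)
    where
    charge-0 : ∀ v → charge integers ℤ.0ℤ v ≡ ℤ.0ℤ
    charge-0 (true , true) = refl
    charge-0 (true , false) = refl
    charge-0 (false , true) = refl
    charge-0 (false , false) = refl
    lemma : Dec (l ≡ i) → balance (config (St [ (i , p) ≔ v ]) l) ≡
            balance (config St l) ℤ.+ charge integers (indicator i l) v
    lemma (yes refl) = trans (weigh-≔ integers (λ _ → ℤ.1ℤ) {St} i f)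
      (cong (λ x → balance (config St i) ℤ.+ charge integers x v) (sym (indicator-≡ i)))
    lemma (no l≢i) = trans (balance-cong (config (St [ (i , p) ≔ v ]) l) (config St l)
        (config-≔-other {St} l≢i))
      (trans (sym (ℤ.+-identityʳ _)) (cong (λ z → balance (config St l) ℤ.+ z)
        (sym (trans (cong (λ x → charge integers x v) (indicator-≢ l≢i)) (charge-0 v)))))

  balance-split-≔ : ∀ {St q} s → Free St q → ∀ l →
      balance (config (St [ q ≔ split s ]) l) ≡ balance (config St l)
  balance-split-≔ {St} {q} s f l = trans (balance-≔ {St} {q} {split s} f l)
    (trans (cong (λ z → balance (config St l) ℤ.+ z) (charge-split integers _ {split s} refl))
        (ℤ.+-identityʳ _))

  weigh-split-≔ : ∀ (x : J m → R m) {St q} s → Free St q → ∀ l →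
                  weigh (ringR m) x (config (St [ q ≔ split s ]) l) ≡ weigh (ringR m) x (config St l)
  weigh-split-≔ x {St} {i , p} s f l = lemma (l Fin.≟ i)
    where
    lemma : Dec (l ≡ i) → weigh (ringR m) x (config (St [ (i , p) ≔ split s ]) l) ≡ weigh (ringR m) x
        (config St l)
    lemma (yes refl) = trans (weigh-≔ (ringR m) x {St} i {p} {split s} f)
      (trans (cong (weigh (ringR m) x (config St i) +_) (charge-split (ringR m) (x p) {split s} refl))
          (+-identityʳ _))
    lemma (no l≢i) = weigh-cong (ringR m) {X = config (St [ (i , p) ≔ split s ]) l} {config St l}
        (λ _ → refl) (config-≔-other {St} l≢i)

  findFree : ∀ St → (∃ λ q → Free St q) ⊎ (∀ q → ¬ Free St q)
  findFree St with Fin.any? (λ l → anyJ? λ p → free? St (l , p))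
  ... | yes (l , p , f) = inj₁ ((l , p) , f)
  ... | no ¬f = inj₂ λ q f → ¬f (proj₁ q , proj₂ q , f)

-- Winning the game on pairs

module Strategy (m h : ℕ) where
  open RM m
  open Arcs h
  open Outcome m (suc (h ℕ.* 2)) arc arc-irrefl arc-asym
  open PairGame m h

  Profile : State → (Block → ℤ) → Set
  Profile St d = ∀ l → balance (config St l) ≡ d l

  profile-≔ : ∀ {St d q} v → Free St q → Profile St d → Profile (St [ q ≔ v ]) λ l →
      d l ℤ.+ charge integers (indicator (proj₁ q) l) v
  profile-≔ {St} {d} {q} v f lv l = trans (balance-≔ {St} {q} {v} f l)
      (cong (ℤ._+ charge integers (indicator (proj₁ q) l) v) (lv l))

  profile-split : ∀ {St d q} s → Free St q → Profile St d → Profile (St [ q ≔ split s ]) d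
  profile-split {St} s f lv l = trans (balance-split-≔ {St} s f l) (lv l)

  profile-plus : ∀ {St q} → Free St q → Profile St (λ _ → ℤ.0ℤ) →
      Profile (St [ q ≔ (true , true) ]) (indicator (proj₁ q))
  profile-plus {St} f lv l = trans (profile-≔ {St} (true , true) f lv l) (ℤ.+-identityˡ _)

  -- Split pairs do not affect balances, so from here on Player I opens any free pair and answers
  -- every move in the pair just touched.
  dipole-wins : ∀ n {St i j} → count St < n → arc i j → Profile St (dipole i j) → WinI St
  dipole-follows : ∀ n {St i j p s} → count St < suc n → arc i j → Profile St (dipole i j) →
      Free St p → WinP St p s

  dipole-wins (suc n) {St} {i} {j} c a lv with findFree St
  ... | inj₂ none = done none (inj₁ (i , j , a , lv))
  ... | inj₁ (p , f) = play p true f (dipole-follows n c a lv f)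

  dipole-follows n {St} {p = p} {s} c a lv f = respond
    (dipole-wins n (count-< {St} f c) a (profile-split {St} s f lv))
    λ q s′ q≢p g → inj₁ (answer n s′ (count-< {St} g c) g
      (trans (≔-other St (split (not s′)) (q≢p ∘ sym)) f))
    where
    answer : ∀ n {q} s′ → count (St [ q ≔ split (not s′) ]) < n → Free St q →
        Free (St [ q ≔ split (not s′) ]) p →
             WinP (St [ q ≔ split (not s′) ]) p s
    answer (suc n) s′ c g f = dipole-follows n c a (profile-split {St} (not s′) g lv) f

  -- All other moves are answered within their own pairs, so in the end Player II has to close `q`;
  -- this creates the deficit in a block dominated by `i`.
  punished : ∀ n {St i q s} → count St < n → arc i (proj₁ q) → Profile St (indicator i) → Free St q →
      WinM St q s
  punished (suc n) {St} {i} {q} {s} c a lv f = respond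
    (dipole-wins n (count-< {St} f c) a (profile-≔ {St} (false , false) f lv))
    λ r s′ r≢q g → inj₁ (punished n (count-< {St} g c) a (profile-split {St} (not s′) g lv)
      (trans (≔-other St (split (not s′)) (r≢q ∘ sym)) f))

  -- Player I answers in the same pair, except that a move of Player II in a block dominated by
  -- the block of the open pair p is punished by completing p.
  follows : ∀ {p s} (K : State → Set) →
    (∀ {St} → K St → Free St p → WinI (St [ p ≔ split s ])) →
    (∀ {St} → K St → Profile St (λ _ → ℤ.0ℤ)) →
    (∀ {St q} s′ → K St → Free St p → Free St q → q ≢ p → ¬ arc (proj₁ p) (proj₁ q) →
        K (St [ q ≔ split s′ ])) →
    ∀ n {St} → count St < n → K St → Free St p → WinP St p s
  follows {p} {s} K fin lv touch (suc n) {St} c k f = respond (fin k f) answer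
    where
    p-free : ∀ {q} s′ → q ≢ p → Free (St [ q ≔ split s′ ]) p
    p-free s′ q≢p = trans (≔-other St (split s′) (q≢p ∘ sym)) f
    answer : ∀ q s′ → q ≢ p → Free St q →
             WinP (St [ q ≔ split (not s′) ]) p s ⊎ WinM (St [ p ≔ (true , true) ]) q s′
    answer q s′ q≢p g with arc? (proj₁ p) (proj₁ q)
    ... | yes a = inj₂ (punished n (count-< {St} f c) a (profile-plus {St} f (lv k))
        (trans (≔-other St _ q≢p) g))
    ... | no ¬a = inj₁ (follows K fin lv touch n (count-< {St} g c) (touch (not s′) k f g q≢p ¬a)
        (p-free (not s′) q≢p))

  -- All free pairs lie in blocks linearly ordered by domination, and a block other than `i` has no
  -- second free pair. So a deviation of Player II from the leading pair falls into a dominated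
  -- block or stays within `i`.
  record Tail (i : Block) (St : State) : Set where
    field
      above : ∀ {q} → Free St q → toℕ i ≤ toℕ (proj₁ q)
      low : ∀ {q} → Free St q → toℕ (proj₁ q) ≤ h
      single : ∀ {q r} → Free St q → Free St r → proj₁ q ≢ i → proj₁ q ≡ proj₁ r → q ≡ r

  open Tail

  tail-≔ : ∀ {i St q v} → Tail i St → Tail i (St [ q ≔ v ])
  tail-≔ {i} {St} {q} {v} T = record
    { above = λ {r} f → above T (proj₁ (≔-free St q v r f))
    ; low = λ {r} f → low T (proj₁ (≔-free St q v r f))
    ; single = λ {r} {r′} f f′ → single T (proj₁ (≔-free St q v r f)) (proj₁ (≔-free St q v r′ f′))
    }

  leading : ∀ (C : R m) {St} → (∃ λ q → Free St q) →
            ∃₂ λ l p → Free St (l , p) × (∀ {q} → Free St q → toℕ l ≤ toℕ (proj₁ q)) ×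
                       (∀ p′ → Free St (l , p′) → NonPos (ringR m) (magnitude C p′ + - magnitude C p))
  leading C {St} (q , f)
    with least (λ l → anyJ? λ p → free? St (l , p)) (proj₁ q , proj₂ q , f)
  ... | l , ∃p , min with maximum (ringR m) (λ p → free? St (l , p)) (magnitude C) ∃p
  ...   | p , g , max = l , p , g , (λ {q} f → min (proj₁ q) (proj₂ q , f)) , max

  -- T is the final position Player I aims at; later blocks have at most one free pair (Tail), so
  -- that Player II cannot spoil the cofactor of block i.
  module Endgame (i : Block) (T : Block → J m → Bool) (T-good : Pos (total λ l p → split (T l p))) where
    target : Config
    target l p = split (T l p)

    C : R m
    C = cofactor i target

    μ : J m → R m
    μ = magnitude C

    -- A tie would mean C t^q = ± C t^p, and `C` can be cancelled.
    μ-strict : ∀ {p q} → q ≢ p → NonPos (ringR m) (μ q + - μ p) → Pos (μ p + - μ q)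
    μ-strict {p} {q} q≢p (inj₂ pos) = subst Pos (begin
      - (μ q + - μ p)   ≡⟨ sym (-‿+-comm (μ q) (- μ p)) ⟩
      - μ q + - - μ p   ≡⟨ cong (- μ q +_) (-‿involutive (μ p)) ⟩
      - μ q + μ p       ≡⟨ +-comm (- μ q) (μ p) ⟩
      μ p + - μ q ∎) pos
      where open ≡-Reasoning
    μ-strict {p} {q} q≢p (inj₁ zer) = ⊥-elim (q≢p (basis-injective q p (lemma (abs-≡ _ _ μ≡))))
      where
      μ≡ : μ q ≡ μ p
      μ≡ = +-cancelʳ (- μ p) _ _ (trans zer (sym (-‿inverseʳ (μ p))))
      lemma : C * basis q ≡ C * basis p ⊎ C * basis q ≡ - (C * basis p) →
          basis q ≡ basis p ⊎ basis q ≡ - basis p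
      lemma (inj₁ eq) = inj₁ (regular-cancel (cofactor-regular i target) eq)
      lemma (inj₂ eq) = inj₂ (regular-cancel (cofactor-regular i target)
          (trans eq (-‿distribʳ-* C (basis p))))

    Agree : State → Set
    Agree St = ∀ q {v} → St q ≡ just v → v ≡ split (T (proj₁ q) (proj₂ q))

    AgreeOutside : State → Set
    AgreeOutside St = ∀ q {v} → proj₁ q ≢ i → St q ≡ just v → v ≡ split (T (proj₁ q) (proj₂ q))

    agree-≔ : ∀ {St q} → Agree St → Agree (St [ q ≔ split (T (proj₁ q) (proj₂ q)) ])
    agree-≔ {St} {q} ag r eq with ≔-just St q _ r eq
    ... | inj₁ (refl , refl) = refl
    ... | inj₂ (_ , eq′) = ag r eq′

    agreeOutside-≔ : ∀ {St q v} → AgreeOutside St →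
        (proj₁ q ≢ i → v ≡ split (T (proj₁ q) (proj₂ q))) → AgreeOutside (St [ q ≔ v ])
    agreeOutside-≔ {St} {q} {v} ag h r r≢i eq with ≔-just St q v r eq
    ... | inj₁ (refl , refl) = h r≢i
    ... | inj₂ (_ , eq′) = ag r r≢i eq′

    agree-profile : ∀ {St} → Agree St → Profile St (λ _ → ℤ.0ℤ)
    agree-profile {St} ag l = balance-split (config St l) λ p → lemma p
      where
      lemma : ∀ p → Split (config St l p)
      lemma p with St (l , p) | ag (l , p)
      ... | nothing | _ = refl
      ... | just v | k with k refl
      ...   | refl = refl

    agree-config : ∀ {St} → Agree St → (∀ q → ¬ Free St q) → ∀ l p → target l p ≡ config St l p
    agree-config {St} ag none l p with St (l , p) | ag (l , p) | none (l , p)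
    ... | nothing | _ | n = ⊥-elim (n refl)
    ... | just v | k | _ = sym (k refl)

    outside-config : ∀ {St} → AgreeOutside St → (∀ q → ¬ Free St q) → ∀ l → l ≢ i → ∀ p →
        config St l p ≡ target l p
    outside-config {St} ag none l l≢i p with St (l , p) | ag (l , p) | none (l , p)
    ... | nothing | _ | n = ⊥-elim (n refl)
    ... | just v | k | _ = k l≢i refl

    -- Block i has been unbalanced in favour of Player I; the other blocks still go according to T.
    record Ahead (St : State) : Set where
      field
        even : Profile St (λ _ → ℤ.0ℤ)
        ahead : Pos (weigh (ringR m) μ (config St i))
        outside : AgreeOutside St
        tail : Tail i St

    open Ahead

    ahead-split : ∀ {St q s} → Ahead St → Free St q → (proj₁ q ≢ i → s ≡ T (proj₁ q) (proj₂ q)) →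
        Ahead (St [ q ≔ split s ])
    ahead-split {St} {q} {s} A f eq = record
      { even = profile-split {St} s f (even A)
      ; ahead = subst Pos (sym (weigh-split-≔ μ {St} s f i)) (ahead A)
      ; outside = agreeOutside-≔ (outside A) (cong split ∘ eq)
      ; tail = tail-≔ (tail A) }

    -- Outside `i` Player I opens the point prescribed by `T`, and the only touches not punished by
    -- domination are in the leading block. If that block is not `i`, it has no second free pair; if
    -- it is `i`, the signs chosen there do not enter its own cofactor.
    ahead-wins : ∀ n {St} → count St < n → Ahead St → WinI St
    ahead-wins (suc n) {St} c A with findFree St
    ... | inj₂ none = done none (inj₂ (inj₁ (i ,
            (λ l l≢i p → subst Split (sym (outside-config (outside A) none l l≢i p)) refl) ,
            even A i ,
            subst Pos (weigh-cong (ringR m) {X = config St i}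
              (λ p → cong (λ D → magnitude D p) (cofactor-cong {target} {config St} i λ l l≢i p →
                  cong proj₁ (sym (outside-config (outside A) none l l≢i p))))
              (λ _ → refl)) (ahead A))))
    ... | inj₁ free with leading C {St} free
    ...   | l , p , f , min , _ = play (l , p) (T l p) f (follows K
              (λ (A , c , _) f → ahead-wins n (count-< f c) (ahead-split A f λ _ → refl))
              (even ∘ proj₁) touch (suc n) c (A , c , min) f)
      where
      K : State → Set
      K St = Ahead St × count St < suc n × (∀ {q} → Free St q → toℕ l ≤ toℕ (proj₁ q))
      touch : ∀ {St q} s′ → K St → Free St (l , p) → Free St q → q ≢ (l , p) → ¬ arc l (proj₁ q) →
          K (St [ q ≔ split s′ ])
      touch {St} {q} s′ (A , c , min) f g q≢ ¬a =
        ahead-split A g (λ q≢i → ⊥-elim (q≢ (single (tail A) g f q≢i same))) ,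
        ℕ.<-≤-trans (count-< g c) (ℕ.n≤1+n n) ,
        (λ {r} f′ → min (proj₁ (≔-free St q (split s′) r f′)))
        where
        same : proj₁ q ≡ l
        same with proj₁ q Fin.≟ l
        ... | yes eq = eq
        ... | no ≢ = ⊥-elim (¬a (arc-low (ℕ.≤∧≢⇒< (min g) (≢ ∘ sym ∘ Fin.toℕ-injective)) (low (tail A) g)))

    -- Player I is one pair up in block `i`, Player II has half of the lighter pair `q` there.
    -- Closing `q` leaves a positive weighted count. A touch in a later block lets Player I
    -- neutralise `q` and use the excess for a dipole instead.
    overtaken : ∀ n {St q s} → count St < n → Free St q → proj₁ q ≡ i → Profile St (indicator i) →
                Pos (weigh (ringR m) μ (config St i) + - μ (proj₂ q)) → AgreeOutside St → Tail i St →
                    WinM St q s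
    overtaken (suc n) {St} {q} {s} c f refl lv pos out tl = respond
      (ahead-wins n (count-< {St} f c) record
        { even = λ l → trans (profile-≔ {St} (false , false) f lv l) (ℤ.+-inverseʳ (indicator i l))
        ; ahead = subst Pos (sym (weigh-≔ (ringR m) μ {St} i f)) pos
        ; outside = agreeOutside-≔ out λ q≢i → ⊥-elim (q≢i refl)
        ; tail = tail-≔ tl })
      answer
      where
      answer : ∀ r s′ → r ≢ q → Free St r → WinM (St [ r ≔ split (not s′) ]) q s ⊎ WinM
          (St [ q ≔ split (not s) ]) r s′
      answer r s′ r≢q g with proj₁ r Fin.≟ i
      ... | yes r≡i = inj₁ (overtaken n (count-< {St} g c)
          (trans (≔-other St (split (not s′)) (r≢q ∘ sym)) f) refl
              (profile-split {St} (not s′) g lv)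
              (subst (λ w → Pos (w + - μ (proj₂ q))) (sym (weigh-split-≔ μ {St} (not s′) g i)) pos)
              (agreeOutside-≔ out λ r≢i → ⊥-elim (r≢i r≡i)) (tail-≔ tl))
      ... | no r≢i = inj₂ (punished n (count-< {St} f c)
              (arc-low (ℕ.≤∧≢⇒< (above tl g) (r≢i ∘ sym ∘ Fin.toℕ-injective)) (low tl g))
              (profile-split {St} (not s) f lv) (trans (≔-other St (split (not s)) r≢q) g))

    -- Player I takes the pairs in the order of the blocks, and within block i by decreasing μ;
    -- any deviation of Player II from answering in the same pair is punished.
    endgame-wins : ∀ n {St} → count St < n → Agree St → Tail i St → WinI St
    endgame-wins (suc n) {St} c ag tl with findFree St
    ... | inj₂ none = done none (good-cong {target} {config St} (agree-config ag none)
        (inj₂ (inj₂ ((λ _ _ → refl) , T-good))))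
    ... | inj₁ free with leading C {St} free
    ...   | l , p , f , min , max = play (l , p) (T l p) f (respond
              (endgame-wins n (count-< {St} f c) (agree-≔ {St} {l , p} ag) (tail-≔ tl)) answer)
      where
      zeroProfile : Profile St (λ _ → ℤ.0ℤ)
      zeroProfile = agree-profile ag
      raised : State
      raised = St [ (l , p) ≔ (true , true) ]
      answer : ∀ q s′ → q ≢ (l , p) → Free St q → WinP (St [ q ≔ split (not s′) ]) (l , p)
          (T l p) ⊎ WinM raised q s′
      answer q s′ q≢ g with proj₁ q Fin.≟ l
      ... | no q≢l = inj₂ (punished n (count-< {St} f c)
              (arc-low (ℕ.≤∧≢⇒< (min g) (q≢l ∘ sym ∘ Fin.toℕ-injective)) (low tl g))
              (profile-plus {St} f zeroProfile) (trans (≔-other St _ q≢) g))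
      ... | yes refl with l Fin.≟ i
      ...   | no l≢i = ⊥-elim (q≢ (single tl g f l≢i refl))
      -- The maximality of `p` makes μ p - μ q strictly positive for whichever pair `q` Player II
      -- has touched.
      ...   | yes refl = inj₂ (overtaken n (count-< {St} f c) (trans (≔-other St _ q≢) g) refl
                (profile-plus {St} f zeroProfile)
                (subst (λ w → Pos (w + - μ (proj₂ q))) (sym raised-weight)
                    (μ-strict (q≢ ∘ cong (l ,_)) (max (proj₂ q) g)))
                (agreeOutside-≔ (λ r _ → ag r) λ ≢i → ⊥-elim (≢i refl)) (tail-≔ tl))
        where
        raised-weight : weigh (ringR m) μ (config raised l) ≡ μ p
        raised-weight = trans (weigh-≔ (ringR m) μ {St} l f) (trans (cong (_+ μ p)
          (weigh-split (ringR m) μ {config St l} λ p′ → agree-split p′)) (+-identityˡ (μ p)))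
          where
          agree-split : ∀ p′ → Split (config St l p′)
          agree-split p′ with St (l , p′) | ag (l , p′)
          ... | nothing | _ = refl
          ... | just v | k with k refl
          ...   | refl = refl

  Clean : State → Set
  Clean St = ∀ q {v} → St q ≡ just v → Split v

  clean-≔ : ∀ {St q} s → Clean St → Clean (St [ q ≔ split s ])
  clean-≔ {St} {q} s cl r eq with ≔-just St q (split s) r eq
  ... | inj₁ (refl , refl) = refl
  ... | inj₂ (_ , eq′) = cl r eq′

  clean-config : ∀ {St} → Clean St → ∀ l p → Split (config St l p)
  clean-config {St} cl l p with St (l , p) | cl (l , p)
  ... | nothing | _ = refl
  ... | just v | k = k refl

  clean-profile : ∀ {St} → Clean St → Profile St (λ _ → ℤ.0ℤ)
  clean-profile {St} cl l = balance-split (config St l) (clean-config cl l)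

  EnoughIn : State → Block → Set
  EnoughIn St i = Enough m λ p → Free St (i , p)

  enoughIn-free : ∀ {St} i → EnoughIn St i → ∃ λ p → Free St (i , p)
  enoughIn-free {St} i = enough-∃ {m} {λ p → Free St (i , p)}

  -- The free pairs of block `i` suffice for `face` to choose their signs so that the product with
  -- the default signs elsewhere is positive. This fixes the final position before the endgame
  -- starts.
  critical-wins : ∀ n {St} i → count St < n → Clean St → Tail i St → EnoughIn St i → WinI St
  critical-wins n {St} i c cl tl en with face m (cofactor-regular i (config St)) (signs (config St i)) _ en
  ... | v , same , pos = Endgame.endgame-wins i T T-good n c agree tl
    where
    T : Block → J m → Bool
    T l with l Fin.≟ i
    ... | yes _ = v
    ... | no _ = signs (config St l)
    T-i : ∀ p → T i p ≡ v p
    T-i p with i Fin.≟ i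
    ... | yes _ = refl
    ... | no i≢i = ⊥-elim (i≢i refl)
    T-other : ∀ l → l ≢ i → ∀ p → signs (config St l) p ≡ T l p
    T-other l l≢i p with l Fin.≟ i
    ... | yes l≡i = ⊥-elim (l≢i l≡i)
    ... | no _ = refl
    target : Config
    target l p = split (T l p)
    T-good : Pos (total target)
    T-good = subst Pos (sym (trans (total-factor i target) (cong₂ _*_
      (sym (cofactor-cong {config St} {target} i T-other)) (ζ-cong {u = T i} {v} T-i)))) pos
    unfree : ∀ {q w} → St q ≡ just w → ¬ Free St q
    unfree eq f with () ← trans (sym eq) f
    sign≡ : ∀ l p {w} → St (l , p) ≡ just w → proj₁ w ≡ T l p
    sign≡ l p eq with l Fin.≟ i
    ... | yes refl = trans (cong (proj₁ ∘ settled) (sym eq)) (sym (same p (unfree eq)))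
    ... | no _ = cong (proj₁ ∘ settled) (sym eq)
    agree : ∀ q {w} → St q ≡ just w → w ≡ split (T (proj₁ q) (proj₂ q))
    agree (l , p) {w} eq = trans (cong (proj₁ w ,_) (cl (l , p) eq)) (cong split (sign≡ l p eq))

  -- As long as some later block has enough free pairs, the current block is merely exhausted.
  low-wins : ∀ n {St} → count St < n → Clean St → (∀ {q} → Free St q → toℕ (proj₁ q) ≤ h) →
      ∃ (EnoughIn St) → WinI St
  low-wins (suc n) {St} c cl lo (i , en)
    -- The order within the block is immaterial here; `0#` makes all magnitudes equal.
    with leading 0# {St} ((i , proj₁ (enoughIn-free {St} i en)) , proj₂ (enoughIn-free {St} i en))
  ... | l , p , f , min , _ with Fin.any? (λ j → (toℕ l ℕ.<? toℕ j) ×-dec enough? (λ p → free? St (j , p)))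
  ...   | yes (j , l<j , en′) = play (l , p) true f (follows K
            (λ {St} (cl , c , lo , _ , en′) f → low-wins n (count-< f c) (clean-≔ true cl)
              (λ {q} g → lo (proj₁ (≔-free St (l , p) (split true) q g)))
                  (j , enough-≔ {St} {l , p} true (<⇒≢ l<j) en′))
            (clean-profile ∘ proj₁) touch (suc n) c (cl , c , lo , min , en′) f)
    where
    <⇒≢ : ∀ {x y : Block} → toℕ x < toℕ y → y ≢ x
    <⇒≢ x<y refl = ℕ.<-irrefl refl x<y
    enough-≔ : ∀ {St q} s → j ≢ proj₁ q → EnoughIn St j → EnoughIn (St [ q ≔ split s ]) j
    enough-≔ {St} {q} s j≢ = enough-map {m} {λ p → Free St (j , p)}
        {λ p → Free (St [ q ≔ split s ]) (j , p)} λ p′ g → trans (≔-other St (split s) (j≢ ∘ cong proj₁)) g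
    K : State → Set
    K St = Clean St × count St < suc n × (∀ {q} → Free St q → toℕ (proj₁ q) ≤ h) ×
           (∀ {q} → Free St q → toℕ l ≤ toℕ (proj₁ q)) × EnoughIn St j
    touch : ∀ {St q} s′ → K St → Free St (l , p) → Free St q → q ≢ (l , p) → ¬ arc l (proj₁ q) →
        K (St [ q ≔ split s′ ])
    touch {St} {q} s′ (cl , c , lo , min , en) f g q≢ ¬a =
      clean-≔ s′ cl , ℕ.<-≤-trans (count-< g c) (ℕ.n≤1+n n) ,
      (λ {r} g′ → lo (proj₁ (≔-free St q _ r g′))) , (λ {r} g′ → min (proj₁ (≔-free St q _ r g′))) ,
      -- A touch in the reserve block `j` would be a move in a block dominated by `l`, hence
      -- punished; so `j` keeps its free pairs.
      enough-≔ {St} {q} s′ (λ { refl → ¬a (arc-low l<j (lo g)) }) en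
  ...   | no ¬en = critical-wins (suc n) l c cl
            (record { above = min ; low = lo ; single = single′ })
            (subst (EnoughIn St) i≡l en)
    where
    later : ∀ {j} → j ≢ l → toℕ l ≤ toℕ j → ¬ EnoughIn St j
    later j≢l l≤j en′ = ¬en (_ , ℕ.≤∧≢⇒< l≤j (j≢l ∘ sym ∘ Fin.toℕ-injective) , en′)
    i≡l : i ≡ l
    i≡l with i Fin.≟ l
    ... | yes eq = eq
    ... | no i≢l = ⊥-elim (later i≢l (min (proj₂ (enoughIn-free {St} i en))) en)
    single′ : ∀ {q r} → Free St q → Free St r → proj₁ q ≢ l → proj₁ q ≡ proj₁ r → q ≡ r
    single′ {q} f g q≢l refl = cong (proj₁ q ,_) (not-enough {m} {λ p → Free St (proj₁ q , p)}
        (later q≢l (min f)) f g)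

  -- Block 0 stays untouched while the blocks dominating it are exhausted.
  wins : ∀ n {St} → count St < n → Clean St → (∀ p → Free St (zero , p)) → WinI St
  wins (suc n) {St} c cl z with Fin.any? (λ l → (h ℕ.<? toℕ l) ×-dec anyJ? (λ p → free? St (l , p)))
  ... | no none = low-wins (suc n) c cl (λ {q} f → ℕ.≮⇒≥ λ h<q → none (proj₁ q , h<q , proj₂ q , f))
      (zero , enough-all {m} {λ p → Free St (zero , p)} z)
  ... | yes (l , h<l , p , f) = play (l , p) true f (follows K
          (λ {St} (cl , c , z) f → wins n (count-< f c) (clean-≔ true cl) (zero-≔ {St} {l , p} true l≢0 z))
          (clean-profile ∘ proj₁) touch (suc n) c (cl , c , z) f)
    where
    l≢0 : zero ≢ l
    l≢0 0≡l = ℕ.n≮0 (subst (λ x → h < toℕ x) (sym 0≡l) h<l)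
    zero-≔ : ∀ {St q} s → zero ≢ proj₁ q → (∀ p → Free St (zero , p)) → ∀ p →
        Free (St [ q ≔ split s ]) (zero , p)
    zero-≔ {St} s 0≢ z p = trans (≔-other St (split s) (0≢ ∘ cong proj₁)) (z p)
    K : State → Set
    K St = Clean St × count St < suc n × (∀ p → Free St (zero , p))
    touch : ∀ {St q} s′ → K St → Free St (l , p) → Free St q → q ≢ (l , p) → ¬ arc l (proj₁ q) →
        K (St [ q ≔ split s′ ])
    touch {St} {q} s′ (cl , c , z) f g q≢ ¬a = clean-≔ s′ cl , ℕ.<-≤-trans (count-< g c) (ℕ.n≤1+n n) ,
      -- Block `l` lies above `h` and so dominates block 0: touches answered in the same pair never
      -- fall there.
      zero-≔ {St} {q} s′ (λ { refl → ¬a (arc-high h<l) }) z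

  wins-empty : WinI (λ _ → nothing)
  wins-empty = wins _ (ℕ.n<1+n _) (λ _ ()) (λ _ → refl)

-- Lines and histories

subsets : ∀ n → List (Subset n)
subsets zero = [] ∷ []
subsets (suc n) = map (true ∷_) (subsets n) ++ map (false ∷_) (subsets n)

∈-subsets : ∀ {n} (S : Subset n) → S ∈ subsets n
∈-subsets [] = here refl
∈-subsets (true ∷ S) = ∈-++⁺ˡ (∈-map⁺ (true ∷_) (∈-subsets S))
∈-subsets {suc n} (false ∷ S) = ∈-++⁺ʳ (map (true ∷_) (subsets n)) (∈-map⁺ (false ∷_) (∈-subsets S))

∈-toSubset⁺ : ∀ {n} {x : Fin n} {xs} → x ∈ xs → x Subset.∈ toSubset xs
∈-toSubset⁺ {x = x} {y ∷ xs} (here refl) = Subset.x∈p∪q⁺ (inj₁ (Subset.x∈⁅x⁆ x))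
∈-toSubset⁺ {x = x} {y ∷ xs} (there x∈xs) = Subset.x∈p∪q⁺ {p = ⁅ y ⁆} (inj₂ (∈-toSubset⁺ x∈xs))

∈-toSubset⁻ : ∀ {n} {x : Fin n} xs → x Subset.∈ toSubset xs → x ∈ xs
∈-toSubset⁻ [] x∈ = ⊥-elim (Subset.∉⊥ x∈)
∈-toSubset⁻ (y ∷ xs) x∈ with Subset.x∈p∪q⁻ ⁅ y ⁆ (toSubset xs) x∈
... | inj₁ x∈y = here (Subset.x∈⁅y⁆⇒x≡y y x∈y)
... | inj₂ x∈xs = there (∈-toSubset⁻ xs x∈xs)

completes? : ∀ {n} (L : AvoidanceGame n) S → Dec (Completes L S)
completes? L S = map′ find (λ (ℓ , ℓ∈L , ℓ⊆S) → lose ℓ∈L ℓ⊆S) (any? (Subset._⊆? S) L)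

module _ {A : Set} where
  snoc-even : ∀ (h : List A) x → odd (length h) ≡ false →
      evens (h ++ [ x ]) ≡ evens h ++ [ x ] × odds (h ++ [ x ]) ≡ odds h
  snoc-odd : ∀ (h : List A) x → odd (length h) ≡ true →
      evens (h ++ [ x ]) ≡ evens h × odds (h ++ [ x ]) ≡ odds h ++ [ x ]

  snoc-even [] x _ = refl , refl
  snoc-even (y ∷ h) x e = let (p , q) = snoc-odd h x (Bool.not-injective e) in cong (y ∷_) q , p

  snoc-odd (y ∷ h) x e = let (p , q) = snoc-even h x (Bool.not-injective e) in cong (y ∷_) q , p

  ∈-evens⊎odds : ∀ {x : A} h → x ∈ h → x ∈ evens h ⊎ x ∈ odds h
  ∈-evens⊎odds (y ∷ h) (here eq) = inj₁ (here eq)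
  ∈-evens⊎odds (y ∷ h) (there x∈h) with ∈-evens⊎odds h x∈h
  ... | inj₁ e = inj₂ e
  ... | inj₂ o = inj₁ (there o)

  evens-⊆ : ∀ {x : A} h → x ∈ evens h → x ∈ h
  odds-⊆ : ∀ {x : A} h → x ∈ odds h → x ∈ h
  evens-⊆ (y ∷ h) (here eq) = here eq
  evens-⊆ (y ∷ h) (there x∈) = there (odds-⊆ h x∈)
  odds-⊆ (y ∷ h) x∈ = there (evens-⊆ h x∈)

  length-snoc : ∀ (h : List A) x → odd (length (h ++ [ x ])) ≡ not (odd (length h))
  length-snoc [] x = refl
  length-snoc (y ∷ h) x = cong not (length-snoc h x)

-- From the game on pairs to the avoidance game

module Transfer (m h n : ℕ)
  (to : Fin n → PairGame.Place m h × Bool) (from : PairGame.Place m h × Bool → Fin n)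
  (to-from : ∀ y → to (from y) ≡ y) (from-to : ∀ x → from (to x) ≡ x) where
  open PairGame m h
  open Arcs h
  open Outcome m (suc (h ℕ.* 2)) arc arc-irrefl arc-asym

  Point : Set
  Point = Place × Bool

  _≟Pt_ : DecidableEquality Point
  _≟Pt_ = ≡-dec _≟P_ Bool._≟_

  pick : Bool → Pair → Bool
  pick true = proj₁
  pick false = proj₂

  bit : Config → Point → Bool
  bit A ((l , p) , s) = pick s (A l p)

  view : Subset n → Config
  view ℓ l p = lookup ℓ (from ((l , p) , true)) , lookup ℓ (from ((l , p) , false))

  bit-view : ∀ ℓ y → bit (view ℓ) y ≡ lookup ℓ (from y)
  bit-view ℓ (_ , true) = refl
  bit-view ℓ (_ , false) = refl

  bit-complement : ∀ A y → bit (complement A) y ≡ not (bit A y)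
  bit-complement A (_ , true) = refl
  bit-complement A (_ , false) = refl

  bit-ext : ∀ {A A′ : Config} → (∀ y → bit A y ≡ bit A′ y) → ∀ l p → A l p ≡ A′ l p
  bit-ext h l p = cong₂ _,_ (h ((l , p) , true)) (h ((l , p) , false))

  Line : Subset n → Set
  Line ℓ = Good (complement (view ℓ))

  line? : ∀ ℓ → Dec (Line ℓ)
  line? ℓ = good? arc? (complement (view ℓ))

  lines : AvoidanceGame n
  lines = filter line? (subsets n)

  line⁺ : ∀ {ℓ} → Line ℓ → ℓ ∈ lines
  line⁺ {ℓ} = ∈-filter⁺ line? (∈-subsets ℓ)

  line⁻ : ∀ {ℓ} → ℓ ∈ lines → Line ℓ
  line⁻ = proj₂ ∘ ∈-filter⁻ line? {xs = subsets n}

  Owner : Set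
  Owner = Point → Maybe Bool

  -- true stands for Player I
  record Rep (hist : List (Fin n)) (O : Owner) : Set where
    field
      evens⁻ : ∀ {x} → x ∈ evens hist → O (to x) ≡ just true
      evens⁺ : ∀ {x} → O (to x) ≡ just true → x ∈ evens hist
      odds⁻ : ∀ {x} → x ∈ odds hist → O (to x) ≡ just false
      odds⁺ : ∀ {x} → O (to x) ≡ just false → x ∈ odds hist

  open Rep

  rep-∉ : ∀ {hist O x} → Rep hist O → x ∉ hist → O (to x) ≡ nothing
  rep-∉ {hist} {O} {x} r x∉ with O (to x) in eq
  ... | nothing = refl
  ... | just true = ⊥-elim (x∉ (evens-⊆ hist (evens⁺ r eq)))
  ... | just false = ⊥-elim (x∉ (odds-⊆ hist (odds⁺ r eq)))

  rep-free : ∀ {hist O y} → Rep hist O → O y ≡ nothing → from y ∉ hist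
  rep-free {hist} {O} {y} r free x∈ with ∈-evens⊎odds hist x∈
  ... | inj₁ e with () ← trans (sym free) (trans (cong O (sym (to-from y))) (evens⁻ r e))
  ... | inj₂ o with () ← trans (sym free) (trans (cong O (sym (to-from y))) (odds⁻ r o))

  record Extends (O O′ : Owner) (y : Point) (s : Bool) : Set where
    field
      was-free : O y ≡ nothing
      here-≡ : O′ y ≡ just s
      else-≡ : ∀ z → z ≢ y → O′ z ≡ O z

  open Extends

  not-here : ∀ {O : Owner} {y z : Point} {s : Bool} → O y ≡ nothing → O z ≡ just s → z ≢ y
  not-here free taken refl with () ← trans (sym free) taken

  point-∈ : ∀ {y x} {xs : List (Fin n)} → to x ≡ y → x ∈ xs ++ [ from y ]
  point-∈ {y} {x} {xs} refl = ∈-++⁺ʳ xs (here (sym (from-to x)))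

  step-I : ∀ {hist O O′ y} → odd (length hist) ≡ false → Rep hist O → Extends O O′ y true →
      Rep (hist ++ [ from y ]) O′
  step-I {hist} {O} {O′} {y} e r ext = record
    { evens⁻ = λ {x} → evens⁻′ x ∘ subst (x ∈_) (proj₁ snoc)
    ; evens⁺ = λ {x} eq → subst (x ∈_) (sym (proj₁ snoc)) (evens⁺′ x eq)
    ; odds⁻ = λ {x} x∈ → let taken = odds⁻ r (subst (x ∈_) (proj₂ snoc) x∈) in
                trans (else-≡ ext (to x) (not-here (was-free ext) taken)) taken
    ; odds⁺ = λ {x} eq → subst (x ∈_) (sym (proj₂ snoc)) (odds⁺′ x eq)
    }
    where
    snoc = snoc-even hist (from y) e
    evens⁻′ : ∀ x → x ∈ evens hist ++ [ from y ] → O′ (to x) ≡ just true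
    evens⁻′ x x∈ with ∈-++⁻ (evens hist) x∈
    ... | inj₁ x∈e = let taken = evens⁻ r x∈e in trans (else-≡ ext (to x) (not-here (was-free ext) taken)) taken
    ... | inj₂ (here refl) = trans (cong O′ (to-from y)) (here-≡ ext)
    evens⁺′ : ∀ x → O′ (to x) ≡ just true → x ∈ evens hist ++ [ from y ]
    evens⁺′ x eq with to x ≟Pt y
    ... | yes tx≡y = point-∈ {xs = evens hist} tx≡y
    ... | no tx≢y = ∈-++⁺ˡ (evens⁺ r (trans (sym (else-≡ ext (to x) tx≢y)) eq))
    odds⁺′ : ∀ x → O′ (to x) ≡ just false → x ∈ odds hist
    odds⁺′ x eq with to x ≟Pt y
    ... | yes refl with () ← trans (sym eq) (here-≡ ext)
    ... | no tx≢y = odds⁺ r (trans (sym (else-≡ ext (to x) tx≢y)) eq)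

  step-II : ∀ {hist O O′ y} → odd (length hist) ≡ true → Rep hist O → Extends O O′ y false →
      Rep (hist ++ [ from y ]) O′
  step-II {hist} {O} {O′} {y} e r ext = record
    { odds⁻ = λ {x} → odds⁻′ x ∘ subst (x ∈_) (proj₂ snoc)
    ; odds⁺ = λ {x} eq → subst (x ∈_) (sym (proj₂ snoc)) (odds⁺′ x eq)
    ; evens⁻ = λ {x} x∈ → let taken = evens⁻ r (subst (x ∈_) (proj₁ snoc) x∈) in
                trans (else-≡ ext (to x) (not-here (was-free ext) taken)) taken
    ; evens⁺ = λ {x} eq → subst (x ∈_) (sym (proj₁ snoc)) (evens⁺′ x eq)
    }
    where
    snoc = snoc-odd hist (from y) e
    odds⁻′ : ∀ x → x ∈ odds hist ++ [ from y ] → O′ (to x) ≡ just false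
    odds⁻′ x x∈ with ∈-++⁻ (odds hist) x∈
    ... | inj₁ x∈o = let taken = odds⁻ r x∈o in trans (else-≡ ext (to x) (not-here (was-free ext) taken)) taken
    ... | inj₂ (here refl) = trans (cong O′ (to-from y)) (here-≡ ext)
    odds⁺′ : ∀ x → O′ (to x) ≡ just false → x ∈ odds hist ++ [ from y ]
    odds⁺′ x eq with to x ≟Pt y
    ... | yes tx≡y = point-∈ {xs = odds hist} tx≡y
    ... | no tx≢y = ∈-++⁺ˡ (odds⁺ r (trans (sym (else-≡ ext (to x) tx≢y)) eq))
    evens⁺′ : ∀ x → O′ (to x) ≡ just true → x ∈ evens hist
    evens⁺′ x eq with to x ≟Pt y
    ... | yes refl with () ← trans (sym eq) (here-≡ ext)
    ... | no tx≢y = evens⁺ r (trans (sym (else-≡ ext (to x) tx≢y)) eq)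

  pick-split : ∀ s → pick s (split s) ≡ true
  pick-split true = refl
  pick-split false = refl

  pick-split-not : ∀ s → pick (not s) (split s) ≡ false
  pick-split-not true = refl
  pick-split-not false = refl

  own : State → Owner
  own St (q , s) = Maybe.map (pick s) (St q)

  half : Bool → Bool → Bool → Maybe Bool
  half s c u = if does (u Bool.≟ s) then just c else nothing

  -- The point s of the pair p belongs to c, its mate is free.
  ownHalf : State → Place → Bool → Bool → Owner
  ownHalf St p s c (q , u) with q ≟P p
  ... | yes _ = half s c u
  ... | no _ = own St (q , u)

  half-≡ : ∀ s c → half s c s ≡ just c
  half-≡ true c = refl
  half-≡ false c = refl

  half-not : ∀ s c → half s c (not s) ≡ nothing
  half-not true c = refl
  half-not false c = refl

  same-or-not : ∀ s u → u ≡ s ⊎ u ≡ not s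
  same-or-not true true = inj₁ refl
  same-or-not true false = inj₂ refl
  same-or-not false true = inj₂ refl
  same-or-not false false = inj₁ refl

  ownHalf-pair : ∀ St p s c u → ownHalf St p s c (p , u) ≡ half s c u
  ownHalf-pair St p s c u with p ≟P p
  ... | yes _ = refl
  ... | no p≢p = ⊥-elim (p≢p refl)

  ownHalf-other : ∀ St {p} s c {q} u → q ≢ p → ownHalf St p s c (q , u) ≡ own St (q , u)
  ownHalf-other St {p} s c {q} u q≢p with q ≟P p
  ... | yes q≡p = ⊥-elim (q≢p q≡p)
  ... | no _ = refl

  own-free : ∀ {St q} u → Free St q → own St (q , u) ≡ nothing
  own-free u f = cong (Maybe.map (pick u)) f

  own-nothing : ∀ {St q} u → own St (q , u) ≡ nothing → Free St q
  own-nothing {St} {q} u eq with St q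
  ... | nothing = refl

  own-≔ : ∀ St q v u → own (St [ q ≔ v ]) (q , u) ≡ just (pick u v)
  own-≔ St q v u = cong (Maybe.map (pick u)) (≔-same St q v)

  own-≔-other : ∀ St {q} v {r} u → r ≢ q → own (St [ q ≔ v ]) (r , u) ≡ own St (r , u)
  own-≔-other St v u r≢q = cong (Maybe.map (pick u)) (≔-other St v r≢q)

  opening : ∀ {St p} s → Free St p → Extends (own St) (ownHalf St p s true) (p , s) true
  opening {St} {p} s f = record
    { was-free = own-free {St} s f
    ; here-≡ = trans (ownHalf-pair St p s true s) (half-≡ s true)
    ; else-≡ = λ (q , u) z≢ → lemma q u z≢ }
    where
    lemma : ∀ q u → (q , u) ≢ (p , s) → ownHalf St p s true (q , u) ≡ own St (q , u)
    lemma q u z≢ with q ≟P p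
    ... | no _ = refl
    ... | yes refl with same-or-not s u
    ...   | inj₁ refl = ⊥-elim (z≢ refl)
    ...   | inj₂ refl = trans (half-not s true) (sym (own-free {St} (not s) f))

  completion : ∀ {St p} s c v t → pick s v ≡ c → pick (not s) v ≡ t →
               Extends (ownHalf St p s c) (own (St [ p ≔ v ])) (p , not s) t
  completion {St} {p} s c v t refl refl = record
    { was-free = trans (ownHalf-pair St p s c (not s)) (half-not s c)
    ; here-≡ = own-≔ St p v (not s)
    ; else-≡ = λ (q , u) z≢ → lemma q u z≢ }
    where
    lemma : ∀ q u → (q , u) ≢ (p , not s) → own (St [ p ≔ v ]) (q , u) ≡ ownHalf St p s c (q , u)
    lemma q u z≢ with same-or-not s u | q ≟P p
    ... | _ | no _ = refl
    ... | inj₁ refl | yes refl = sym (half-≡ s c)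
    ... | inj₂ refl | yes refl = ⊥-elim (z≢ refl)

  extend : Owner → Point → Bool → Owner
  extend O y c z with z ≟Pt y
  ... | yes _ = just c
  ... | no _ = O z

  extend-≡ : ∀ O y c → extend O y c y ≡ just c
  extend-≡ O y c with y ≟Pt y
  ... | yes _ = refl
  ... | no y≢y = ⊥-elim (y≢y refl)

  extend-≢ : ∀ O {y} c {z} → z ≢ y → extend O y c z ≡ O z
  extend-≢ O {y} c {z} z≢y with z ≟Pt y
  ... | yes z≡y = ⊥-elim (z≢y z≡y)
  ... | no _ = refl

  extends : ∀ {O y} c → O y ≡ nothing → Extends O (extend O y c) y c
  extends {O} {y} c f = record { was-free = f ; here-≡ = extend-≡ O y c ; else-≡ = λ z → extend-≢ O c }

  -- `extend` records the move of Player II at `y`, which may leave two pairs half taken; O″ is the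
  -- position after the answer at `z`.
  two-steps : ∀ {O O″ y z} → O y ≡ nothing → O z ≡ nothing → z ≢ y → O″ y ≡ just false → O″ z ≡ just true →
              (∀ w → w ≢ y → w ≢ z → O″ w ≡ O w) → Extends (extend O y false) O″ z true
  two-steps {O} {O″} {y} {z} fy fz z≢y oy oz other = record
    { was-free = trans (extend-≢ O false z≢y) fz ; here-≡ = oz ; else-≡ = lemma }
    where
    lemma : ∀ w → w ≢ z → O″ w ≡ extend O y false w
    lemma w w≢z with w ≟Pt y
    ... | yes refl = oy
    ... | no w≢y = other w w≢y w≢z

  not-≢ : ∀ {q : Place} {s} → (q , not s) ≢ (q , s)
  not-≢ {s = true} ()
  not-≢ {s = false} ()

  answer-there : ∀ {St p q} s c s′ → q ≢ p → Free St q →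
    Extends (extend (ownHalf St p s c) (q , s′) false) (ownHalf (St [ q ≔ split (not s′) ]) p s c)
        (q , not s′) true
  answer-there {St} {p} {q} s c s′ q≢p f = two-steps
    (trans (ownHalf-other St s c s′ q≢p) (own-free {St} s′ f))
    (trans (ownHalf-other St s c (not s′) q≢p) (own-free {St} (not s′) f))
    not-≢
    (trans (ownHalf-other _ s c s′ q≢p) (trans (own-≔ St q _ s′)
      (cong just (trans (cong (λ u → pick u (split (not s′))) (sym (Bool.not-involutive s′)))
          (pick-split-not (not s′))))))
    (trans (ownHalf-other _ s c (not s′) q≢p) (trans (own-≔ St q _ (not s′))
        (cong just (pick-split (not s′)))))
    λ (r , u) r≢ r≢′ → other r u r≢ r≢′
    where
    other : ∀ r u → (r , u) ≢ (q , s′) → (r , u) ≢ (q , not s′) →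
            ownHalf (St [ q ≔ split (not s′) ]) p s c (r , u) ≡ ownHalf St p s c (r , u)
    other r u r≢ r≢′ with r ≟P p
    ... | yes _ = refl
    ... | no _ = own-≔-other St _ u r≢q
      where
      r≢q : r ≢ q
      r≢q refl with same-or-not s′ u
      ... | inj₁ refl = r≢ refl
      ... | inj₂ refl = r≢′ refl

  answer-here : ∀ {St p q} s c v s′ → q ≢ p → Free St q → pick s v ≡ c → pick (not s) v ≡ true →
    Extends (extend (ownHalf St p s c) (q , s′) false) (ownHalf (St [ p ≔ v ]) q s′ false) (p , not s) true
  answer-here {St} {p} {q} s c v s′ q≢p f refl eq = two-steps
    (trans (ownHalf-other St s c s′ q≢p) (own-free {St} s′ f))
    (trans (ownHalf-pair St p s c (not s)) (half-not s c))
    (q≢p ∘ sym ∘ cong proj₁)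
    (trans (ownHalf-pair _ q s′ false s′) (half-≡ s′ false))
    (trans (ownHalf-other _ s′ false (not s) (q≢p ∘ sym)) (trans (own-≔ St p v (not s)) (cong just eq)))
    λ (r , u) r≢ r≢′ → other r u r≢ r≢′
    where
    other : ∀ r u → (r , u) ≢ (q , s′) → (r , u) ≢ (p , not s) →
            ownHalf (St [ p ≔ v ]) q s′ false (r , u) ≡ ownHalf St p s c (r , u)
    other r u r≢ r≢′ with r ≟P q | r ≟P p
    ... | yes refl | yes refl = ⊥-elim (q≢p refl)
    ... | no _ | no r≢p = own-≔-other St v u r≢p
    ... | yes refl | no _ with same-or-not s′ u
    ...   | inj₁ refl = ⊥-elim (r≢ refl)
    ...   | inj₂ refl = trans (half-not s′ false) (sym (own-free {St} (not s′) f))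
    other r u r≢ r≢′ | no _ | yes refl with same-or-not s u
    ...   | inj₁ refl = trans (own-≔ St r v u) (sym (half-≡ s c))
    ...   | inj₂ refl = ⊥-elim (r≢′ refl)

  -- A certificate that Player I has not lost: by `good-antichain`, points lying within a good set
  -- contain no line.
  Future : Owner → Set
  Future O = ∃ λ A → Good A × ∀ y → O y ≡ just true → bit A y ≡ true

  future-step : ∀ {O O′ y s} → Extends O O′ y s → Future O′ → Future O
  future-step {O} ext (A , good , mine) = A , good , λ z eq →
    mine z (trans (else-≡ ext z (not-here {O} (was-free ext) eq)) eq)

  pick-settled : ∀ {St : State} q u {c} → own St (q , u) ≡ just c → bit (config St) (q , u) ≡ c
  pick-settled {St} (l , p) u eq with St (l , p)
  pick-settled (l , p) u refl | just v = refl

  -- The certificate is read off the branch in which Player II always closes the half-taken pair; it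
  -- ends in a good set containing all that Player I holds now.
  futureI : ∀ {St} → WinI St → Future (own St)
  futureP : ∀ {St p s} → WinP St p s → Future (ownHalf St p s true)
  futureI {St} (done none good) = config St , good , λ (q , u) → pick-settled {St} q u
  futureI (play p s f w) = future-step (opening s f) (futureP w)
  futureP {St} {p} {s} (respond w _) =
    future-step (completion {St} {p} s true (split s) false (pick-split s) (pick-split-not s)) (futureI w)

  futureM : ∀ {St q s} → WinM St q s → Future (ownHalf St q s false)
  futureM {St} {q} {s} (respond w _) =
    future-step (completion {St} {q} s false (false , false) false (lemma s) (lemma (not s))) (futureI w)
    where
    lemma : ∀ s → pick s (false , false) ≡ false
    lemma true = refl
    lemma false = refl

  lookup-∈ : ∀ {x : Fin n} {S : Subset n} → x Subset.∈ S → lookup S x ≡ true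
  lookup-∈ = []=⇒lookup

  no-loss : ∀ {hist O} → Rep hist O → Future O → ¬ Completes lines (toSubset (evens hist))
  no-loss {hist} {O} r (A , good , mine) (ℓ , ℓ∈ , ℓ⊆) =
      good-antichain (odd-blocks h) {A} {view ℓ} below good (line⁻ ℓ∈)
    where
    odd-blocks : ∀ h → odd (suc (h ℕ.* 2)) ≡ true
    odd-blocks zero = refl
    odd-blocks (suc h) = trans (Bool.not-involutive _) (odd-blocks h)
    held : ∀ y → lookup ℓ (from y) ≡ true → bit A y ≡ true
    held y eq = mine y (trans (cong O (sym (to-from y)))
      (evens⁻ r (∈-toSubset⁻ (evens hist) (ℓ⊆ (lookup⇒[]= (from y) ℓ eq)))))
    below : ∀ l p → _
    below l p = held ((l , p) , true) , held ((l , p) , false)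

  -- On the full board the set of Player II is the complement of a good set, hence itself a line.
  loss : ∀ {hist St} → Rep hist (own St) → (∀ q → ¬ Free St q) → Good (config St) →
      Completes lines (toSubset (odds hist))
  loss {hist} {St} r none good = S , line⁺ {S} (good-cong
      (bit-ext {config St} {complement (view S)} bits) good) , λ x∈ → x∈
    where
    S = toSubset (odds hist)
    bits : ∀ y → bit (config St) y ≡ bit (complement (view S)) y
    bits (q , u) with own St (q , u) in eq
    ... | nothing = ⊥-elim (none q (own-nothing {St} u eq))
    ... | just c = trans (pick-settled {St} q u eq) (sym (trans (bit-complement (view S) (q , u))
                     (trans (cong not (trans (bit-view S (q , u)) (lemma c eq))) (Bool.not-involutive c))))
      where
      lemma : ∀ c → own St (q , u) ≡ just c → lookup S (from (q , u)) ≡ not c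
      lemma false eq = lookup-∈ (∈-toSubset⁺ (odds⁺ r (trans (cong (own St) (to-from (q , u))) eq)))
      lemma true eq with lookup S (from (q , u)) in eq′
      ... | false = refl
      ... | true with () ← trans (sym eq) (trans (cong (own St) (sym (to-from (q , u))))
                   (odds⁻ r (∈-toSubset⁻ (odds hist) (lookup⇒[]= (from (q , u)) S eq′))))

  Reply : List (Fin n) → Set
  Reply hist = Completes lines (toSubset (odds hist)) ⊎
      (¬ Completes lines (toSubset (odds hist)) × IWinsAtI lines hist)

  -- If Player II has already completed a line, the game is over in favour of Player I; otherwise
  -- the given strategy goes on.
  reply : ∀ {hist} → IWinsAtI lines hist → Reply hist
  reply {hist} w with completes? lines (toSubset (odds hist))
  ... | yes c = inj₁ c
  ... | no ¬c = inj₂ (¬c , w)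

  moveI : ∀ {hist O O′ y} → odd (length hist) ≡ false → Rep hist O → Extends O O′ y true → Future O′ →
          (Rep (hist ++ [ from y ]) O′ → IWinsAtII lines (hist ++ [ from y ])) → IWinsAtI lines hist
  moveI {hist} {y = y} e r ext fut k = move (from y) (rep-free r (was-free ext)) (no-loss r′ fut) (k r′)
    where r′ = step-I {hist} e r ext

  even-snoc : ∀ {hist : List (Fin n)} {x} → odd (length hist) ≡ true → odd (length (hist ++ [ x ])) ≡ false
  even-snoc {hist} {x} o = trans (length-snoc hist x) (cong not o)

  odd-snoc : ∀ {hist : List (Fin n)} {x} → odd (length hist) ≡ false → odd (length (hist ++ [ x ])) ≡ true
  odd-snoc {hist} {x} o = trans (length-snoc hist x) (cong not o)

  playI : ∀ {St hist} → WinI St → odd (length hist) ≡ false → Rep hist (own St) → Reply hist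
  playP : ∀ {St p s hist} → WinP St p s → odd (length hist) ≡ true →
          Rep hist (ownHalf St p s true) → IWinsAtII lines hist
  playM : ∀ {St q s hist} → WinM St q s → odd (length hist) ≡ true →
          Rep hist (ownHalf St q s false) → IWinsAtII lines hist

  playI (done none good) e r = inj₁ (loss r none good)
  playI {hist = hist} (play p s f w) e r = reply (moveI e r (opening s f) (futureP w) λ r′ →
      playP w (odd-snoc {hist} e) r′)

  -- `WinP` and `WinM` differ only in the owner `c` of the point taken in the open pair. Its mate is
  -- free, so the board is never full when Player II is to move.
  playHalf : ∀ {St p s c hist} v → pick s v ≡ c → pick (not s) v ≡ false → odd (length hist) ≡ true →
    Rep hist (ownHalf St p s c) →
    (∀ {hist′} → odd (length hist′) ≡ false → Rep hist′ (own (St [ p ≔ v ])) → Reply hist′) →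
    (∀ {hist′} q s′ → q ≢ p → Free St q → odd (length hist′) ≡ false →
       Rep hist′ (extend (ownHalf St p s c) (q , s′) false) → IWinsAtI lines hist′) →
    IWinsAtII lines hist
  playHalf {St} {p} {s} {c} {hist} v eq eq′ o r complete touch = respond
    (from (p , not s) , rep-free r (trans (ownHalf-pair St p s c (not s)) (half-not s c)))
    λ x x∉ → subst (λ x → Reply (hist ++ [ x ])) (from-to x) (answer (to x) (rep-∉ r x∉))
    where
    answer : ∀ y → ownHalf St p s c y ≡ nothing → Reply (hist ++ [ from y ])
    answer (q , u) free with q ≟P p in q≟p
    ... | no q≢p = reply (touch q u q≢p (own-nothing {St} u free) (even-snoc {hist} o)
            (step-II {hist} o r (extends false (trans (ownHalf-other St s c u q≢p) free))))
    ... | yes refl with same-or-not s u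
    ...   | inj₁ refl with () ← trans (sym free) (half-≡ s c)
    ...   | inj₂ refl = complete (even-snoc {hist} o)
        (step-II {hist} o r (completion {St} {p} s c v false eq eq′))

  playP {St} {p} {s} {hist} (respond w answer) o r =
      playHalf {St} {p} {s} {true} {hist} (split s) (pick-split s) (pick-split-not s) o r
    (λ e r′ → playI w e r′) touch
    where
    touch : ∀ {hist′} q s′ → q ≢ p → Free St q → odd (length hist′) ≡ false →
            Rep hist′ (extend (ownHalf St p s true) (q , s′) false) → IWinsAtI lines hist′
    touch {hist′} q s′ q≢p f e r′ with answer q s′ q≢p f
    ... | inj₁ w′ = moveI e r′ (answer-there {St} s true s′ q≢p f) (futureP w′) λ r″ →
        playP w′ (odd-snoc {hist′} e) r″
    ... | inj₂ w′ = moveI e r′ (answer-here {St} s true (true , true) s′ q≢p f (lemma s)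
        (lemma (not s))) (futureM w′)
                      λ r″ → playM w′ (odd-snoc {hist′} e) r″
      where
      lemma : ∀ s → pick s (true , true) ≡ true
      lemma true = refl
      lemma false = refl

  playM {St} {p} {s} {hist} (respond w answer) o r =
      playHalf {St} {p} {s} {false} {hist} (false , false) (lemma s) (lemma (not s)) o r
    (λ e r′ → playI w e r′) touch
    where
    lemma : ∀ s → pick s (false , false) ≡ false
    lemma true = refl
    lemma false = refl
    touch : ∀ {hist′} q s′ → q ≢ p → Free St q → odd (length hist′) ≡ false →
            Rep hist′ (extend (ownHalf St p s false) (q , s′) false) → IWinsAtI lines hist′
    touch {hist′} q s′ q≢p f e r′ with answer q s′ q≢p f
    ... | inj₁ w′ = moveI e r′ (answer-there {St} s false s′ q≢p f) (futureM w′) λ r″ →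
        playM w′ (odd-snoc {hist′} e) r″
    ... | inj₂ w′ = moveI e r′ (answer-here {St} s false (split (not s)) s′ q≢p f
                        (trans (cong (λ u → pick u (split (not s))) (sym (Bool.not-involutive s)))
                            (pick-split-not (not s)))
                        (pick-split (not s))) (futureM w′)
                      λ r″ → playM w′ (odd-snoc {hist′} e) r″

  playerI-wins : IsPlayerIWin lines
  playerI-wins = start wins-empty
    where
    open Strategy m h using (wins-empty)
    empty : Rep [] (own λ _ → nothing)
    empty = record { evens⁻ = λ () ; evens⁺ = λ () ; odds⁻ = λ () ; odds⁺ = λ () }
    start : WinI (λ _ → nothing) → IWinsAtI lines []
    start (done none _) = ⊥-elim (none (zero , replicate m false) refl)
    start (play p s f w) = moveI refl empty (opening s f) (futureP w) λ r → playP w refl r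

-- Transitivity

module Rotation (h : ℕ) where
  open Arcs h
  private
    N = h ℕ.* 2

    N≡h+h : N ≡ h ℕ.+ h
    N≡h+h = trans (ℕ.*-comm h 2) (cong (h ℕ.+_) (ℕ.+-identityʳ h))

  back : Fin (suc N) → Fin (suc N)
  back zero = fromℕ N
  back (suc i) = inject₁ i

  next : Fin (suc N) → Fin (suc N)
  next i with topView i
  ... | ‵fromℕ = zero
  ... | ‵inj₁ {i = j} _ = suc j

  next-back : ∀ i → next (back i) ≡ i
  next-back zero rewrite view-fromℕ N = refl
  next-back (suc i) rewrite view-inject₁ i = refl

  back-next : ∀ i → back (next i) ≡ i
  back-next i with topView i
  ... | ‵fromℕ = refl
  ... | ‵inj₁ _ = refl

  arc-inject⁺ : ∀ {i j} → arc (suc i) (suc j) → arc (inject₁ i) (inject₁ j)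
  arc-inject⁺ {i} {j} a rewrite Fin.toℕ-inject₁ i | Fin.toℕ-inject₁ j with a
  ... | inj₁ (s≤s p , s≤s q) = inj₁ (p , q)
  ... | inj₂ (s≤s p) = inj₂ p

  arc-inject⁻ : ∀ {i j} → arc (inject₁ i) (inject₁ j) → arc (suc i) (suc j)
  arc-inject⁻ {i} {j} a rewrite Fin.toℕ-inject₁ i | Fin.toℕ-inject₁ j with a
  ... | inj₁ (p , q) = inj₁ (s≤s p , s≤s q)
  ... | inj₂ p = inj₂ (s≤s p)

  -- When block 0 becomes the last block, the two alternatives of `arc` change roles, and 2h = h + h
  -- converts their bounds into each other.
  arc-from⁺ : ∀ {j} → arc zero (suc j) → arc (fromℕ N) (inject₁ j)
  arc-from⁺ {j} (inj₁ (_ , q)) rewrite Fin.toℕ-inject₁ j | Fin.toℕ-fromℕ N =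
    inj₂ (subst (toℕ j ℕ.+ h <_) (sym N≡h+h) (ℕ.+-monoˡ-< h q))

  arc-from⁻ : ∀ {j} → arc (fromℕ N) (inject₁ j) → arc zero (suc j)
  arc-from⁻ {j} a rewrite Fin.toℕ-inject₁ j | Fin.toℕ-fromℕ N with a
  ... | inj₁ (p , _) = ⊥-elim (ℕ.<-asym p (Fin.toℕ<n j))
  ... | inj₂ p = inj₁ (s≤s z≤n , ℕ.+-cancelʳ-< h (toℕ j) h (subst (toℕ j ℕ.+ h <_) N≡h+h p))

  arc-into⁺ : ∀ {i} → arc (suc i) zero → arc (inject₁ i) (fromℕ N)
  arc-into⁺ {i} (inj₂ (s≤s q)) rewrite Fin.toℕ-inject₁ i | Fin.toℕ-fromℕ N =
    inj₁ (Fin.toℕ<n i , subst (_≤ toℕ i ℕ.+ h) (sym N≡h+h) (ℕ.+-monoˡ-≤ h q))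

  arc-into⁻ : ∀ {i} → arc (inject₁ i) (fromℕ N) → arc (suc i) zero
  arc-into⁻ {i} a rewrite Fin.toℕ-inject₁ i | Fin.toℕ-fromℕ N with a
  ... | inj₁ (_ , q) = inj₂ (s≤s (ℕ.+-cancelʳ-≤ h h (toℕ i) (subst (_≤ toℕ i ℕ.+ h) N≡h+h q)))
  ... | inj₂ p = ⊥-elim (ℕ.<-asym (ℕ.≤-<-trans (ℕ.m≤m+n N h) p) (Fin.toℕ<n i))

  arc-back : ∀ {x y} → arc x y → arc (back x) (back y)
  arc-back {zero} {zero} a = ⊥-elim (arc-irrefl a refl)
  arc-back {zero} {suc j} a = arc-from⁺ {j} a
  arc-back {suc i} {zero} a = arc-into⁺ {i} a
  arc-back {suc i} {suc j} a = arc-inject⁺ {i} {j} a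

  arc-next : ∀ {x y} → arc x y → arc (next x) (next y)
  arc-next {x} {y} a = lemma (next x) (next y) (subst₂ arc (sym (back-next x)) (sym (back-next y)) a)
    where
    lemma : ∀ x y → arc (back x) (back y) → arc x y
    lemma zero zero a = ⊥-elim (arc-irrefl a refl)
    lemma zero (suc j) a = arc-from⁻ {j} a
    lemma (suc i) zero a = arc-into⁻ {i} a
    lemma (suc i) (suc j) a = arc-inject⁻ {i} {j} a

-- Two steps from an even exponent are one step on the remaining binary digits, so induction applies
-- to the even exponents; one further step links them to the odd ones. Without digits a step flips
-- the sign.
orbit : ∀ {m} (_~_ : J m × Bool → J m × Bool → Set) → IsEquivalence _~_ →
        (∀ p s → (p , s) ~ (τ p , s xor wraps p)) → ∀ y → y ~ (replicate m false , true)
orbit {zero} _~_ eqv step ([] , true) = IsEquivalence.refl eqv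
orbit {zero} _~_ eqv step ([] , false) = step [] false
orbit {suc m} _~_ eqv step = λ where
    (false ∷ p , s) → even p s
    (true ∷ p , s) → E.trans (E.sym (even~odd p s)) (even p s)
  where
  module E = IsEquivalence eqv
  even~odd : ∀ p s → (false ∷ p , s) ~ (true ∷ p , s)
  even~odd p s = subst (λ u → (false ∷ p , s) ~ (true ∷ p , u)) (Bool.xor-identityʳ s) (step (false ∷ p) s)
  even : ∀ p s → (false ∷ p , s) ~ (replicate (suc m) false , true)
  even p s = orbit {m} (λ (p , s) (q , u) → (false ∷ p , s) ~ (false ∷ q , u))
    (record { refl = E.refl ; sym = E.sym ; trans = E.trans })
    (λ p s → E.trans (even~odd p s) (step (true ∷ p) s)) (p , s)

module Transitivity (m h n : ℕ) (0<h : 0 < h)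
  (to : Fin n → PairGame.Place m h × Bool) (from : PairGame.Place m h × Bool → Fin n)
  (to-from : ∀ y → to (from y) ≡ y) (from-to : ∀ x → from (to x) ≡ x) where
  open PairGame m h
  open Arcs h
  open Outcome m (suc (h ℕ.* 2)) arc arc-irrefl arc-asym
  open Symmetry m (suc (h ℕ.* 2)) arc arc-irrefl arc-asym
  open Rotation h
  open Transfer m h n to from to-from from-to

  -- `A′` is the image of `A`, described bit by bit because configurations are functions and are
  -- compared only pointwise.
  Preserves : (Point → Point) → Set
  Preserves φ = ∀ {A A′ : Config} → (∀ y → bit A′ (φ y) ≡ bit A y) → Good A → Good A′

  record Symm : Set where
    field
      φ φ⁻¹ : Point → Point
      φ-φ⁻¹ : ∀ y → φ (φ⁻¹ y) ≡ y
      φ⁻¹-φ : ∀ y → φ⁻¹ (φ y) ≡ y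
      preserves : Preserves φ
      preserves⁻¹ : Preserves φ⁻¹

  open Symm

  _~_ : Point → Point → Set
  y ~ z = ∃ λ S → φ S y ≡ z

  ~-isEquivalence : IsEquivalence _~_
  ~-isEquivalence = record
    { refl = record
        { φ = id ; φ⁻¹ = id ; φ-φ⁻¹ = λ _ → refl ; φ⁻¹-φ = λ _ → refl
        ; preserves = λ {A} {A′} eq → good-cong (bit-ext {A} {A′} λ y → sym (eq y))
        ; preserves⁻¹ = λ {A} {A′} eq → good-cong (bit-ext {A} {A′} λ y → sym (eq y)) } , refl
    ; sym = λ {y} (S , eq) → record
        { φ = φ⁻¹ S ; φ⁻¹ = φ S ; φ-φ⁻¹ = φ⁻¹-φ S ; φ⁻¹-φ = φ-φ⁻¹ S
        ; preserves = preserves⁻¹ S ; preserves⁻¹ = preserves S } ,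
            trans (cong (φ⁻¹ S) (sym eq)) (φ⁻¹-φ S y)
    ; trans = λ (S , eq) (S′ , eq′) → compose S S′ , trans (cong (φ S′) eq) eq′
    }
    where
    along : Config → (Point → Point) → Config
    along A ψ l p = bit A (ψ ((l , p) , true)) , bit A (ψ ((l , p) , false))
    bit-along : ∀ A ψ y → bit (along A ψ) y ≡ bit A (ψ y)
    bit-along A ψ (_ , true) = refl
    bit-along A ψ (_ , false) = refl
    preserves-∘ : ∀ {ψ ψ⁻¹ χ} → (∀ y → ψ⁻¹ (ψ y) ≡ y) → (∀ y → ψ (ψ⁻¹ y) ≡ y) → Preserves ψ →
        Preserves χ → Preserves (χ ∘ ψ)
    preserves-∘ {ψ} {ψ⁻¹} {χ} inv inv′ pψ pχ {A} {A′} eq good = pχ {along A ψ⁻¹}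
      (λ y → trans (cong (bit A′ ∘ χ) (sym (inv′ y))) (trans (eq (ψ⁻¹ y)) (sym (bit-along A ψ⁻¹ y))))
      (pψ {A} (λ y → trans (bit-along A ψ⁻¹ (ψ y)) (cong (bit A) (inv y))) good)
    compose : Symm → Symm → Symm
    compose S S′ = record
      { φ = φ S′ ∘ φ S ; φ⁻¹ = φ⁻¹ S ∘ φ⁻¹ S′
      ; φ-φ⁻¹ = λ y → trans (cong (φ S′) (φ-φ⁻¹ S _)) (φ-φ⁻¹ S′ y)
      ; φ⁻¹-φ = λ y → trans (cong (φ⁻¹ S) (φ⁻¹-φ S′ _)) (φ⁻¹-φ S y)
      ; preserves = preserves-∘ {φ S} {φ⁻¹ S} {φ S′} (φ⁻¹-φ S) (φ-φ⁻¹ S) (preserves S) (preserves S′)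
      ; preserves⁻¹ = preserves-∘ {φ⁻¹ S′} {φ S′} {φ⁻¹ S} (φ-φ⁻¹ S′) (φ⁻¹-φ S′) (preserves⁻¹ S′)
          (preserves⁻¹ S) }

  rotate~ : ∀ l p s → ((l , p) , s) ~ ((back l , p) , s)
  rotate~ l p s = record
    { φ = λ ((l , p) , s) → (back l , p) , s
    ; φ⁻¹ = λ ((l , p) , s) → (next l , p) , s
    ; φ-φ⁻¹ = λ ((l , p) , s) → cong (λ l → (l , p) , s) (back-next l)
    ; φ⁻¹-φ = λ ((l , p) , s) → cong (λ l → (l , p) , s) (next-back l)
    ; preserves = λ {A} {A′} eq → good-permute (permutation back next back-next next-back) arc-back {A} {A′}
        λ l p → cong₂ _,_ (eq ((l , p) , true)) (eq ((l , p) , false))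
    ; preserves⁻¹ = λ {A} {A′} eq → good-permute (permutation next back next-back back-next) arc-next
        {A} {A′}
        λ l p → cong₂ _,_ (eq ((l , p) , true)) (eq ((l , p) , false))
    } , refl

  -- Multiplication by t on block i and by t⁻¹ on block j.
  turn : Block → Block → Point → Point
  turn i j ((l , p) , s) with l Fin.≟ i | l Fin.≟ j
  ... | yes _ | _ = (l , τ p) , s xor wraps p
  ... | no _ | yes _ = (l , τ⁻¹ p) , s xor wraps (τ⁻¹ p)
  ... | no _ | no _ = (l , p) , s

  turn-first : ∀ i j p s → turn i j ((i , p) , s) ≡ ((i , τ p) , s xor wraps p)
  turn-first i j p s with i Fin.≟ i | i Fin.≟ j
  ... | yes _ | _ = refl
  ... | no i≢i | _ = ⊥-elim (i≢i refl)

  turn-second : ∀ {i j} → i ≢ j → ∀ p s → turn i j ((j , p) , s) ≡ ((j , τ⁻¹ p) , s xor wraps (τ⁻¹ p))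
  turn-second {i} {j} i≢j p s with j Fin.≟ i | j Fin.≟ j
  ... | yes eq | _ = ⊥-elim (i≢j (sym eq))
  ... | no _ | yes _ = refl
  ... | no _ | no j≢j = ⊥-elim (j≢j refl)

  turn-other : ∀ {i j l} → l ≢ i → l ≢ j → ∀ p s → turn i j ((l , p) , s) ≡ ((l , p) , s)
  turn-other {i} {j} {l} l≢i l≢j p s with l Fin.≟ i | l Fin.≟ j
  ... | yes eq | _ = ⊥-elim (l≢i eq)
  ... | no _ | yes eq = ⊥-elim (l≢j eq)
  ... | no _ | no _ = refl

  xor-twice : ∀ s w → (s xor w) xor w ≡ s
  xor-twice s w = trans (Bool.xor-assoc s w w) (trans (cong (s xor_) (Bool.xor-same w))
      (Bool.xor-identityʳ s))

  turn-turn : ∀ {i j} → i ≢ j → ∀ y → turn j i (turn i j y) ≡ y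
  turn-turn {i} {j} i≢j ((l , p) , s) = lemma (l Fin.≟ i) (l Fin.≟ j)
    where
    lemma : Dec (l ≡ i) → Dec (l ≡ j) → turn j i (turn i j ((l , p) , s)) ≡ ((l , p) , s)
    lemma (yes refl) _ = begin
      turn j i (turn i j ((i , p) , s)) ≡⟨ cong (turn j i) (turn-first i j p s) ⟩
      turn j i ((i , τ p) , s xor wraps p) ≡⟨ turn-second (i≢j ∘ sym) (τ p) _ ⟩
      ((i , τ⁻¹ (τ p)) , (s xor wraps p) xor wraps (τ⁻¹ (τ p))) ≡⟨ cong
          (λ q → (i , q) , (s xor wraps p) xor wraps q) (τ⁻¹-τ p) ⟩
      ((i , p) , (s xor wraps p) xor wraps p) ≡⟨ cong ((i , p) ,_) (xor-twice s (wraps p)) ⟩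
      ((i , p) , s) ∎
      where open ≡-Reasoning
    lemma (no l≢i) (yes refl) = begin
      turn j i (turn i j ((j , p) , s)) ≡⟨ cong (turn j i) (turn-second i≢j p s) ⟩
      turn j i ((j , τ⁻¹ p) , s xor wraps (τ⁻¹ p)) ≡⟨ turn-first j i (τ⁻¹ p) _ ⟩
      ((j , τ (τ⁻¹ p)) , (s xor wraps (τ⁻¹ p)) xor wraps (τ⁻¹ p)) ≡⟨ cong₂ (λ q u → (j , q) , u)
          (τ-τ⁻¹ p) (xor-twice s (wraps (τ⁻¹ p))) ⟩
      ((j , p) , s) ∎
      where open ≡-Reasoning
    lemma (no l≢i) (no l≢j) = trans (cong (turn j i) (turn-other l≢i l≢j p s)) (turn-other l≢j l≢i p s)

  turn-preserves : ∀ {i j} → i ≢ j → Preserves (turn i j)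
  turn-preserves {i} {j} i≢j {A} {A′} eq = good-shift {i} {j} {A} {A′} {M} i≢j
    ((λ p → trans (M-i (τ p)) (turned p (A i p) (A′ i (τ p)) λ s →
        trans (cong (bit A′) (sym (turn-first i j p s))) (eq ((i , p) , s)))) ,
     λ l l≢i p → M-other l≢i p)
    ((λ p → trans (M-other (i≢j ∘ sym) (τ p)) (turned p (A′ j p) (A j (τ p)) λ s → turn-back p s)) ,
     λ l l≢j p → untouched l l≢j p)
    where
    M : Config
    M l with l Fin.≟ i
    ... | yes _ = A′ l
    ... | no _ = A l
    M-i : ∀ p → M i p ≡ A′ i p
    M-i p with i Fin.≟ i
    ... | yes _ = refl
    ... | no i≢i = ⊥-elim (i≢i refl)
    M-other : ∀ {l} → l ≢ i → ∀ p → M l p ≡ A l p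
    M-other {l} l≢i p with l Fin.≟ i
    ... | yes l≡i = ⊥-elim (l≢i l≡i)
    ... | no _ = refl
    turned : ∀ (p : J m) x y → (∀ s → pick (s xor wraps p) y ≡ pick s x) → y ≡ swapIf (wraps p) x
    turned p x y h with wraps p
    ... | false = cong₂ _,_ (h true) (h false)
    ... | true = cong₂ _,_ (h false) (h true)
    turn-back : ∀ p s → pick (s xor wraps p) (A j (τ p)) ≡ pick s (A′ j p)
    turn-back p s = trans (sym (eq ((j , τ p) , s xor wraps p))) (cong (bit A′) (begin
      turn i j ((j , τ p) , s xor wraps p)                    ≡⟨ turn-second i≢j (τ p) _ ⟩
      ((j , τ⁻¹ (τ p)) , (s xor wraps p) xor wraps (τ⁻¹ (τ p))) ≡⟨ cong
          (λ q → (j , q) , (s xor wraps p) xor wraps q) (τ⁻¹-τ p) ⟩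
      ((j , p) , (s xor wraps p) xor wraps p)                 ≡⟨ cong ((j , p) ,_) (xor-twice s (wraps p)) ⟩
      ((j , p) , s) ∎))
      where open ≡-Reasoning
    untouched : ∀ l → l ≢ j → ∀ p → M l p ≡ A′ l p
    untouched l l≢j p with l Fin.≟ i
    ... | yes refl = refl
    ... | no l≢i = cong₂ _,_ (lemma true) (lemma false)
      where
      lemma : ∀ s → pick s (A l p) ≡ pick s (A′ l p)
      lemma s = trans (sym (eq ((l , p) , s))) (cong (bit A′) (turn-other l≢i l≢j p s))

  turn~ : ∀ i p s → ((i , p) , s) ~ ((i , τ p) , s xor wraps p)
  turn~ i p s = record
    { φ = turn i j ; φ⁻¹ = turn j i
    ; φ-φ⁻¹ = turn-turn (i≢j ∘ sym) ; φ⁻¹-φ = turn-turn i≢j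
    ; preserves = turn-preserves i≢j ; preserves⁻¹ = turn-preserves (i≢j ∘ sym)
    } , turn-first i j p s
    where
    -- The block that absorbs t⁻¹; for block 0 it is the last block, different from it because h >
    -- 0.
    distinct : ∀ i → ∃ λ j → i ≢ j
    distinct zero = back zero , λ eq → ℕ.<-irrefl (trans (cong toℕ eq) (Fin.toℕ-fromℕ _))
        (ℕ.<-≤-trans 0<h (ℕ.m≤m*n h 2))
    distinct (suc i) = zero , λ ()
    j = proj₁ (distinct i)
    i≢j = proj₂ (distinct i)

  base : Point
  base = (zero , replicate m false) , true

  all~base : ∀ y → y ~ base
  all~base ((l , p) , s) = E.trans (to-zero l) (orbit
      (λ (p , s) (q , u) → ((zero , p) , s) ~ ((zero , q) , u))
    (record { refl = E.refl ; sym = E.sym ; trans = E.trans }) (turn~ zero) (p , s))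
    where
    module E = IsEquivalence ~-isEquivalence
    to-zero : ∀ l → ((l , p) , s) ~ ((zero , p) , s)
    to-zero = <-weakInduction (λ l → ((l , p) , s) ~ ((zero , p) , s)) E.refl λ i ih →
        E.trans (rotate~ (suc i) p s) ih

  module _ (S : Symm) where
    private
      π : Permutation′ n
      π = permutation (from ∘ φ S ∘ to) (from ∘ φ⁻¹ S ∘ to)
        (λ x → trans (cong (from ∘ φ S) (to-from _)) (trans (cong from (φ-φ⁻¹ S (to x))) (from-to x)))
        (λ x → trans (cong (from ∘ φ⁻¹ S) (to-from _)) (trans (cong from (φ⁻¹-φ S (to x))) (from-to x)))

      bit-image : ∀ ℓ y → bit (view (image π ℓ)) y ≡ bit (view ℓ) (φ⁻¹ S y)
      bit-image ℓ y = trans (bit-view (image π ℓ) y) (trans (lookup∘tabulate _ (from y))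
        (trans (cong (lookup ℓ ∘ from ∘ φ⁻¹ S) (to-from y)) (sym (bit-view ℓ (φ⁻¹ S y)))))

      bit-complement-image : ∀ ℓ y → bit (complement (view (image π ℓ))) y ≡ bit (complement (view ℓ))
          (φ⁻¹ S y)
      bit-complement-image ℓ y = trans (bit-complement (view (image π ℓ)) y)
        (trans (cong not (bit-image ℓ y)) (sym (bit-complement (view ℓ) (φ⁻¹ S y))))

      image-line : ∀ {ℓ} → Line ℓ → Line (image π ℓ)
      image-line {ℓ} = preserves S {complement (view ℓ)} {complement (view (image π ℓ))} λ y →
        trans (bit-complement-image ℓ (φ S y)) (cong (bit (complement (view ℓ))) (φ⁻¹-φ S y))

      line-image : ∀ {ℓ} → Line (image π ℓ) → Line ℓ
      line-image {ℓ} = preserves⁻¹ S {complement (view (image π ℓ))} {complement (view ℓ)} λ y →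
        sym (bit-complement-image ℓ y)

      image-flip : ∀ ℓ → image π (image (flip π) ℓ) ≡ ℓ
      image-flip ℓ = trans (tabulate-cong λ x → trans (lookup∘tabulate _ (π ⟨$⟩ˡ x))
          (cong (lookup ℓ) (inverseʳ π)))
        (tabulate∘lookup ℓ)

    symm-automorphism : ∃ λ π → IsAutomorphism lines π × ∀ y → π ⟨$⟩ʳ from y ≡ from (φ S y)
    symm-automorphism = π ,
      ((λ ℓ ℓ∈ → line⁺ {image π ℓ} (image-line {ℓ} (line⁻ {ℓ} ℓ∈))) ,
       (λ ℓ ℓ∈ → image (flip π) ℓ , line⁺ {image (flip π) ℓ}
           (line-image {image (flip π) ℓ} (subst Line (sym (image-flip ℓ)) (line⁻ {ℓ} ℓ∈))) ,
           image-flip ℓ)) ,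
      λ y → cong (from ∘ φ S) (to-from y)

  transitive : IsTransitive lines
  transitive x y = let
      (S , eq) = E.trans (all~base (to x)) (E.sym (all~base (to y)))
      (π , auto , π-φ) = symm-automorphism S
    in π , auto , trans (cong (π ⟨$⟩ʳ_) (sym (from-to x)))
        (trans (π-φ (to x)) (trans (cong from eq) (from-to y)))
    where module E = IsEquivalence ~-isEquivalence

-- Coordinates on the board and the conclusion

open import Data.Nat using (_*_; _^_; _%_)

binary : ∀ m → Fin (2 ^ m) ↔ Vec Bool m
binary zero = mk↔ₛ′ (λ _ → []) (λ _ → zero) (λ { [] → refl }) (λ { zero → refl })
binary (suc m) = cons ↔-∘ ((Fin.2↔Bool ×-↔ binary m) ↔-∘ Fin.*↔× {2} {2 ^ m})
  where
  cons : (Bool × Vec Bool m) ↔ Vec Bool (suc m)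
  cons = mk↔ₛ′ (λ (x , xs) → x ∷ xs) (λ { (x ∷ xs) → x , xs }) (λ { (x ∷ xs) → refl })
      (λ { (x , xs) → refl })

-- Of the m + 1 binary digits locating a point in its block, the first is the sign and the others
-- form the exponent.
board : ∀ m b → Fin (2 ^ suc m * b) ↔ ((Fin b × J m) × Bool)
board m b = rearranged ↔-∘ ((binary (suc m) ×-↔ ↔-id (Fin b)) ↔-∘ Fin.*↔× {2 ^ suc m} {b})
  where
  rearranged : (Vec Bool (suc m) × Fin b) ↔ ((Fin b × J m) × Bool)
  rearranged = mk↔ₛ′ (λ { (s ∷ j , i) → (i , j) , s }) (λ ((i , j) , s) → s ∷ j , i) (λ _ → refl)
      (λ { (_ ∷ _ , _) → refl })

odd-form : ∀ b → b % 2 ≡ 1 → ∃ λ h → b ≡ suc (h * 2)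
odd-form b eq = b ℕ./ 2 , trans (ℕ.m≡m%n+[m/n]*n b 2) (cong (ℕ._+ b ℕ./ 2 * 2) eq)

theorem13 : (a b : ℕ) → 1 ≤ a → 1 < b → b % 2 ≡ 1 →
    Σ (AvoidanceGame (2 ^ a * b)) λ L → IsTransitive L × IsPlayerIWin L
theorem13 (suc m) b _ 1<b b-odd with odd-form b b-odd
-- Here b would be 1; otherwise h > 0 and `Transitivity` has its second block.
... | zero , refl with s≤s () ← 1<b
... | suc h′ , refl = lines , transitive , playerI-wins
  where
  h = suc h′
  open Inverse (board m (suc (h * 2))) using (to; from; strictlyInverseˡ; strictlyInverseʳ)
  open Transfer m h _ to from strictlyInverseˡ strictlyInverseʳ using (lines; playerI-wins)
  open Transitivity m h _ (s≤s z≤n) to from strictlyInverseˡ strictlyInverseʳ using (transitive)
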